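{- Let $L=\mathbb{Q}(\sqrt m,\sqrt n)$ be a biquadratic extension of $\mathbb{Q}$ with $m,n$ square-free, $m\equiv1\pmod 4$ and $n\equiv 2$ or $3\pmod 4$. Let $d=\gcd(m,n)$, $k=\frac{mn}{d^2}$, and let $H_1$ be the non-classical Hopf-Galois structure on $L/\mathbb{Q}$ corresponding to $\sqrt m$. Then $\mathcal{O}_L$ is $\mathfrak{A}_{H_1}$-free if and only if there exist integers $x,y\in\mathbb{Z}$ such that at least one of the equations $x^2+my^2=\pm2d$ is satisfied. If it is so, a free generator of $\mathcal{O}_L$ as $\mathfrak{A}_{H_1}$-module is $$\beta=\gamma_1-\gamma_2+\frac{x-dy}{2d}\,\gamma_3+y\,\gamma_4,$$ where $\gamma_1=1,\ \gamma_2=\frac{1+\sqrt m}{2},\ \gamma_3=\sqrt n,\ \gamma_4=\frac{\sqrt n+\sqrt k}{2}$.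
   Context: $L=\mathbb{Q}(\sqrt m,\sqrt n)$ has Galois group $C_2\times C_2$; its quadratic subfields are $\mathbb{Q}(\sqrt m),\mathbb{Q}(\sqrt n),\mathbb{Q}(\sqrt k)$, with $\sqrt k=\sqrt m\sqrt n/d$ and $d=\gcd(m,n)>0$. Here $n\equiv k\pmod 4$ and $\{\gamma_1,\gamma_2,\gamma_3,\gamma_4\}$ is an integral basis of $L$. A Hopf-Galois structure on $L/\mathbb{Q}$ is a finite-dimensional cocommutative $\mathbb{Q}$-Hopf algebra $H$ with an action making $L$ a left $H$-module algebra such that $L\otimes_{\mathbb{Q}} H\to\mathrm{End}_{\mathbb{Q}}(L)$, $x\otimes h\mapsto(y\mapsto x(h\cdot y))$ is bijective. Besides the classical one $\mathbb{Q}[\mathrm{Gal}(L/\mathbb{Q})]$, there are exactly three, one for each $\zeta\in\{\sqrt m,\sqrt n,\sqrt k\}$. Explicitly, let $\tau$ generate $\mathrm{Gal}(L/\mathbb{Q}(\zeta))$ and let $\sigma\in\mathrm{Gal}(L/\mathbb{Q})\setminus\langle\tau\rangle$; since the action is faithful, the structure corresponding to $\zeta$ is identified, as an algebra acting on $L$, with the subalgebra of $\mathrm{End}_{\mathbb{Q}}(L)$ having $\mathbb{Q}$-basis $\mathrm{id},\ \tau,\ \sigma+\sigma\tau,\ \zeta(\sigma-\sigma\tau)$. The associated order is $\mathfrak{A}_H=\{h\in H: h\cdot\mathcal{O}_L\subseteq\mathcal{O}_L\}$; "$\mathcal{O}_L$ is $\mathfrak{A}_H$-free" means free (of rank one) as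 $\mathfrak{A}_H$-module, and a free generator is a $\beta\in\mathcal{O}_L$ such that $\mathfrak{A}_H\to\mathcal{O}_L$, $h\mapsto h\cdot\beta$, is bijective. -}

module Defs where

open import Algebra.Consequences.Propositional
  using (comm∧idˡ⇒id; comm∧invˡ⇒inv; comm∧distrˡ⇒distr)
open import Algebra.Structures using (IsCommutativeRing)
open import Data.Fin.Base using (zero; suc)
open import Data.Fin using (#_)
open import Data.Integer.Base as ℤ using (ℤ; +_; ∣_∣)
import Data.Integer.Properties as ℤ
open import Data.List.Base using (List; foldr)
open import Data.Nat.Base as ℕ using (ℕ; suc; NonZero)
import Data.Nat.Divisibility as ℕ
import Data.Nat.GCD as ℕ
import Data.Nat.Properties as ℕ
open import Data.Product.Base using (Σ; ∃; _×_; _,_; proj₁)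
open import Data.Rational.Base as ℚ using (ℚ; 0ℚ; 1ℚ; ½; _/_)
import Data.Rational.Properties as ℚ
open import Data.Rational.Solver using (module +-*-Solver)
open import Data.Rational.Unnormalised.Base as ℚᵘ using (mkℚᵘ)
import Data.Rational.Unnormalised.Properties as ℚᵘ
open import Data.Sum.Base using (inj₁)
open import Data.Vec.Base using (Vec; []; _∷_)
open import Function.Definitions using (Bijective)
open import Level using (0ℓ)
open import Relation.Binary.PropositionalEquality
open import Relation.Binary.PropositionalEquality.Algebra using (isMagma)
import Relation.Binary.Reasoning.Setoid as ≈-Reasoning
open import Relation.Unary using (Pred; _∈_)

SquareFree : ℤ → Set
SquareFree z = ∀ (a : ℕ) → (a ℕ.* a) ℕ.∣ ∣ z ∣ → a ≡ 1

-- The nonzero hypotheses serve only to make gcd(m , n) a legal denominator;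
-- they hold automatically for square-free integers.
module Biquadratic (m n : ℤ) .{{_ : ℤ.NonZero m}} .{{_ : ℤ.NonZero n}} where

  d : ℕ
  d = ℕ.gcd ∣ m ∣ ∣ n ∣

  instance
    d-nonZero : NonZero d
    d-nonZero = ℕ.≢-nonZero
      (ℕ.gcd[m,n]≢0 ∣ m ∣ ∣ n ∣ (inj₁ (ℕ.≢-nonZero⁻¹ ∣ m ∣)))

    2d-nonZero : NonZero (2 ℕ.* d)
    2d-nonZero = ℕ.m*n≢0 2 d

    dd-nonZero : NonZero (d ℕ.* d)
    dd-nonZero = ℕ.m*n≢0 d d

  mℚ nℚ : ℚ
  mℚ = m / 1
  nℚ = n / 1

  -- ⟨ a , b , c , e ⟩ stands for a + b √m + c √n + e √m √n, so that L is the
  -- ℚ-algebra ℚ[X , Y] / (X² - m , Y² - n).  ℚ(√m , √n) / ℚ has degree 4 exactly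
  -- when this algebra is a field, and it is then ℚ(√m , √n).
  record L : Set where
    constructor ⟨_,_,_,_⟩
    field
      c₁ cₘ cₙ cₘₙ : ℚ

  open L public

  infixl 6 _+_ _-_
  infixl 7 _*_ _·_
  infix  8 -_

  _+_ : L → L → L
  ⟨ a , b , c , e ⟩ + ⟨ a′ , b′ , c′ , e′ ⟩ =
    ⟨ a ℚ.+ a′ , b ℚ.+ b′ , c ℚ.+ c′ , e ℚ.+ e′ ⟩

  -_ : L → L
  - ⟨ a , b , c , e ⟩ = ⟨ ℚ.- a , ℚ.- b , ℚ.- c , ℚ.- e ⟩

  _-_ : L → L → L
  x - y = x + - y

  _*_ : L → L → L
  ⟨ a , b , c , e ⟩ * ⟨ a′ , b′ , c′ , e′ ⟩ =
    ⟨ a ℚ.* a′ ℚ.+ mℚ ℚ.* (b ℚ.* b′) ℚ.+ nℚ ℚ.* (c ℚ.* c′)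
        ℚ.+ mℚ ℚ.* nℚ ℚ.* (e ℚ.* e′)
    , a ℚ.* b′ ℚ.+ b ℚ.* a′ ℚ.+ nℚ ℚ.* (c ℚ.* e′ ℚ.+ e ℚ.* c′)
    , a ℚ.* c′ ℚ.+ c ℚ.* a′ ℚ.+ mℚ ℚ.* (b ℚ.* e′ ℚ.+ e ℚ.* b′)
    , a ℚ.* e′ ℚ.+ e ℚ.* a′ ℚ.+ b ℚ.* c′ ℚ.+ c ℚ.* b′
    ⟩

  _·_ : ℚ → L → L
  q · ⟨ a , b , c , e ⟩ = ⟨ q ℚ.* a , q ℚ.* b , q ℚ.* c , q ℚ.* e ⟩

  fromℚ : ℚ → L
  fromℚ q = ⟨ q , 0ℚ , 0ℚ , 0ℚ ⟩

  0L 1L √m √n √k : L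
  0L = fromℚ 0ℚ
  1L = fromℚ 1ℚ
  √m = ⟨ 0ℚ , 1ℚ , 0ℚ , 0ℚ ⟩
  √n = ⟨ 0ℚ , 0ℚ , 1ℚ , 0ℚ ⟩
  √k = (+ 1 / d) · (√m * √n)

  IsBiquadraticField : Set
  IsBiquadraticField = ∀ x → x ≢ 0L → ∃ λ y → x * y ≡ 1L

  -- cs lists the coefficients c₀ , c₁ , … , c_{r-1} (in this order) of the monic
  -- polynomial X^r + c_{r-1} X^{r-1} + … + c₀, evaluated by Horner's rule.
  evalMonic : List ℤ → L → L
  evalMonic cs x = foldr (λ c v → fromℚ (c / 1) + x * v) 1L cs

  𝓞 : Pred L 0ℓ
  𝓞 x = ∃ λ cs → evalMonic cs x ≡ 0L

  -- τ generates Gal(L / ℚ(√m)) and σ generates Gal(L / ℚ(√n)).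
  τ σ : L → L
  τ ⟨ a , b , c , e ⟩ = ⟨ a , b , ℚ.- c , ℚ.- e ⟩
  σ ⟨ a , b , c , e ⟩ = ⟨ a , ℚ.- b , c , ℚ.- e ⟩

  -- The non-classical Hopf-Galois structure corresponding to √m.  Its action on L
  -- is faithful, so it is identified with its image in End_ℚ(L), the ℚ-span of
  -- id, τ, σ + στ and √m (σ - στ).  Taking στ in place of σ changes only the sign
  -- of the last one.
  H₁ : Pred (L → L) 0ℓ
  H₁ h = Σ ℚ λ q₁ → Σ ℚ λ q₂ → Σ ℚ λ q₃ → Σ ℚ λ q₄ → ∀ x →
    h x ≡ q₁ · x + q₂ · τ x + q₃ · (σ x + σ (τ x)) + q₄ · (√m * (σ x - σ (τ x)))

  -- 𝔄 H is the associated order of H.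
  𝔄 : Pred (L → L) 0ℓ → Pred (L → L) 0ℓ
  𝔄 H h = h ∈ H × (∀ x → x ∈ 𝓞 → h x ∈ 𝓞)

  module _ (H : Pred (L → L) 0ℓ) where

    actOn : ∀ β → β ∈ 𝓞 → ∃ (𝔄 H) → ∃ 𝓞
    actOn β β∈𝓞 (h , _ , h𝓞⊆𝓞) = h β , h𝓞⊆𝓞 β β∈𝓞

    -- Elements of H are compared as maps on L, and elements of 𝓞 as elements of L.
    IsFreeGenerator : Pred L 0ℓ
    IsFreeGenerator β = Σ (β ∈ 𝓞) λ β∈𝓞 →
      Bijective {A = ∃ (𝔄 H)} {B = ∃ 𝓞}
        (λ h h′ → proj₁ h ≗ proj₁ h′) (λ x y → proj₁ x ≡ proj₁ y) (actOn β β∈𝓞)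

    IsFree : Set
    IsFree = ∃ IsFreeGenerator

  γ₁ γ₂ γ₃ γ₄ : L
  γ₁ = 1L
  γ₂ = ½ · (1L + √m)
  γ₃ = √n
  γ₄ = ½ · (√n + √k)

  genβ : ℤ → ℤ → L
  genβ x y = γ₁ - γ₂ + ((x ℤ.- + d ℤ.* y) / (2 ℕ.* d)) · γ₃ + (y / 1) · γ₄

  -- Checks of the model: L is a commutative ring, √m, √n, √k are square roots of
  -- m, n and k = mn / d², and τ, σ are multiplicative.

  private
    ext : ∀ {a a′ b b′ c c′ e e′} → a ≡ a′ → b ≡ b′ → c ≡ c′ → e ≡ e′ →
          ⟨ a , b , c , e ⟩ ≡ ⟨ a′ , b′ , c′ , e′ ⟩
    ext refl refl refl refl = refl

  private
    open +-*-Solver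

    -- The operations of L on quadruples of polynomial expressions, where the
    -- first two variables stand for mℚ and nℚ.
    record P (r : ℕ) : Set where
      constructor ⟪_,_,_,_⟫
      field p₁ pₘ pₙ pₘₙ : Polynomial (2 ℕ.+ r)
    open P

    M N : ∀ {r} → Polynomial (2 ℕ.+ r)
    M = var zero
    N = var (suc zero)

    infixl 6 _⊕_
    infixl 7 _⊗_
    _⊕_ _⊗_ : ∀ {r} → P r → P r → P r
    ⟪ a , b , c , e ⟫ ⊕ ⟪ a′ , b′ , c′ , e′ ⟫ =
      ⟪ a :+ a′ , b :+ b′ , c :+ c′ , e :+ e′ ⟫
    ⟪ a , b , c , e ⟫ ⊗ ⟪ a′ , b′ , c′ , e′ ⟫ =
      ⟪ a :* a′ :+ M :* (b :* b′) :+ N :* (c :* c′) :+ M :* N :* (e :* e′)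
      , a :* b′ :+ b :* a′ :+ N :* (c :* e′ :+ e :* c′)
      , a :* c′ :+ c :* a′ :+ M :* (b :* e′ :+ e :* b′)
      , a :* e′ :+ e :* a′ :+ b :* c′ :+ c :* b′
      ⟫
    τP σP : ∀ {r} → P r → P r
    τP ⟪ a , b , c , e ⟫ = ⟪ a , b , :- c , :- e ⟫
    σP ⟪ a , b , c , e ⟫ = ⟪ a , :- b , c , :- e ⟫

    O I : ∀ {r} → Polynomial (2 ℕ.+ r)
    O = con 0ℚ
    I = con 1ℚ
    √mP √nP : ∀ {r} → P r
    √mP = ⟪ O , I , O , O ⟫
    √nP = ⟪ O , O , I , O ⟫
    _⊙_ : ∀ {r} → Polynomial (2 ℕ.+ r) → P r → P r
    q ⊙ ⟪ a , b , c , e ⟫ = ⟪ q :* a , q :* b , q :* c , q :* e ⟫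

    X : ∀ {r} → P (4 ℕ.+ r)
    X = ⟪ var (# 2) , var (# 3) , var (# 4) , var (# 5) ⟫
    Y : ∀ {r} → P (8 ℕ.+ r)
    Y = ⟪ var (# 6) , var (# 7) , var (# 8) , var (# 9) ⟫
    Z : P 12
    Z = ⟪ var (# 10) , var (# 11) , var (# 12) , var (# 13) ⟫

    env₂ : L → L → Vec ℚ 10
    env₂ ⟨ a , b , c , e ⟩ ⟨ a′ , b′ , c′ , e′ ⟩ =
      mℚ ∷ nℚ ∷ a ∷ b ∷ c ∷ e ∷ a′ ∷ b′ ∷ c′ ∷ e′ ∷ []
    env₃ : L → L → L → Vec ℚ 14
    env₃ ⟨ a , b , c , e ⟩ ⟨ a′ , b′ , c′ , e′ ⟩ ⟨ a″ , b″ , c″ , e″ ⟩ =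
      mℚ ∷ nℚ ∷ a ∷ b ∷ c ∷ e ∷ a′ ∷ b′ ∷ c′ ∷ e′ ∷ a″ ∷ b″ ∷ c″ ∷ e″ ∷ []

  +-comm : ∀ x y → x + y ≡ y + x
  +-comm x y = ext (eq c₁) (eq cₘ) (eq cₙ) (eq cₘₙ)
    where eq = λ (c : L → ℚ) → ℚ.+-comm (c x) (c y)

  +-assoc : ∀ x y z → x + y + z ≡ x + (y + z)
  +-assoc x y z = ext (eq c₁) (eq cₘ) (eq cₙ) (eq cₘₙ)
    where eq = λ (c : L → ℚ) → ℚ.+-assoc (c x) (c y) (c z)

  +-identityˡ : ∀ x → 0L + x ≡ x
  +-identityˡ x = ext (eq c₁) (eq cₘ) (eq cₙ) (eq cₘₙ)
    where eq = λ (c : L → ℚ) → ℚ.+-identityˡ (c x)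

  +-inverseˡ : ∀ x → - x + x ≡ 0L
  +-inverseˡ x = ext (eq c₁) (eq cₘ) (eq cₙ) (eq cₘₙ)
    where eq = λ (c : L → ℚ) → ℚ.+-inverseˡ (c x)

  *-identityˡ : ∀ x → 1L * x ≡ x
  *-identityˡ x = ext (eq p₁ refl) (eq pₘ refl) (eq pₙ refl) (eq pₘₙ refl)
    where eq = λ (c : P 8 → Polynomial 10) →
                 prove (env₂ x x) (c (⟪ I , O , O , O ⟫ ⊗ X)) (c X)

  *-comm : ∀ x y → x * y ≡ y * x
  *-comm x y = ext (eq p₁ refl) (eq pₘ refl) (eq pₙ refl) (eq pₘₙ refl)
    where eq = λ (c : P 8 → Polynomial 10) → prove (env₂ x y) (c (X ⊗ Y)) (c (Y ⊗ X))

  *-assoc : ∀ x y z → x * y * z ≡ x * (y * z)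
  *-assoc x y z = ext (eq p₁ refl) (eq pₘ refl) (eq pₙ refl) (eq pₘₙ refl)
    where eq = λ (c : P 12 → Polynomial 14) →
                 prove (env₃ x y z) (c (X ⊗ Y ⊗ Z)) (c (X ⊗ (Y ⊗ Z)))

  *-distribˡ-+ : ∀ x y z → x * (y + z) ≡ x * y + x * z
  *-distribˡ-+ x y z = ext (eq p₁ refl) (eq pₘ refl) (eq pₙ refl) (eq pₘₙ refl)
    where eq = λ (c : P 12 → Polynomial 14) →
                 prove (env₃ x y z) (c (X ⊗ (Y ⊕ Z))) (c (X ⊗ Y ⊕ X ⊗ Z))

  isCommutativeRing : IsCommutativeRing _≡_ _+_ _*_ (λ x → - x) 0L 1L
  isCommutativeRing = record
    { isRing = record
      { +-isAbelianGroup = record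
        { isGroup = record
          { isMonoid = record
            { isSemigroup = record
              { isMagma = isMagma _+_
              ; assoc = +-assoc
              }
            ; identity = comm∧idˡ⇒id +-comm +-identityˡ
            }
          ; inverse = comm∧invˡ⇒inv +-comm +-inverseˡ
          ; ⁻¹-cong = cong λ x → - x
          }
        ; comm = +-comm
        }
      ; *-cong = cong₂ _*_
      ; *-assoc = *-assoc
      ; *-identity = comm∧idˡ⇒id *-comm *-identityˡ
      ; distrib = comm∧distrˡ⇒distr (cong₂ _+_) *-comm *-distribˡ-+
      }
    ; *-comm = *-comm
    }

  √m*√m : √m * √m ≡ fromℚ mℚ
  √m*√m = ext (eq p₁ refl) (eq pₘ refl) (eq pₙ refl) (eq pₘₙ refl)
    where eq = λ (c : P 0 → Polynomial 2) →
                 prove (mℚ ∷ nℚ ∷ []) (c (√mP ⊗ √mP)) (c ⟪ M , O , O , O ⟫)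

  √n*√n : √n * √n ≡ fromℚ nℚ
  √n*√n = ext (eq p₁ refl) (eq pₘ refl) (eq pₙ refl) (eq pₘₙ refl)
    where eq = λ (c : P 0 → Polynomial 2) →
                 prove (mℚ ∷ nℚ ∷ []) (c (√nP ⊗ √nP)) (c ⟪ N , O , O , O ⟫)

  √k*√k : √k * √k ≡ fromℚ ((m ℤ.* n) / (d ℕ.* d))
  √k*√k = trans (ext (eq p₁ refl) (eq pₘ refl) (eq pₙ refl) (eq pₘₙ refl))
                (cong fromℚ (sym k≡))
    where
    D : Polynomial 3
    D = var (# 2)
    √kP : P 1
    √kP = D ⊙ (√mP ⊗ √nP)
    eq = λ (c : P 1 → Polynomial 3) →
           prove (mℚ ∷ nℚ ∷ + 1 / d ∷ [])
             (c (√kP ⊗ √kP)) (c ⟪ M :* N :* (D :* D) , O , O , O ⟫)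

    *-/ : ∀ i j p q .{{_ : NonZero p}} .{{_ : NonZero q}} .{{_ : NonZero (p ℕ.* q)}} →
          (i ℤ.* j) / (p ℕ.* q) ≡ (i / p) ℚ.* (j / q)
    *-/ i j p@(suc p-1) q@(suc q-1) = ℚ.toℚᵘ-injective (begin
      ℚ.toℚᵘ ((i ℤ.* j) / (p ℕ.* q))
        ≈⟨ ℚ.toℚᵘ-fromℚᵘ (mkℚᵘ i p-1 ℚᵘ.* mkℚᵘ j q-1) ⟩
      mkℚᵘ i p-1 ℚᵘ.* mkℚᵘ j q-1
        ≈⟨ ℚᵘ.*-cong (ℚ.toℚᵘ-fromℚᵘ (mkℚᵘ i p-1)) (ℚ.toℚᵘ-fromℚᵘ (mkℚᵘ j q-1)) ⟨
      ℚ.toℚᵘ (i / p) ℚᵘ.* ℚ.toℚᵘ (j / q)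
        ≈⟨ ℚ.toℚᵘ-homo-* (i / p) (j / q) ⟨
      ℚ.toℚᵘ ((i / p) ℚ.* (j / q)) ∎)
      where open ≈-Reasoning ℚᵘ.≃-setoid

    k≡ : (m ℤ.* n) / (d ℕ.* d) ≡ mℚ ℚ.* nℚ ℚ.* ((+ 1 / d) ℚ.* (+ 1 / d))
    k≡ = begin
      (m ℤ.* n) / (d ℕ.* d)
        ≡⟨ ℚ./-cong (sym (ℤ.*-identityʳ (m ℤ.* n))) (sym (ℕ.*-identityˡ (d ℕ.* d))) ⟩
      ((m ℤ.* n) ℤ.* + 1) / (1 ℕ.* (d ℕ.* d))
        ≡⟨ *-/ (m ℤ.* n) (+ 1) 1 (d ℕ.* d) ⟩
      ((m ℤ.* n) / 1) ℚ.* (+ 1 / (d ℕ.* d))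
        ≡⟨ cong₂ ℚ._*_ (*-/ m n 1 1) (*-/ (+ 1) (+ 1) d d) ⟩
      mℚ ℚ.* nℚ ℚ.* ((+ 1 / d) ℚ.* (+ 1 / d)) ∎
      where
      open ≡-Reasoning
      instance
        1dd : NonZero (1 ℕ.* (d ℕ.* d))
        1dd = ℕ.m*n≢0 1 (d ℕ.* d)

  τ-* : ∀ x y → τ (x * y) ≡ τ x * τ y
  τ-* x y = ext (eq p₁ refl) (eq pₘ refl) (eq pₙ refl) (eq pₘₙ refl)
    where eq = λ (c : P 8 → Polynomial 10) →
                 prove (env₂ x y) (c (τP (X ⊗ Y))) (c (τP X ⊗ τP Y))

  σ-* : ∀ x y → σ (x * y) ≡ σ x * σ y
  σ-* x y = ext (eq p₁ refl) (eq pₘ refl) (eq pₙ refl) (eq pₘₙ refl)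
    where eq = λ (c : P 8 → Polynomial 10) →
                 prove (env₂ x y) (c (σP (X ⊗ Y))) (c (σP X ⊗ σP Y))

{-# OPTIONS --safe #-}
module Submission where

-- Write k = m n / d², m = m′ d and n = n′ d.  Every integral element of L is almost integral:
-- its powers have a common denominator.  Hence its relative traces and norms satisfy integrality
-- conditions which, read modulo 4, show that γ₁, γ₂, γ₃, γ₄ is an integral basis.  In the
-- coordinates a, b, c, f on 1, √m, √n, √k an element of H₁ acts as
-- (a , b , c , f) ↦ (p a , r b , s c - m′ t f , s f + d t c), so H₁ ≅ ℚ × ℚ × ℚ(√-m).
-- The associated order consists of the maps with integers p ≡ r (mod 2) and s, t ∈ ℤ.  On the
-- first two coordinates it is always free of rank one.  On ℤ γ₃ + ℤ γ₄ it acts through ℤ[√-m],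
-- and the form d c² + m′ f², which acting by s + t √-m multiplies by s² + m t², measures the
-- index of a cyclic submodule: an element generates exactly when its value is ± 1 / 2, that is,
-- when x² + m y² = ± 2 d for x = 2 d c and y = 2 f.
open import Defs
open import Data.Integer using (ℤ; +_; -_; _+_; _*_; NonZero)
open import Data.Integer.DivMod using (_%ℕ_)
open import Data.Nat using () renaming (_*_ to _*ℕ_)
open import Data.Product using (_×_; ∃-syntax)
open import Data.Sum using (_⊎_)
open import Function.Bundles using (_⇔_)
open import Relation.Binary.PropositionalEquality using (_≡_)

open import Algebra.Bundles using (CommutativeRing)
import Algebra.Properties.CommutativeSemiring.Exp as Exp
import Algebra.Properties.Group as Group
import Algebra.Properties.Ring as Ring
import Algebra.Solver.Ring as ScalarSolver
import Algebra.Solver.Ring.AlmostCommutativeRing as ACR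
open import Algebra.Structures using (IsCommutativeRing)
open import Data.Bool using (Bool; true; T; _∧_; if_then_else_)
open import Data.Bool.Properties using (T-∧)
open import Data.Fin using (Fin; #_)
open import Data.Integer as ℤ using (∣_∣)
import Data.Integer.Properties as ℤ
open import Data.Integer.DivMod using (_/ℕ_; n%ℕd<d; a≡a%ℕn+[a/ℕn]*n)
open import Data.Integer.Divisibility.Signed
  using (_∣_; divides; quotient; module _∣_; ∣ᵤ⇒∣; ∣⇒∣ᵤ; ∣m∣n⇒∣m+n; ∣m+n∣m⇒∣n; ∣m+n∣n⇒∣m; ∣m⇒∣m*n; ∣n⇒∣m*n)
open import Data.Integer.Tactic.RingSolver using (solve-∀)
open import Data.List using (List; []; _∷_; foldr; length)
open import Data.Maybe using (map)
open import Data.Nat as ℕ using (ℕ; zero; suc; z≤n; s≤s)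
import Data.Nat.Coprimality as ℕ
import Data.Nat.Divisibility as ℕ
import Data.Nat.GCD as ℕ
import Data.Nat.Properties as ℕ
open import Data.Product using (_,_; ∃; proj₁; proj₂)
open import Data.Rational as ℚ using (ℚ; 0ℚ; 1ℚ; ½; _/_; ↥_; ↧_; ↧ₙ_)
import Data.Rational.Properties as ℚ
open import Data.Rational.Unnormalised.Base as ℚᵘ using (mkℚᵘ; *≡*)
import Data.Rational.Unnormalised.Properties as ℚᵘ
open import Data.Sum using (inj₁; inj₂; [_,_]′)
open import Data.Unit using (⊤; tt)
open import Data.Vec as Vec using (Vec; []; _∷_; lookup)
open import Data.Vec.Properties using (lookup-map)
open import Function using (_∘_)
open import Function.Bundles using (Equivalence; mk⇔)
open import Level using (0ℓ)
open import Relation.Binary.PropositionalEquality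
  using (_≢_; _≗_; refl; sym; trans; cong; cong₂; subst; module ≡-Reasoning)
open import Relation.Nullary using (contradiction)
open import Relation.Nullary.Decidable using (dec⇒maybe)
import Tactic.RingSolver as RingSolver
open import Tactic.RingSolver.Core.AlmostCommutativeRing using (AlmostCommutativeRing; fromCommutativeRing)

open Exp (CommutativeRing.commutativeSemiring ℚ.+-*-commutativeRing) using (_^_; ^-distrib-*)
open Ring (CommutativeRing.ring ℚ.+-*-commutativeRing) using (-‿involutive; -‿distribʳ-*)
open ≡-Reasoning

-- `𝓞` asks for a single monic polynomial, which makes sums and products of integral elements hard
-- to control directly. Almost integrality passes to sums, products and conjugates under `τ` and `σ`
-- by bookkeeping of denominators alone, and on ℚ it means being an integer. For the converse
-- inclusion every element of the ℤ-span of the γ's receives an explicit quartic, the norm of its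
-- quadratic polynomial over ℤ[γ₂].
--
-- The congruence behind the Galois module part is `d + m′ ≡ 2 (mod 4)`, a consequence of
-- `m′ d ≡ 1 (mod 4)`. It makes `g = (d + m′) / 2 = 1 + 2 κ` an odd integer, and this `g` is the
-- constant in the matrix of the action on γ₄ and in the form `G`. Since `g` is odd and `m` is
-- square-free, `2 d` and `g` are coprime, which is why no multiplier `s + t √-m` with fractional
-- `t` preserves ℤ γ₃ + ℤ γ₄.

infixl 6 _⊞_
infixl 7 _⊠_
infix  8 ⊟_

-- Divisibility by 4 of integer polynomials, decided by exhausting residues

data Expr (k : ℕ) : Set where
  X       : Fin k → Expr k
  K       : ℕ → Expr k
  _⊞_ _⊠_ : Expr k → Expr k → Expr k
  ⊟_       : Expr k → Expr k

private variable k : ℕ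

⟦_⟧ : Expr k → Vec ℤ k → ℤ
⟦ X i ⟧  ρ = lookup ρ i
⟦ K c ⟧  ρ = + c
⟦ s ⊞ t ⟧ ρ = ⟦ s ⟧ ρ + ⟦ t ⟧ ρ
⟦ s ⊠ t ⟧ ρ = ⟦ s ⟧ ρ * ⟦ t ⟧ ρ
⟦ ⊟ s ⟧   ρ = - ⟦ s ⟧ ρ

-- Modulo 4 the opposite of r is 3 r.
residue : Expr k → Vec ℕ k → ℕ
residue (X i)  ρ = lookup ρ i
residue (K c)  ρ = c
residue (s ⊞ t) ρ = residue s ρ ℕ.+ residue t ρ
residue (s ⊠ t) ρ = residue s ρ ℕ.* residue t ρ
residue (⊟ s)   ρ = 3 ℕ.* residue s ρ

residues : Vec ℤ k → Vec ℕ k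
residues = Vec.map (_%ℕ 4)

-- Values over the residues stay unreduced natural numbers; the explicit quotient lets divisibility
-- by 4 be carried in both directions.
⟦⟧≡residue : ∀ (s : Expr k) ρ → ∃[ q ] ⟦ s ⟧ ρ ≡ + residue s (residues ρ) + q * + 4
⟦⟧≡residue (X i) ρ rewrite lookup-map i (_%ℕ 4) ρ = lookup ρ i /ℕ 4 , a≡a%ℕn+[a/ℕn]*n (lookup ρ i) 4
⟦⟧≡residue (K c) ρ = + 0 , sym (ℤ.+-identityʳ (+ c))
⟦⟧≡residue (s ⊞ t) ρ with ⟦⟧≡residue s ρ | ⟦⟧≡residue t ρ
... | p , eqs | q , eqt = p + q , trans (cong₂ _+_ eqs eqt)
  (collect (+ residue s (residues ρ)) (+ residue t (residues ρ)) p q)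
  where
  collect : ∀ a b p q → (a + p * + 4) + (b + q * + 4) ≡ (a + b) + (p + q) * + 4
  collect = solve-∀
⟦⟧≡residue (s ⊠ t) ρ with ⟦⟧≡residue s ρ | ⟦⟧≡residue t ρ
... | p , eqs | q , eqt = a * q + p * b + p * q * + 4 ,
  trans (cong₂ _*_ eqs eqt)
    (trans (collect a b p q) (cong (_+ (a * q + p * b + p * q * + 4) * + 4)
      (sym (ℤ.pos-* (residue s (residues ρ)) _))))
  where
  a = + residue s (residues ρ)
  b = + residue t (residues ρ)
  collect : ∀ a b p q → (a + p * + 4) * (b + q * + 4) ≡ a * b + (a * q + p * b + p * q * + 4) * + 4
  collect = solve-∀
⟦⟧≡residue (⊟ s) ρ with ⟦⟧≡residue s ρ
... | p , eqs = - a + - p ,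
  trans (cong -_ eqs)
    (trans (collect a p) (cong (_+ (- a + - p) * + 4) (sym (ℤ.pos-* 3 (residue s (residues ρ))))))
  where
  a = + residue s (residues ρ)
  collect : ∀ a p → - (a + p * + 4) ≡ + 3 * a + (- a + - p) * + 4
  collect = solve-∀

4∣ᵇ_ : ℕ → Bool
4∣ᵇ a = a ℕ.% 4 ℕ.≡ᵇ 0

4∣ᵇ⇒4∣ : ∀ a → T (4∣ᵇ a) → 4 ℕ.∣ a
4∣ᵇ⇒4∣ a t = ℕ.m%n≡0⇒n∣m a 4 (ℕ.≡ᵇ⇒≡ _ 0 t)

4∣⇒4∣ᵇ : ∀ a → 4 ℕ.∣ a → T (4∣ᵇ a)
4∣⇒4∣ᵇ a t = ℕ.≡⇒≡ᵇ _ 0 (ℕ.n∣m⇒m%n≡0 a 4 t)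

4∣⟦⟧⇒4∣residue : ∀ (s : Expr k) ρ → + 4 ∣ ⟦ s ⟧ ρ → 4 ℕ.∣ residue s (residues ρ)
4∣⟦⟧⇒4∣residue s ρ 4∣s with ⟦⟧≡residue s ρ
... | q , eq = ∣⇒∣ᵤ {+ 4} {+ residue s (residues ρ)} (∣m+n∣n⇒∣m (subst (+ 4 ∣_) eq 4∣s) (divides q refl))

4∣residue⇒4∣⟦⟧ : ∀ (s : Expr k) ρ → 4 ℕ.∣ residue s (residues ρ) → + 4 ∣ ⟦ s ⟧ ρ
4∣residue⇒4∣⟦⟧ s ρ 4∣r with ⟦⟧≡residue s ρ
... | q , eq = subst (+ 4 ∣_) (sym eq) (∣m∣n⇒∣m+n {+ 4} {+ residue s (residues ρ)} (∣ᵤ⇒∣ 4∣r) (divides q refl))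

allDivisible : List (Expr k) → Vec ℕ k → Bool
allDivisible []       ρ = true
allDivisible (c ∷ cs) ρ = 4∣ᵇ residue c ρ ∧ allDivisible cs ρ

-- A failing hypothesis settles the implication at once, so conclusions are evaluated only at the
-- residues that survive all hypotheses.
entail : List (Expr k) → List (Expr k) → Vec ℕ k → Bool
entail []       cs ρ = allDivisible cs ρ
entail (h ∷ hs) cs ρ = if 4∣ᵇ residue h ρ then entail hs cs ρ else true

everywhere : ∀ k → (Vec ℕ k → Bool) → Bool
everywhere zero    P = P []
everywhere (suc k) P = everywhere k (λ ρ → P (0 ∷ ρ) ∧ P (1 ∷ ρ) ∧ P (2 ∷ ρ) ∧ P (3 ∷ ρ))

∧-split : ∀ {a b} → T (a ∧ b) → T a × T b
∧-split = Equivalence.to T-∧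

everywhere-residues : ∀ P → T (everywhere k P) → ∀ ρ → T (P (residues ρ))
everywhere-residues P t []      = t
everywhere-residues P t (z ∷ ρ) = at (z %ℕ 4) (n%ℕd<d z 4) (everywhere-residues _ t ρ)
  where
  at : ∀ r → r ℕ.< 4 → T (P (0 ∷ residues ρ) ∧ P (1 ∷ residues ρ) ∧ P (2 ∷ residues ρ) ∧ P (3 ∷ residues ρ)) →
       T (P (r ∷ residues ρ))
  at 0 _ t = proj₁ (∧-split t)
  at 1 _ t = proj₁ (∧-split (proj₂ (∧-split {P (0 ∷ residues ρ)} t)))
  at 2 _ t = proj₁ (∧-split (proj₂ (∧-split {P (1 ∷ residues ρ)} (proj₂ (∧-split {P (0 ∷ residues ρ)} t)))))
  at 3 _ t = proj₂ (∧-split {P (2 ∷ residues ρ)}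
    (proj₂ (∧-split {P (1 ∷ residues ρ)} (proj₂ (∧-split {P (0 ∷ residues ρ)} t)))))
  at (suc (suc (suc (suc _)))) (s≤s (s≤s (s≤s (s≤s ())))) _

4∣⟦_⟧ : List (Expr k) → Vec ℤ k → Set
4∣⟦ [] ⟧     ρ = ⊤
4∣⟦ s ∷ ss ⟧ ρ = + 4 ∣ ⟦ s ⟧ ρ × 4∣⟦ ss ⟧ ρ

allDivisible-sound : ∀ (cs : List (Expr k)) ρ → T (allDivisible cs (residues ρ)) → 4∣⟦ cs ⟧ ρ
allDivisible-sound []       ρ t = tt
allDivisible-sound (c ∷ cs) ρ t with ∧-split {4∣ᵇ residue c (residues ρ)} t
... | t₁ , t₂ = 4∣residue⇒4∣⟦⟧ c ρ (4∣ᵇ⇒4∣ _ t₁) , allDivisible-sound cs ρ t₂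

entail-sound : ∀ (hs cs : List (Expr k)) ρ → T (entail hs cs (residues ρ)) →
               4∣⟦ hs ⟧ ρ → 4∣⟦ cs ⟧ ρ
entail-sound []       cs ρ t _ = allDivisible-sound cs ρ t
entail-sound (h ∷ hs) cs ρ t (p , ps)
  -- The hypothesis, transported to the residues, rules out the branch in which the test is `false`.
  with 4∣ᵇ residue h (residues ρ) | 4∣⇒4∣ᵇ _ (4∣⟦⟧⇒4∣residue h ρ p)
... | true | _ = entail-sound hs cs ρ t ps

-- Implications between divisibilities by 4 of integer polynomials, decided by
-- running through all residues.
mod4 : ∀ (hs cs : List (Expr k)) → T (everywhere k (entail hs cs)) → ∀ ρ →
       4∣⟦ hs ⟧ ρ → 4∣⟦ cs ⟧ ρ
mod4 hs cs t ρ = entail-sound hs cs ρ (everywhere-residues (entail hs cs) t ρ)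

-- Integers among the rationals, and denominators

ℚ-ring : AlmostCommutativeRing _ _
ℚ-ring = fromCommutativeRing ℚ.+-*-commutativeRing (λ q → dec⇒maybe (0ℚ ℚ.≟ q))

ι : ℤ → ℚ
ι z = z / 1

/-≡ : ∀ i j p q .{{_ : ℕ.NonZero p}} .{{_ : ℕ.NonZero q}} → i * + q ≡ j * + p → i / p ≡ j / q
/-≡ i j (suc p) (suc q) eq = ℚ.fromℚᵘ-cong {mkℚᵘ i p} {mkℚᵘ j q} (*≡* eq)

toℚᵘ-ι : ∀ z → ℚ.toℚᵘ (ι z) ℚᵘ.≃ mkℚᵘ z 0
toℚᵘ-ι z = ℚ.toℚᵘ-fromℚᵘ (mkℚᵘ z 0)

ι-+ : ∀ a b → ι (a + b) ≡ ι a ℚ.+ ι b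
ι-+ a b = ℚ.toℚᵘ-injective (ℚᵘ.≃-trans (toℚᵘ-ι (a + b)) (ℚᵘ.≃-trans (*≡* (rearrange a b))
  (ℚᵘ.≃-sym (ℚᵘ.≃-trans (ℚ.toℚᵘ-homo-+ (ι a) (ι b)) (ℚᵘ.+-cong (toℚᵘ-ι a) (toℚᵘ-ι b))))))
  where
  rearrange : ∀ a b → (a + b) * + 1 ≡ (a * + 1 + b * + 1) * + 1
  rearrange = solve-∀

ι-* : ∀ a b → ι (a * b) ≡ ι a ℚ.* ι b
ι-* a b = ℚ.toℚᵘ-injective (ℚᵘ.≃-trans (toℚᵘ-ι (a * b))
  (ℚᵘ.≃-sym (ℚᵘ.≃-trans (ℚ.toℚᵘ-homo-* (ι a) (ι b)) (ℚᵘ.*-cong (toℚᵘ-ι a) (toℚᵘ-ι b)))))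

ι-^ : ∀ z i → ι (z ℤ.^ i) ≡ ι z ^ i
ι-^ z zero    = refl
ι-^ z (suc i) = trans (ι-* z (z ℤ.^ i)) (cong (ι z ℚ.*_) (ι-^ z i))

ι-neg : ∀ a → ι (- a) ≡ ℚ.- ι a
ι-neg a = ℚ.toℚᵘ-injective (ℚᵘ.≃-trans (toℚᵘ-ι (- a))
  (ℚᵘ.≃-sym (ℚᵘ.≃-trans (ℚ.toℚᵘ-homo‿- (ι a)) (ℚᵘ.-‿cong (toℚᵘ-ι a)))))

ι-injective : ∀ {a b} → ι a ≡ ι b → a ≡ b
ι-injective {a} {b} eq with ℚ.fromℚᵘ-injective {mkℚᵘ a 0} {mkℚᵘ b 0} eq
... | *≡* eq′ = trans (sym (ℤ.*-identityʳ a)) (trans eq′ (ℤ.*-identityʳ b))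

q*↧q≡↥q : ∀ q → q ℚ.* ι (↧ q) ≡ ι (↥ q)
q*↧q≡↥q q@record{} = ℚ.toℚᵘ-injective (ℚᵘ.≃-trans (ℚ.toℚᵘ-homo-* q (ι (↧ q)))
  (ℚᵘ.≃-trans (ℚᵘ.*-cong {ℚ.toℚᵘ q} ℚᵘ.≃-refl (toℚᵘ-ι (↧ q)))
  (ℚᵘ.≃-trans (*≡* (rearrange (↥ q) (↧ q))) (ℚᵘ.≃-sym (toℚᵘ-ι (↥ q))))))
  where
  rearrange : ∀ a b → (a * b) * + 1 ≡ a * (b * + 1)
  rearrange = solve-∀

ι[q*d/d]≡q : ∀ z d .{{_ : ℕ.NonZero d}} → (z * + d) / d ≡ ι z
ι[q*d/d]≡q z d = /-≡ (z * + d) z d 1 (ℤ.*-identityʳ (z * + d))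

1/d*d≡1 : ∀ d .{{_ : ℕ.NonZero d}} → (+ 1 / d) ℚ.* ι (+ d) ≡ 1ℚ
1/d*d≡1 d@(suc d-1) = ℚ.toℚᵘ-injective (ℚᵘ.≃-trans (ℚ.toℚᵘ-homo-* (+ 1 / d) (ι (+ d)))
  (ℚᵘ.≃-trans (ℚᵘ.*-cong (ℚ.toℚᵘ-fromℚᵘ (mkℚᵘ (+ 1) d-1)) (toℚᵘ-ι (+ d)))
  (*≡* (rearrange (+ d)))))
  where
  rearrange : ∀ a → (+ 1 * a) * + 1 ≡ + 1 * (a * + 1)
  rearrange = solve-∀

⟦_⟧ℚ : ∀ {k} → Expr k → Vec ℤ k → ℚ
⟦ X i ⟧ℚ  ρ = ι (lookup ρ i)
⟦ K c ⟧ℚ  ρ = ι (+ c)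
⟦ s ⊞ t ⟧ℚ ρ = ⟦ s ⟧ℚ ρ ℚ.+ ⟦ t ⟧ℚ ρ
⟦ s ⊠ t ⟧ℚ ρ = ⟦ s ⟧ℚ ρ ℚ.* ⟦ t ⟧ℚ ρ
⟦ ⊟ s ⟧ℚ   ρ = ℚ.- ⟦ s ⟧ℚ ρ

ι-⟦⟧ : ∀ {k} (s : Expr k) ρ → ι (⟦ s ⟧ ρ) ≡ ⟦ s ⟧ℚ ρ
ι-⟦⟧ (X i)  ρ = refl
ι-⟦⟧ (K c)  ρ = refl
ι-⟦⟧ (s ⊞ t) ρ = trans (ι-+ (⟦ s ⟧ ρ) (⟦ t ⟧ ρ)) (cong₂ ℚ._+_ (ι-⟦⟧ s ρ) (ι-⟦⟧ t ρ))
ι-⟦⟧ (s ⊠ t) ρ = trans (ι-* (⟦ s ⟧ ρ) (⟦ t ⟧ ρ)) (cong₂ ℚ._*_ (ι-⟦⟧ s ρ) (ι-⟦⟧ t ρ))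
ι-⟦⟧ (⊟ s)   ρ = trans (ι-neg (⟦ s ⟧ ρ)) (cong ℚ.-_ (ι-⟦⟧ s ρ))

Integral : ℚ → Set
Integral q = ∃[ z ] q ≡ ι z

integral-+ : ∀ {p q} → Integral p → Integral q → Integral (p ℚ.+ q)
integral-+ (a , refl) (b , refl) = a + b , sym (ι-+ a b)

integral-* : ∀ {p q} → Integral p → Integral q → Integral (p ℚ.* q)
integral-* (a , refl) (b , refl) = a * b , sym (ι-* a b)

integral-neg : ∀ {p} → Integral p → Integral (ℚ.- p)
integral-neg (a , refl) = - a , sym (ι-neg a)

-- Lowest terms. The coprimality stored in a rational is irrelevant and has to be recomputed before
-- use.
↧-divisor : ∀ q {o} → ↧ₙ q ℕ.∣ ∣ ↥ q ∣ ℕ.* o → ↧ₙ q ℕ.∣ o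
↧-divisor (ℚ.mkℚ _ _ coprime) = ℕ.coprime-divisor (ℕ.sym (ℕ.recompute coprime))

-- Coprimality moves the denominator from the product `z * ↥ q` to `z`. Together with `↧∣⇒integral`
-- this says that the integers clearing `q` are the multiples of its denominator, so integrality
-- questions become divisibilities in ℕ.
integral⇒↧∣ : ∀ z q → Integral (ι z ℚ.* q) → ↧ₙ q ℕ.∣ ∣ z ∣
integral⇒↧∣ z q (w , eq) = ↧-divisor q
  (ℕ.divides ∣ w ∣ (trans (ℕ.*-comm ∣ ↥ q ∣ ∣ z ∣) (trans (sym (ℤ.abs-* z (↥ q)))
    (trans (cong ∣_∣ (ι-injective {z * ↥ q} {w * ↧ q} cleared)) (ℤ.abs-* w (↧ q))))))
  where
  cleared : ι (z * ↥ q) ≡ ι (w * ↧ q)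
  cleared = begin
    ι (z * ↥ q)               ≡⟨ ι-* z (↥ q) ⟩
    ι z ℚ.* ι (↥ q)           ≡⟨ cong (ι z ℚ.*_) (q*↧q≡↥q q) ⟨
    ι z ℚ.* (q ℚ.* ι (↧ q))   ≡⟨ ℚ.*-assoc (ι z) q (ι (↧ q)) ⟨
    ι z ℚ.* q ℚ.* ι (↧ q)     ≡⟨ cong (ℚ._* ι (↧ q)) eq ⟩
    ι w ℚ.* ι (↧ q)           ≡⟨ ι-* w (↧ q) ⟨
    ι (w * ↧ q)               ∎

↧∣⇒integral : ∀ z q → ↧ₙ q ℕ.∣ ∣ z ∣ → Integral (ι z ℚ.* q)
↧∣⇒integral z q ↧∣z with ∣ᵤ⇒∣ {↧ q} {z} ↧∣z
... | divides w refl = w * ↥ q , (begin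
  ι (w * ↧ q) ℚ.* q         ≡⟨ cong (ℚ._* q) (ι-* w (↧ q)) ⟩
  ι w ℚ.* ι (↧ q) ℚ.* q     ≡⟨ rearrange (ι w) (ι (↧ q)) q ⟩
  ι w ℚ.* (q ℚ.* ι (↧ q))   ≡⟨ cong (ι w ℚ.*_) (q*↧q≡↥q q) ⟩
  ι w ℚ.* ι (↥ q)           ≡⟨ ι-* w (↥ q) ⟨
  ι (w * ↥ q)               ∎)
  where
  rearrange : ∀ a b c → a ℚ.* b ℚ.* c ≡ a ℚ.* (c ℚ.* b)
  rearrange = RingSolver.solve-∀ ℚ-ring

↧≡1⇒integral : ∀ q → ↧ₙ q ≡ 1 → Integral q
↧≡1⇒integral q eq = subst Integral (ℚ.*-identityˡ q) (↧∣⇒integral (+ 1) q (ℕ.∣-reflexive eq))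

-- If `b` is the denominator of `q`, then every power of `b` divides `N`, which forces `b = 1`.
bounded-denominators⇒integral : ∀ N .{{_ : NonZero N}} q → (∀ i → Integral (ι N ℚ.* q ^ i)) → Integral q
bounded-denominators⇒integral N q h = ↧≡1⇒integral q (b≡1 b (λ i → ℕ.∣⇒≤ (b^i∣N i)))
  where
  a = ↥ q
  b = ↧ₙ q

  b∣a^i*M⇒b∣M : ∀ i M → b ℕ.∣ ∣ a ∣ ℕ.^ i ℕ.* M → b ℕ.∣ M
  b∣a^i*M⇒b∣M zero    M b∣ = subst (b ℕ.∣_) (ℕ.+-identityʳ M) b∣
  b∣a^i*M⇒b∣M (suc i) M b∣ = b∣a^i*M⇒b∣M i M
    (↧-divisor q (subst (b ℕ.∣_) (ℕ.*-assoc ∣ a ∣ (∣ a ∣ ℕ.^ i) M) b∣))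

  abs-^ : ∀ z i → ∣ z ℤ.^ i ∣ ≡ ∣ z ∣ ℕ.^ i
  abs-^ z zero    = refl
  abs-^ z (suc i) = trans (ℤ.abs-* z (z ℤ.^ i)) (cong (∣ z ∣ ℕ.*_) (abs-^ z i))

  b^i∣N : ∀ i → b ℕ.^ i ℕ.∣ ∣ N ∣
  b^i∣N zero    = ℕ.1∣ _
  b^i∣N (suc i) with ∣ᵤ⇒∣ {+ (b ℕ.^ i)} {N} (b^i∣N i)
  ... | divides M eq = subst (b ℕ.^ suc i ℕ.∣_) (sym abs-N)
      (ℕ.*-monoˡ-∣ (b ℕ.^ i) (b∣a^i*M⇒b∣M i ∣ M ∣ (subst (b ℕ.∣_) abs-aM
        (integral⇒↧∣ (a ℤ.^ i * M) q (subst Integral shift (h (suc i)))))))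
    where
    abs-N : ∣ N ∣ ≡ ∣ M ∣ ℕ.* b ℕ.^ i
    abs-N = trans (cong ∣_∣ eq) (ℤ.abs-* M (+ (b ℕ.^ i)))
    abs-aM : ∣ a ℤ.^ i * M ∣ ≡ ∣ a ∣ ℕ.^ i ℕ.* ∣ M ∣
    abs-aM = trans (ℤ.abs-* (a ℤ.^ i) M) (cong (ℕ._* ∣ M ∣) (abs-^ a i))
    +-^ : ∀ b i → + (b ℕ.^ i) ≡ (+ b) ℤ.^ i
    +-^ b zero    = refl
    +-^ b (suc i) = trans (ℤ.pos-* b (b ℕ.^ i)) (cong (+ b *_) (+-^ b i))
    rearrange : ∀ M B p q → M ℚ.* B ℚ.* (q ℚ.* p) ≡ (p ℚ.* B) ℚ.* M ℚ.* q
    rearrange = RingSolver.solve-∀ ℚ-ring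
    shift : ι N ℚ.* q ^ suc i ≡ ι (a ℤ.^ i * M) ℚ.* q
    shift = begin
      ι N ℚ.* q ^ suc i
        ≡⟨ cong (λ z → ι z ℚ.* q ^ suc i) eq ⟩
      ι (M * + (b ℕ.^ i)) ℚ.* q ^ suc i
        ≡⟨ cong (λ z → z ℚ.* q ^ suc i) (trans (ι-* M _)
          (cong (ι M ℚ.*_) (trans (cong ι (+-^ b i)) (ι-^ (+ b) i)))) ⟩
      ι M ℚ.* ι (+ b) ^ i ℚ.* (q ℚ.* q ^ i)
        ≡⟨ rearrange (ι M) (ι (+ b) ^ i) (q ^ i) q ⟩
      (q ^ i ℚ.* ι (+ b) ^ i) ℚ.* ι M ℚ.* q
        ≡⟨ cong (λ z → z ℚ.* ι M ℚ.* q) (trans (sym (^-distrib-* q (ι (+ b)) i))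
          (trans (cong (_^ i) (q*↧q≡↥q q)) (sym (ι-^ a i)))) ⟩
      ι (a ℤ.^ i) ℚ.* ι M ℚ.* q
        ≡⟨ cong (ℚ._* q) (ι-* (a ℤ.^ i) M) ⟨
      ι (a ℤ.^ i * M) ℚ.* q ∎

  n<b^n : ∀ b n → 1 ℕ.< b → n ℕ.< b ℕ.^ n
  n<b^n b zero    1<b = s≤s z≤n
  n<b^n b (suc n) 1<b = ℕ.≤-trans (s≤s (n<b^n b n 1<b)) (subst (b ℕ.^ n ℕ.<_) (ℕ.*-comm (b ℕ.^ n) b)
    (ℕ.m<m*n (b ℕ.^ n) b {{ℕ.>-nonZero (ℕ.≤-<-trans z≤n (n<b^n b n 1<b))}} 1<b))

  b≡1 : ∀ b .{{_ : ℕ.NonZero b}} → (∀ i → b ℕ.^ i ℕ.≤ ∣ N ∣) → b ≡ 1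
  b≡1 1               _ = refl
  -- The exponent `∣ N ∣` already violates the bound, as `n < b ^ n` for `b > 1`.
  b≡1 b@(suc (suc _)) b^i≤N = contradiction (b^i≤N ∣ N ∣) (ℕ.<⇒≱ (n<b^n b ∣ N ∣ (s≤s (s≤s z≤n))))

-- Coprimality is applied twice to the denominator `b`: first `b` divides `m`, and then, for
-- `m = M b`, it divides `M` as well. Hence `b²` divides `m`.
squarefree⇒integral : ∀ {m} → SquareFree m → ∀ q → Integral (ι m ℚ.* (q ℚ.* q)) → Integral q
squarefree⇒integral {m} sqf q (z , eq) = ↧≡1⇒integral q (sqf b b²∣m)
  where
  a = ↥ q
  b = ↧ₙ q

  coprime-divisor : ∀ {o} → b ℕ.∣ ∣ o * a ∣ → b ℕ.∣ ∣ o ∣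
  coprime-divisor {o} b∣ = ↧-divisor q
    (subst (b ℕ.∣_) (trans (ℤ.abs-* o a) (ℕ.*-comm ∣ o ∣ ∣ a ∣)) b∣)

  rearrange : ∀ m q c → m ℚ.* (q ℚ.* c) ℚ.* q ≡ m ℚ.* (q ℚ.* q) ℚ.* c
  rearrange = RingSolver.solve-∀ ℚ-ring

  maq : ι (m * a) ℚ.* q ≡ ι (z * + b)
  maq = begin
    ι (m * a) ℚ.* q                   ≡⟨ cong (ℚ._* q) (trans (ι-* m a) (cong (ι m ℚ.*_) (sym (q*↧q≡↥q q)))) ⟩
    ι m ℚ.* (q ℚ.* ι (+ b)) ℚ.* q     ≡⟨ rearrange (ι m) q (ι (+ b)) ⟩
    ι m ℚ.* (q ℚ.* q) ℚ.* ι (+ b)     ≡⟨ cong (ℚ._* ι (+ b)) eq ⟩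
    ι z ℚ.* ι (+ b)                   ≡⟨ ι-* z (+ b) ⟨
    ι (z * + b)                       ∎

  Maq : ∀ M → m ≡ M * + b → ι (M * a) ℚ.* q ≡ ι z
  Maq M m≡ = begin
    ι (M * a) ℚ.* q                 ≡⟨ cong (ℚ._* q) (trans (ι-* M a) (cong (ι M ℚ.*_) (sym (q*↧q≡↥q q)))) ⟩
    ι M ℚ.* (q ℚ.* ι (+ b)) ℚ.* q   ≡⟨ rearrange′ (ι M) q (ι (+ b)) ⟩
    ι M ℚ.* ι (+ b) ℚ.* (q ℚ.* q)   ≡⟨ cong (ℚ._* (q ℚ.* q)) (ι-* M (+ b)) ⟨
    ι (M * + b) ℚ.* (q ℚ.* q)       ≡⟨ cong (λ x → ι x ℚ.* (q ℚ.* q)) m≡ ⟨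
    ι m ℚ.* (q ℚ.* q)               ≡⟨ eq ⟩
    ι z                             ∎
    where
    rearrange′ : ∀ M q c → M ℚ.* (q ℚ.* c) ℚ.* q ≡ (M ℚ.* c) ℚ.* (q ℚ.* q)
    rearrange′ = RingSolver.solve-∀ ℚ-ring

  b²∣m : b ℕ.* b ℕ.∣ ∣ m ∣
  b²∣m = subst (b ℕ.* b ℕ.∣_) (sym (trans (cong ∣_∣ (_∣_.equality b∣m)) (ℤ.abs-* M (+ b))))
      (ℕ.*-monoˡ-∣ b (coprime-divisor {M} (integral⇒↧∣ (M * a) q (z , Maq M (_∣_.equality b∣m)))))
    where
    b∣m = ∣ᵤ⇒∣ {+ b} {m} (coprime-divisor {m} (integral⇒↧∣ (m * a) q (z * + b , maq)))
    M = quotient b∣m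

-- Commutative ℚ-algebras and explicit quartics

-- Keeping the ring abstract prevents Agda from unfolding the arithmetic of
-- quadruples of rationals.
module ℚ-Algebra {A : Set} {_+′_ _*′_ : A → A → A} { -′_ : A → A} {0A 1A : A}
  (isCommutativeRing : IsCommutativeRing _≡_ _+′_ _*′_ -′_ 0A 1A)
  (κ : ℚ → A) (κ-+ : ∀ p q → κ (p ℚ.+ q) ≡ κ p +′ κ q) (κ-* : ∀ p q → κ (p ℚ.* q) ≡ κ p *′ κ q)
  (κ-neg : ∀ p → κ (ℚ.- p) ≡ -′ κ p) (κ-0 : κ 0ℚ ≡ 0A) (κ-1 : κ 1ℚ ≡ 1A)
  where

  ring : CommutativeRing 0ℓ 0ℓ
  ring = record { isCommutativeRing = isCommutativeRing }

  scalars : CommutativeRing.rawRing ℚ.+-*-commutativeRing ACR.-Raw-AlmostCommutative⟶ ACR.fromCommutativeRing ring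
  scalars = record
    { ⟦_⟧ = κ ; +-homo = κ-+ ; *-homo = κ-* ; -‿homo = κ-neg ; 0-homo = κ-0 ; 1-homo = κ-1 }

  module Solver = ScalarSolver _ _ scalars (λ p q → map (cong κ) (dec⇒maybe (p ℚ.≟ q)))
  open CommutativeRing ring using (*-assoc; *-identityʳ; +-identityˡ; zeroˡ; zeroʳ; -‿inverseʳ; +-group)
    renaming (_+_ to _⊕_; _*_ to _⊗_; -_ to ⊝_)
  open Exp (CommutativeRing.commutativeSemiring ring) using () renaming (_^_ to _^ᴬ_; ^-distrib-* to ^ᴬ-distrib-*)

  ⊗-interchange : ∀ x y z w → x ⊗ z ⊗ (y ⊗ w) ≡ x ⊗ y ⊗ (z ⊗ w)
  ⊗-interchange = solve 4 (λ x y z w → x :* z :* (y :* w) := x :* y :* (z :* w)) refl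
    where open Solver

  leibniz : ∀ a b x y p q z → a ⊗ (x ⊗ p) ⊗ (b ⊗ q) ⊗ z ⊕ a ⊗ p ⊗ (b ⊗ (y ⊗ q)) ⊗ z ≡
                              a ⊗ p ⊗ (b ⊗ q) ⊗ ((x ⊕ y) ⊗ z)
  leibniz = solve 7 (λ a b x y p q z →
    a :* (x :* p) :* (b :* q) :* z :+ a :* p :* (b :* (y :* q)) :* z :=
    a :* p :* (b :* q) :* ((x :+ y) :* z)) refl
    where open Solver

  horner-expand : ∀ v c x z → v ⊗ (c ⊕ x ⊗ z) ≡ v ⊗ c ⊕ v ⊗ x ⊗ z
  horner-expand = solve 4 (λ v c x z → v :* (c :+ x :* z) := v :* c :+ v :* x :* z) refl
    where open Solver

  horner-collect : ∀ u w v x z → u ⊕ (w ⊕ v ⊗ x ⊗ z) ≡ u ⊕ w ⊕ v ⊗ (x ⊗ z)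
  horner-collect = solve 5 (λ u w v x z → u :+ (w :+ v :* x :* z) := u :+ w :+ v :* (x :* z)) refl
    where open Solver

  shift : ∀ a x y z → a ⊗ y ⊗ (x ⊗ z) ≡ a ⊗ (x ⊗ y) ⊗ z
  shift = solve 4 (λ a x y z → a :* y :* (x :* z) := a :* (x :* y) :* z) refl
    where open Solver

  ⟦_⟧ᴬ : ∀ {k} → Expr k → Vec ℤ k → A
  ⟦ X i ⟧ᴬ  ρ = κ (ι (lookup ρ i))
  ⟦ K c ⟧ᴬ  ρ = κ (ι (+ c))
  ⟦ s ⊞ t ⟧ᴬ ρ = ⟦ s ⟧ᴬ ρ ⊕ ⟦ t ⟧ᴬ ρ
  ⟦ s ⊠ t ⟧ᴬ ρ = ⟦ s ⟧ᴬ ρ ⊗ ⟦ t ⟧ᴬ ρ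
  ⟦ ⊟ s ⟧ᴬ   ρ = ⊝ ⟦ s ⟧ᴬ ρ

  κ-⟦⟧ : ∀ {k} (s : Expr k) ρ → κ (⟦ s ⟧ℚ ρ) ≡ ⟦ s ⟧ᴬ ρ
  κ-⟦⟧ (X i)  ρ = refl
  κ-⟦⟧ (K c)  ρ = refl
  κ-⟦⟧ (s ⊞ t) ρ = trans (κ-+ (⟦ s ⟧ℚ ρ) (⟦ t ⟧ℚ ρ)) (cong₂ _⊕_ (κ-⟦⟧ s ρ) (κ-⟦⟧ t ρ))
  κ-⟦⟧ (s ⊠ t) ρ = trans (κ-* (⟦ s ⟧ℚ ρ) (⟦ t ⟧ℚ ρ)) (cong₂ _⊗_ (κ-⟦⟧ s ρ) (κ-⟦⟧ t ρ))
  κ-⟦⟧ (⊟ s)   ρ = trans (κ-neg (⟦ s ⟧ℚ ρ)) (cong ⊝_ (κ-⟦⟧ s ρ))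

  evalMonic : List ℤ → A → A
  evalMonic cs x = foldr (λ c v → κ (c / 1) ⊕ x ⊗ v) 1A cs

  -- The norm to ℤ[X] of X² - (t₀ + t₁ ω) X + s₀ + s₁ ω = P - ω Q, where
  -- P = X² - t₀ X + s₀, Q = t₁ X - s₁ and ω² = ω + μ, is P² - P Q - μ Q².
  quadratic⇒integral : ∀ μ t₀ t₁ s₀ s₁ ω x → ω ⊗ ω ≡ ω ⊕ κ (ι μ) →
    x ⊗ x ⊕ ⊝ (κ (ι t₀) ⊗ x) ⊕ κ (ι s₀) ≡ ω ⊗ (κ (ι t₁) ⊗ x ⊕ ⊝ κ (ι s₁)) →
    ∃[ cs ] evalMonic cs x ≡ 0A
  quadratic⇒integral μ t₀ t₁ s₀ s₁ ω x ω² x² =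
    ⟦ e₀ ⟧ ρ ∷ ⟦ e₁ ⟧ ρ ∷ ⟦ e₂ ⟧ ρ ∷ ⟦ e₃ ⟧ ρ ∷ [] , (begin
      κ (ι (⟦ e₀ ⟧ ρ)) ⊕ x ⊗ (κ (ι (⟦ e₁ ⟧ ρ)) ⊕ x ⊗ (κ (ι (⟦ e₂ ⟧ ρ)) ⊕ x ⊗ (κ (ι (⟦ e₃ ⟧ ρ)) ⊕ x ⊗ 1A)))
        ≡⟨ cong₂ _⊕_ (κι e₀) (cong (x ⊗_) (cong₂ _⊕_ (κι e₁) (cong (x ⊗_) (cong₂ _⊕_ (κι e₂)
             (cong (x ⊗_) (cong₂ _⊕_ (κι e₃) (cong (x ⊗_) (sym κ-1)))))))) ⟩
      ⟦ e₀ ⟧ᴬ ρ ⊕ x ⊗ (⟦ e₁ ⟧ᴬ ρ ⊕ x ⊗ (⟦ e₂ ⟧ᴬ ρ ⊕ x ⊗ (⟦ e₃ ⟧ᴬ ρ ⊕ x ⊗ κ 1ℚ)))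
        ≡⟨ norm (κ (ι μ)) (κ (ι t₀)) (κ (ι t₁)) (κ (ι s₀)) (κ (ι s₁)) x ⟩
      P ⊗ P ⊕ ⊝ (P ⊗ Q) ⊕ ⊝ (κ (ι μ) ⊗ (Q ⊗ Q))
        -- At `x` the polynomial `P` equals `ω Q`, so the norm becomes `ω² - ω - μ` times `Q²`.
        ≡⟨ cong (λ p → p ⊗ p ⊕ ⊝ (p ⊗ Q) ⊕ ⊝ (κ (ι μ) ⊗ (Q ⊗ Q))) x² ⟩
      ω ⊗ Q ⊗ (ω ⊗ Q) ⊕ ⊝ (ω ⊗ Q ⊗ Q) ⊕ ⊝ (κ (ι μ) ⊗ (Q ⊗ Q))
        ≡⟨ factor (κ (ι μ)) ω Q ⟩
      (ω ⊗ ω ⊕ ⊝ (ω ⊕ κ (ι μ))) ⊗ (Q ⊗ Q)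
        ≡⟨ cong (λ v → (v ⊕ ⊝ (ω ⊕ κ (ι μ))) ⊗ (Q ⊗ Q)) ω² ⟩
      (ω ⊕ κ (ι μ) ⊕ ⊝ (ω ⊕ κ (ι μ))) ⊗ (Q ⊗ Q)
        ≡⟨ cong (_⊗ (Q ⊗ Q)) (-‿inverseʳ _) ⟩
      0A ⊗ (Q ⊗ Q)
        ≡⟨ zeroˡ _ ⟩
      0A ∎)
    where
    P = x ⊗ x ⊕ ⊝ (κ (ι t₀) ⊗ x) ⊕ κ (ι s₀)
    Q = κ (ι t₁) ⊗ x ⊕ ⊝ κ (ι s₁)
    ρ = μ ∷ t₀ ∷ t₁ ∷ s₀ ∷ s₁ ∷ []
    M T₀ T₁ S₀ S₁ e₀ e₁ e₂ e₃ : Expr 5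
    M  = X (# 0)
    T₀ = X (# 1)
    T₁ = X (# 2)
    S₀ = X (# 3)
    S₁ = X (# 4)
    e₀ = S₀ ⊠ S₀ ⊞ S₀ ⊠ S₁ ⊞ ⊟ (M ⊠ (S₁ ⊠ S₁))
    e₁ = ⊟ (K 2 ⊠ (T₀ ⊠ S₀) ⊞ T₀ ⊠ S₁ ⊞ T₁ ⊠ S₀ ⊞ ⊟ (K 2 ⊠ (M ⊠ (T₁ ⊠ S₁))))
    e₂ = T₀ ⊠ T₀ ⊞ T₀ ⊠ T₁ ⊞ ⊟ (M ⊠ (T₁ ⊠ T₁)) ⊞ K 2 ⊠ S₀ ⊞ S₁
    e₃ = ⊟ (K 2 ⊠ T₀ ⊞ T₁)
    κι : ∀ e → κ (ι (⟦ e ⟧ ρ)) ≡ ⟦ e ⟧ᴬ ρ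
    κι e = trans (cong κ (ι-⟦⟧ e ρ)) (κ-⟦⟧ e ρ)
    norm : ∀ m t₀ t₁ s₀ s₁ x →
      s₀ ⊗ s₀ ⊕ s₀ ⊗ s₁ ⊕ ⊝ (m ⊗ (s₁ ⊗ s₁)) ⊕
      x ⊗ (⊝ (κ (ι (+ 2)) ⊗ (t₀ ⊗ s₀) ⊕ t₀ ⊗ s₁ ⊕ t₁ ⊗ s₀ ⊕ ⊝ (κ (ι (+ 2)) ⊗ (m ⊗ (t₁ ⊗ s₁)))) ⊕
      x ⊗ (t₀ ⊗ t₀ ⊕ t₀ ⊗ t₁ ⊕ ⊝ (m ⊗ (t₁ ⊗ t₁)) ⊕ κ (ι (+ 2)) ⊗ s₀ ⊕ s₁ ⊕
      x ⊗ (⊝ (κ (ι (+ 2)) ⊗ t₀ ⊕ t₁) ⊕ x ⊗ κ 1ℚ))) ≡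
      (x ⊗ x ⊕ ⊝ (t₀ ⊗ x) ⊕ s₀) ⊗ (x ⊗ x ⊕ ⊝ (t₀ ⊗ x) ⊕ s₀) ⊕
      ⊝ ((x ⊗ x ⊕ ⊝ (t₀ ⊗ x) ⊕ s₀) ⊗ (t₁ ⊗ x ⊕ ⊝ s₁)) ⊕
      ⊝ (m ⊗ ((t₁ ⊗ x ⊕ ⊝ s₁) ⊗ (t₁ ⊗ x ⊕ ⊝ s₁)))
    norm = solve 6 (λ m t₀ t₁ s₀ s₁ x →
      s₀ :* s₀ :+ s₀ :* s₁ :+ :- (m :* (s₁ :* s₁)) :+
      x :* (:- (con (ι (+ 2)) :* (t₀ :* s₀) :+ t₀ :* s₁ :+ t₁ :* s₀ :+ :- (con (ι (+ 2)) :* (m :* (t₁ :* s₁)))) :+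
      x :* (t₀ :* t₀ :+ t₀ :* t₁ :+ :- (m :* (t₁ :* t₁)) :+ con (ι (+ 2)) :* s₀ :+ s₁ :+
      x :* (:- (con (ι (+ 2)) :* t₀ :+ t₁) :+ x :* con 1ℚ))) :=
      (x :* x :+ :- (t₀ :* x) :+ s₀) :* (x :* x :+ :- (t₀ :* x) :+ s₀) :+
      :- ((x :* x :+ :- (t₀ :* x) :+ s₀) :* (t₁ :* x :+ :- s₁)) :+
      :- (m :* ((t₁ :* x :+ :- s₁) :* (t₁ :* x :+ :- s₁)))) refl
      where open Solver
    factor : ∀ m w q → w ⊗ q ⊗ (w ⊗ q) ⊕ ⊝ (w ⊗ q ⊗ q) ⊕ ⊝ (m ⊗ (q ⊗ q)) ≡ (w ⊗ w ⊕ ⊝ (w ⊕ m)) ⊗ (q ⊗ q)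
    factor = solve 3 (λ m w q →
      w :* q :* (w :* q) :+ :- (w :* q :* q) :+ :- (m :* (q :* q)) := (w :* w :+ :- (w :+ m)) :* (q :* q)) refl
      where open Solver

  -- Almost integral elements

  ≢0-* : ∀ {M N} → M ≢ + 0 → N ≢ + 0 → M * N ≢ + 0
  ≢0-* {M} M≢0 N≢0 MN≡0 with ℤ.i*j≡0⇒i≡0∨j≡0 M MN≡0
  ... | inj₁ M≡0 = M≢0 M≡0
  ... | inj₂ N≡0 = N≢0 N≡0

  -- `Λ` plays the role of an order: a subring that contains ℤ, meets ℚ only in ℤ, and contains a
  -- nonzero integer multiple of every element.
  module Almost (Λ : A → Set)
    (Λ-+ : ∀ {x y} → Λ x → Λ y → Λ (x ⊕ y)) (Λ-* : ∀ {x y} → Λ x → Λ y → Λ (x ⊗ y))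
    (Λ-neg : ∀ {x} → Λ x → Λ (⊝ x)) (Λ-κ : ∀ z → Λ (κ (ι z)))
    (Λ-κ⁻¹ : ∀ {q} → Λ (κ q) → Integral q) (denominator : ∀ x → ∃[ D ] D ≢ + 0 × Λ (κ (ι D) ⊗ x))
    where

    AlmostIntegral : A → Set
    AlmostIntegral x = ∃[ N ] N ≢ + 0 × (∀ i → Λ (κ (ι N) ⊗ x ^ᴬ i))

    κ-ι-* : ∀ M N → κ (ι (M * N)) ≡ κ (ι M) ⊗ κ (ι N)
    κ-ι-* M N = trans (cong κ (ι-* M N)) (κ-* (ι M) (ι N))

    Λ⇒almostIntegral : ∀ {x} → Λ x → AlmostIntegral x
    Λ⇒almostIntegral {x} x∈Λ = + 1 , (λ ()) , λ i → Λ-* (Λ-κ (+ 1)) (Λ-^ i)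
      where
      Λ-^ : ∀ i → Λ (x ^ᴬ i)
      Λ-^ zero    = subst Λ κ-1 (Λ-κ (+ 1))
      Λ-^ (suc i) = Λ-* x∈Λ (Λ-^ i)

    almostIntegral-* : ∀ {x y} → AlmostIntegral x → AlmostIntegral y → AlmostIntegral (x ⊗ y)
    almostIntegral-* {x} {y} (M , M≢0 , hx) (N , N≢0 , hy) = M * N , ≢0-* M≢0 N≢0 , λ i →
      subst Λ (trans (⊗-interchange (κ (ι M)) (κ (ι N)) (x ^ᴬ i) (y ^ᴬ i))
                     (cong₂ _⊗_ (sym (κ-ι-* M N)) (sym (^ᴬ-distrib-* x y i))))
              (Λ-* (hx i) (hy i))

    -- Generalising to the products `x^i y^j (x + y)^k` permits induction on `k`: one factor `x + y`
    -- is traded for a larger `i` or a larger `j`. The denominator `M N` serves all these products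
    -- at once.
    almostIntegral-+ : ∀ {x y} → AlmostIntegral x → AlmostIntegral y → AlmostIntegral (x ⊕ y)
    almostIntegral-+ {x} {y} (M , M≢0 , hx) (N , N≢0 , hy) = M * N , ≢0-* M≢0 N≢0 , λ k →
      subst Λ (cong (_⊗ (x ⊕ y) ^ᴬ k) (trans (cong₂ _⊗_ (*-identityʳ _) (*-identityʳ _)) (sym (κ-ι-* M N))))
        (monomials k 0 0)
      where
      monomials : ∀ k i j → Λ (κ (ι M) ⊗ x ^ᴬ i ⊗ (κ (ι N) ⊗ y ^ᴬ j) ⊗ (x ⊕ y) ^ᴬ k)
      monomials zero    i j = subst Λ (sym (*-identityʳ _)) (Λ-* (hx i) (hy j))
      monomials (suc k) i j = subst Λ (leibniz (κ (ι M)) (κ (ι N)) x y (x ^ᴬ i) (y ^ᴬ j) ((x ⊕ y) ^ᴬ k))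
        (Λ-+ (monomials k (suc i) j) (monomials k i (suc j)))

    almostIntegral-hom : ∀ (φ : A → A) → (∀ x y → φ (x ⊗ y) ≡ φ x ⊗ φ y) → (∀ q → φ (κ q) ≡ κ q) →
                         (∀ {x} → Λ x → Λ (φ x)) → ∀ {x} → AlmostIntegral x → AlmostIntegral (φ x)
    almostIntegral-hom φ φ-* φ-κ φ-Λ {x} (N , N≢0 , hx) = N , N≢0 , λ i →
      subst Λ (trans (φ-* (κ (ι N)) (x ^ᴬ i)) (cong₂ _⊗_ (φ-κ (ι N)) (φ-^ i))) (φ-Λ (hx i))
      where
      φ-^ : ∀ i → φ (x ^ᴬ i) ≡ φ x ^ᴬ i
      φ-^ zero    = trans (cong φ (sym κ-1)) (trans (φ-κ 1ℚ) κ-1)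
      φ-^ (suc i) = trans (φ-* x (x ^ᴬ i)) (cong (φ x ⊗_) (φ-^ i))

    κ-^ : ∀ q i → κ (q ^ i) ≡ κ q ^ᴬ i
    κ-^ q zero    = κ-1
    κ-^ q (suc i) = trans (κ-* q (q ^ i)) (cong (κ q ⊗_) (κ-^ q i))

    almostIntegral-κ : ∀ q → AlmostIntegral (κ q) → Integral q
    almostIntegral-κ q (N , N≢0 , hq) = bounded-denominators⇒integral N {{ℤ.≢-nonZero N≢0}} q λ i →
      Λ-κ⁻¹ (subst Λ (sym (trans (κ-* (ι N) (q ^ i)) (cong (κ (ι N) ⊗_) (κ-^ q i)))) (hq i))

    -- Horner's recursion with an accumulated factor `v`. Only exponents below the degree are
    -- assumed to land in `Λ`, and the leading term is kept apart, so that at a root it is expressed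
    -- by the others.
    horner : ∀ x cs v → (∀ l → l ℕ.< length cs → Λ (v ⊗ x ^ᴬ l)) →
             ∃[ w ] Λ w × v ⊗ evalMonic cs x ≡ w ⊕ v ⊗ x ^ᴬ length cs
    horner x []       v hv = 0A , subst Λ κ-0 (Λ-κ (+ 0)) , sym (+-identityˡ (v ⊗ 1A))
    horner x (c ∷ cs) v hv with horner x cs (v ⊗ x)
      (λ l l< → subst Λ (sym (*-assoc v x (x ^ᴬ l))) (hv (suc l) (s≤s l<)))
    ... | w , w∈Λ , eq = v ⊗ κ (c / 1) ⊕ w ,
        Λ-+ (Λ-* (subst Λ (*-identityʳ v) (hv 0 (s≤s z≤n))) (Λ-κ c)) w∈Λ , (begin
        v ⊗ (κ (c / 1) ⊕ x ⊗ evalMonic cs x)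
          ≡⟨ horner-expand v (κ (c / 1)) x (evalMonic cs x) ⟩
        v ⊗ κ (c / 1) ⊕ v ⊗ x ⊗ evalMonic cs x
          ≡⟨ cong (v ⊗ κ (c / 1) ⊕_) eq ⟩
        v ⊗ κ (c / 1) ⊕ (w ⊕ v ⊗ x ⊗ x ^ᴬ length cs)
          ≡⟨ horner-collect (v ⊗ κ (c / 1)) w v x (x ^ᴬ length cs) ⟩
        v ⊗ κ (c / 1) ⊕ w ⊕ v ⊗ (x ⊗ x ^ᴬ length cs) ∎)

    -- If `D` clears `x` and the polynomial has degree `r`, then `D^r` clears 1, x, ..., x^r. The
    -- monic relation lets this window of powers slide upwards without a new denominator.
    integral⇒almostIntegral : ∀ {x} → (∃ λ cs → evalMonic cs x ≡ 0A) → AlmostIntegral x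
    integral⇒almostIntegral {x} (cs , root) = N , N≢0 , λ i → subst Λ (*-identityʳ _) (window i 0 z≤n)
      where
      r = length cs
      D = proj₁ (denominator x)
      N = D ℤ.^ r
      N≢0 : N ≢ + 0
      N≢0 = ≢0-^ r
        where
        ≢0-^ : ∀ i → D ℤ.^ i ≢ + 0
        ≢0-^ zero    ()
        ≢0-^ (suc i) = ≢0-* (proj₁ (proj₂ (denominator x))) (≢0-^ i)
      low : ∀ r l → l ℕ.≤ r → Λ (κ (ι (D ℤ.^ r)) ⊗ x ^ᴬ l)
      low r       zero    _       = subst Λ (sym (*-identityʳ _)) (Λ-κ (D ℤ.^ r))
      low (suc r) (suc l) (s≤s p) = subst Λ
        (trans (⊗-interchange (κ (ι D)) (κ (ι (D ℤ.^ r))) x (x ^ᴬ l))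
               (cong (_⊗ (x ⊗ x ^ᴬ l)) (sym (κ-ι-* D (D ℤ.^ r)))))
        (Λ-* (proj₂ (proj₂ (denominator x))) (low r l p))
      -- At a root `horner` reads `0 = w + v x^r`, so `v x^r` is the opposite of an element of `Λ`.
      step : ∀ v → (∀ l → l ℕ.< r → Λ (v ⊗ x ^ᴬ l)) → Λ (v ⊗ x ^ᴬ r)
      step v hv = subst Λ (sym (Group.inverseʳ-unique +-group w z
        (trans (sym eq) (trans (cong (v ⊗_) root) (zeroʳ v))))) (Λ-neg w∈Λ)
        where
        z = v ⊗ x ^ᴬ r
        w = proj₁ (horner x cs v hv)
        w∈Λ = proj₁ (proj₂ (horner x cs v hv))
        eq = proj₂ (proj₂ (horner x cs v hv))
      -- Raising `i` by one keeps all but the top of the window; the one new power is supplied by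
      -- `step`.
      window : ∀ i l → l ℕ.≤ r → Λ (κ (ι N) ⊗ x ^ᴬ i ⊗ x ^ᴬ l)
      window zero    l l≤r = subst Λ (cong (_⊗ x ^ᴬ l) (sym (*-identityʳ _))) (low r l l≤r)
      window (suc i) l l≤r = [ lower l , (λ l≡r → subst (λ l → Λ (_ ⊗ x ^ᴬ l)) (sym l≡r) (step _ lower)) ]′
        (ℕ.m≤n⇒m<n∨m≡n l≤r)
        where
        lower : ∀ l → l ℕ.< r → Λ (κ (ι N) ⊗ x ^ᴬ suc i ⊗ x ^ᴬ l)
        lower l l<r = subst Λ (shift (κ (ι N)) x (x ^ᴬ i) (x ^ᴬ l)) (window i (suc l) l<r)

-- The order ℤ[√m, √n]

module Lattice (m n : ℤ) .{{_ : NonZero m}} .{{_ : NonZero n}} where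

  open Biquadratic m n
    using (L; ⟨_,_,_,_⟩; c₁; cₘ; cₙ; cₘₙ; mℚ; nℚ; fromℚ; τ; σ)
    renaming (_+_ to _⊕_; _*_ to _⊗_; -_ to ⊝_)
  private module B = Biquadratic m n

  ext : ∀ {a a′ b b′ c c′ e e′} → a ≡ a′ → b ≡ b′ → c ≡ c′ → e ≡ e′ →
        ⟨ a , b , c , e ⟩ ≡ ⟨ a′ , b′ , c′ , e′ ⟩
  ext refl refl refl refl = refl

  fromℚ-scale : ∀ q x → fromℚ q ⊗ x ≡ ⟨ q ℚ.* c₁ x , q ℚ.* cₘ x , q ℚ.* cₙ x , q ℚ.* cₘₙ x ⟩
  fromℚ-scale q ⟨ a , b , c , e ⟩ = ext (eq₁ q a b c e mℚ nℚ) (eq₂ q a b c e nℚ) (eq₂ q a c b e mℚ) (eq₃ q a b c e)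
    where
    eq₁ : ∀ q a b c e m n → q ℚ.* a ℚ.+ m ℚ.* (0ℚ ℚ.* b) ℚ.+ n ℚ.* (0ℚ ℚ.* c) ℚ.+ m ℚ.* n ℚ.* (0ℚ ℚ.* e) ≡ q ℚ.* a
    eq₁ = RingSolver.solve-∀ ℚ-ring
    eq₂ : ∀ q a b c e n → q ℚ.* b ℚ.+ 0ℚ ℚ.* a ℚ.+ n ℚ.* (0ℚ ℚ.* e ℚ.+ 0ℚ ℚ.* c) ≡ q ℚ.* b
    eq₂ = RingSolver.solve-∀ ℚ-ring
    eq₃ : ∀ q a b c e → q ℚ.* e ℚ.+ 0ℚ ℚ.* a ℚ.+ 0ℚ ℚ.* c ℚ.+ 0ℚ ℚ.* b ≡ q ℚ.* e
    eq₃ = RingSolver.solve-∀ ℚ-ring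

  fromℚ-* : ∀ p q → fromℚ (p ℚ.* q) ≡ fromℚ p ⊗ fromℚ q
  fromℚ-* p q = sym (trans (fromℚ-scale p (fromℚ q)) (ext refl (ℚ.*-zeroʳ p) (ℚ.*-zeroʳ p) (ℚ.*-zeroʳ p)))

  -- This is ℤ[√m, √n]. It may be smaller than `𝓞`: almost integrality tolerates a fixed
  -- denominator, so an order stable under `τ` and `σ` suffices.
  Λ : L → Set
  Λ x = Integral (c₁ x) × Integral (cₘ x) × Integral (cₙ x) × Integral (cₘₙ x)

  Λ-+ : ∀ {x y} → Λ x → Λ y → Λ (x ⊕ y)
  Λ-+ (a , b , c , e) (a′ , b′ , c′ , e′) =
    integral-+ a a′ , integral-+ b b′ , integral-+ c c′ , integral-+ e e′

  Λ-neg : ∀ {x} → Λ x → Λ (⊝ x)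
  Λ-neg (a , b , c , e) = integral-neg a , integral-neg b , integral-neg c , integral-neg e

  Λ-* : ∀ {x y} → Λ x → Λ y → Λ (x ⊗ y)
  Λ-* (a , b , c , e) (a′ , b′ , c′ , e′) =
      (a ∙ a′ ⊹ mᴵ ∙ (b ∙ b′) ⊹ nᴵ ∙ (c ∙ c′) ⊹ mᴵ ∙ nᴵ ∙ (e ∙ e′))
    , (a ∙ b′ ⊹ b ∙ a′ ⊹ nᴵ ∙ (c ∙ e′ ⊹ e ∙ c′))
    , (a ∙ c′ ⊹ c ∙ a′ ⊹ mᴵ ∙ (b ∙ e′ ⊹ e ∙ b′))
    , (a ∙ e′ ⊹ e ∙ a′ ⊹ b ∙ c′ ⊹ c ∙ b′)
    where
    infixl 6 _⊹_
    infixl 7 _∙_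
    _⊹_ : ∀ {p q} → Integral p → Integral q → Integral (p ℚ.+ q)
    _⊹_ = integral-+
    _∙_ : ∀ {p q} → Integral p → Integral q → Integral (p ℚ.* q)
    _∙_ = integral-*
    mᴵ : Integral mℚ
    mᴵ = m , refl
    nᴵ : Integral nℚ
    nᴵ = n , refl

  0ᴵ : Integral 0ℚ
  0ᴵ = + 0 , refl

  Λ-fromℚ : ∀ {q} → Integral q → Λ (fromℚ q)
  Λ-fromℚ q = q , 0ᴵ , 0ᴵ , 0ᴵ

  Λ-τ : ∀ {x} → Λ x → Λ (τ x)
  Λ-τ (a , b , c , e) = a , b , integral-neg c , integral-neg e

  Λ-σ : ∀ {x} → Λ x → Λ (σ x)
  Λ-σ (a , b , c , e) = a , integral-neg b , c , integral-neg e

  denominator : ∀ x → ∃[ D ] D ≢ + 0 × Λ (fromℚ (ι D) ⊗ x)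
  denominator x@(⟨ a , b , c , e ⟩) = + D , D≢0 ∘ ℤ.+-injective ,
    subst Λ (sym (fromℚ-scale (ι (+ D)) x))
      ( ↧∣⇒integral (+ D) a (ℕ.∣m⇒∣m*n (↧ₙ e) (ℕ.∣m⇒∣m*n (↧ₙ c) (ℕ.m∣m*n (↧ₙ b))))
      , ↧∣⇒integral (+ D) b (ℕ.∣m⇒∣m*n (↧ₙ e) (ℕ.∣m⇒∣m*n (↧ₙ c) (ℕ.n∣m*n (↧ₙ a))))
      , ↧∣⇒integral (+ D) c (ℕ.∣m⇒∣m*n (↧ₙ e) (ℕ.n∣m*n (↧ₙ a ℕ.* ↧ₙ b)))
      , ↧∣⇒integral (+ D) e (ℕ.n∣m*n (↧ₙ a ℕ.* ↧ₙ b ℕ.* ↧ₙ c)) )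
    where
    D : ℕ
    D = ↧ₙ a ℕ.* ↧ₙ b ℕ.* ↧ₙ c ℕ.* ↧ₙ e
    D≢0 : D ≢ 0
    D≢0 = ℕ.≢-nonZero⁻¹ D {{ℕ.m*n≢0 (↧ₙ a ℕ.* ↧ₙ b ℕ.* ↧ₙ c) (↧ₙ e)
      {{ℕ.m*n≢0 (↧ₙ a ℕ.* ↧ₙ b) (↧ₙ c) {{ℕ.m*n≢0 (↧ₙ a) (↧ₙ b)}}}}}}

  open ℚ-Algebra B.isCommutativeRing fromℚ (λ p q → refl) fromℚ-* (λ p → refl) refl refl public
    using (module Almost; quadratic⇒integral)
  open Almost Λ (λ {x} {y} → Λ-+ {x} {y}) (λ {x} {y} → Λ-* {x} {y}) (λ {x} → Λ-neg {x})
    (λ z → Λ-fromℚ (z , refl)) proj₁ denominator public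
    renaming (almostIntegral-κ to almostIntegral-fromℚ)

  almostIntegral-τ : ∀ {x} → AlmostIntegral x → AlmostIntegral (τ x)
  almostIntegral-τ = almostIntegral-hom τ B.τ-* (λ q → refl) (λ {x} → Λ-τ {x})

  almostIntegral-σ : ∀ {x} → AlmostIntegral x → AlmostIntegral (σ x)
  almostIntegral-σ = almostIntegral-hom σ B.σ-* (λ q → refl) (λ {x} → Λ-σ {x})

-- Congruences modulo 4 behind the integral basis

halve : ∀ z → + 4 ∣ + 2 * z → ∃[ w ] z ≡ + 2 * w
halve z (divides q eq) = q , ℤ.*-cancelˡ-≡ (+ 2) z (+ 2 * q) (trans eq (regroup q))
  where
  regroup : ∀ q → q * + 4 ≡ + 2 * (+ 2 * q)
  regroup = solve-∀

-- Modulo 4 the number `- v c²` is `2 c²` or `c²`, and squares are 0 or 1. All conditions are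
-- phrased as divisibility by 4, the one relation that `mod4` handles: `v ≡ 2, 3` becomes a product,
-- and evenness of `a` becomes `4 ∣ 2 a`.
2,3-norm : ∀ v a c → + 4 ∣ (v + - + 2) * (v + - + 3) → + 4 ∣ a * a + - (v * (c * c)) →
           (+ 4 ∣ + 2 * a) × (+ 4 ∣ + 2 * c)
2,3-norm v a c h₁ h₂ = proj₁ conclusion , proj₁ (proj₂ conclusion)
  where
  V A C : Expr 3
  V = X (# 0)
  A = X (# 1)
  C = X (# 2)
  conclusion = mod4
    ((V ⊞ ⊟ K 2) ⊠ (V ⊞ ⊟ K 3) ∷ A ⊠ A ⊞ ⊟ (V ⊠ (C ⊠ C)) ∷ [])
    (K 2 ⊠ A ∷ K 2 ⊠ C ∷ []) tt (v ∷ a ∷ c ∷ []) (h₁ , h₂ , tt)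

1-norm : ∀ v a b → + 4 ∣ v + - + 1 → + 4 ∣ + 2 * a → + 4 ∣ a * a + - (v * (b * b)) → + 4 ∣ + 2 * b
1-norm v a b h₁ h₂ h₃ = proj₁ (mod4
    (V ⊞ ⊟ K 1 ∷ K 2 ⊠ A ∷ A ⊠ A ⊞ ⊟ (V ⊠ (B ⊠ B)) ∷ [])
    (K 2 ⊠ B ∷ []) tt (v ∷ a ∷ b ∷ []) (h₁ , h₂ , h₃ , tt))
  where
  V A B : Expr 3
  V = X (# 0)
  A = X (# 1)
  B = X (# 2)

-- From `m′ d ≡ 1` both factors are odd and `m′ ≡ d` modulo 4. So `d + m′ ≡ 2 d ≡ 2`, and
-- `k = m′ n′ ≡ d n′ = n`, while `n′ ≡ n` modulo 2 because `d` is odd.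
cofactors : ∀ d m n → + 4 ∣ m * d + - + 1 → + 4 ∣ (n * d + - + 2) * (n * d + - + 3) →
            (+ 4 ∣ d + m + - + 2) × (+ 4 ∣ m * n + - (n * d)) × (+ 4 ∣ + 2 * (n + - (n * d))) ×
            (+ 4 ∣ (m * n + - + 2) * (m * n + - + 3))
cofactors d m n h₁ h₂ = proj₁ c , proj₁ (proj₂ c) , proj₁ (proj₂ (proj₂ c)) , proj₁ (proj₂ (proj₂ (proj₂ c)))
  where
  D M N : Expr 3
  D = X (# 0)
  M = X (# 1)
  N = X (# 2)
  c = mod4
    (M ⊠ D ⊞ ⊟ K 1 ∷ (N ⊠ D ⊞ ⊟ K 2) ⊠ (N ⊠ D ⊞ ⊟ K 3) ∷ [])
    (D ⊞ M ⊞ ⊟ K 2 ∷ M ⊠ N ⊞ ⊟ (N ⊠ D) ∷ K 2 ⊠ (N ⊞ ⊟ (N ⊠ D)) ∷ (M ⊠ N ⊞ ⊟ K 2) ⊠ (M ⊠ N ⊞ ⊟ K 3) ∷ [])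
    tt (d ∷ m ∷ n ∷ []) (h₁ , h₂ , tt)

-- The relative norm of (A + B √m + C √n + F √k) / 2 over ℚ(√m) is (w + v √m) / 2 with
-- v = A B - n′ C F, and it is integral only if w ≡ v (mod 2).
same-parity : ∀ n n′ A B C F w → + 4 ∣ (n + - + 2) * (n + - + 3) → + 4 ∣ + 2 * (n′ + - n) →
  + 4 ∣ A * A + B * B + - (n * (C * C + F * F)) + - (+ 2 * w) →
  + 4 ∣ w * w + - ((A * B + - (n′ * (C * F))) * (A * B + - (n′ * (C * F)))) →
  (+ 4 ∣ + 2 * (A + - B)) × (+ 4 ∣ + 2 * (C + - F))
same-parity n n′ A B C F w h₁ h₂ h₃ h₄ = proj₁ conclusion , proj₁ (proj₂ conclusion)
  where
  N N′ Aᴱ Bᴱ Cᴱ Fᴱ W : Expr 7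
  N  = X (# 0)
  N′ = X (# 1)
  Aᴱ = X (# 2)
  Bᴱ = X (# 3)
  Cᴱ = X (# 4)
  Fᴱ = X (# 5)
  W  = X (# 6)
  conclusion = mod4
    ((N ⊞ ⊟ K 2) ⊠ (N ⊞ ⊟ K 3) ∷ K 2 ⊠ (N′ ⊞ ⊟ N) ∷
     Aᴱ ⊠ Aᴱ ⊞ Bᴱ ⊠ Bᴱ ⊞ ⊟ (N ⊠ (Cᴱ ⊠ Cᴱ ⊞ Fᴱ ⊠ Fᴱ)) ⊞ ⊟ (K 2 ⊠ W) ∷
     W ⊠ W ⊞ ⊟ ((Aᴱ ⊠ Bᴱ ⊞ ⊟ (N′ ⊠ (Cᴱ ⊠ Fᴱ))) ⊠ (Aᴱ ⊠ Bᴱ ⊞ ⊟ (N′ ⊠ (Cᴱ ⊠ Fᴱ)))) ∷ [])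
    (K 2 ⊠ (Aᴱ ⊞ ⊟ Bᴱ) ∷ K 2 ⊠ (Cᴱ ⊞ ⊟ Fᴱ) ∷ []) tt
    (n ∷ n′ ∷ A ∷ B ∷ C ∷ F ∷ w ∷ []) (h₁ , h₂ , h₃ , h₄ , tt)

-- Replacing `m` by 1 and `k` by `n` beforehand removes two variables, so that 4^7 residue vectors
-- are enumerated rather than 4^9.
same-parity′ : ∀ m n n′ k A B C F w → + 4 ∣ m + - + 1 → + 4 ∣ k + - n →
  + 4 ∣ (n + - + 2) * (n + - + 3) → + 4 ∣ + 2 * (n′ + - n) →
  + 4 ∣ A * A + m * (B * B) + - (n * (C * C)) + - (k * (F * F)) + - (+ 2 * w) →
  + 4 ∣ w * w + - (m * ((A * B + - (n′ * (C * F))) * (A * B + - (n′ * (C * F))))) →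
  (+ 4 ∣ + 2 * (A + - B)) × (+ 4 ∣ + 2 * (C + - F))
same-parity′ m n n′ k A B C F w h₁ h₂ h₃ h₄ h₅ h₆ = same-parity n n′ A B C F w h₃ h₄
  (subst (+ 4 ∣_) (eq₁ m n k A B C F w) (∣m∣n⇒∣m+n (∣m∣n⇒∣m+n h₅ (∣n⇒∣m*n (F * F) h₂)) (∣n⇒∣m*n (- (B * B)) h₁)))
  (subst (+ 4 ∣_) (eq₂ m w (A * B + - (n′ * (C * F))))
    (∣m∣n⇒∣m+n h₆ (∣n⇒∣m*n ((A * B + - (n′ * (C * F))) * (A * B + - (n′ * (C * F)))) h₁)))
  where
  eq₁ : ∀ m n k A B C F w → A * A + m * (B * B) + - (n * (C * C)) + - (k * (F * F)) + - (+ 2 * w) +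
          (F * F) * (k + - n) + (- (B * B)) * (m + - + 1) ≡
        A * A + B * B + - (n * (C * C + F * F)) + - (+ 2 * w)
  eq₁ = solve-∀
  eq₂ : ∀ m w v → w * w + - (m * (v * v)) + (v * v) * (m + - + 1) ≡ w * w + - (v * v)
  eq₂ = solve-∀

2× 4× : ℚ → ℚ
2× q = q ℚ.+ q
4× q = 2× (2× q)

norm-divisible : ∀ v α β p q → ι α ≡ 2× p → ι β ≡ 2× q → Integral (p ℚ.* p ℚ.- ι v ℚ.* (q ℚ.* q)) →
                 + 4 ∣ α * α + - (v * (β * β))
norm-divisible v α β p q α≡ β≡ (z , eq) = divides z (ι-injective {α * α + - (v * (β * β))} {z * + 4} (begin
  ι (α * α + - (v * (β * β)))                     ≡⟨ ι-⟦⟧ (A ⊠ A ⊞ ⊟ (V ⊠ (B ⊠ B))) (v ∷ α ∷ β ∷ []) ⟩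
  ι α ℚ.* ι α ℚ.+ ℚ.- (ι v ℚ.* (ι β ℚ.* ι β))     ≡⟨ cong₂ (λ x y → x ℚ.* x ℚ.+ ℚ.- (ι v ℚ.* (y ℚ.* y))) α≡ β≡ ⟩
  2× p ℚ.* 2× p ℚ.+ ℚ.- (ι v ℚ.* (2× q ℚ.* 2× q)) ≡⟨ regroup (ι v) p q ⟩
  (p ℚ.* p ℚ.- ι v ℚ.* (q ℚ.* q)) ℚ.* ι (+ 4)     ≡⟨ cong (ℚ._* ι (+ 4)) eq ⟩
  ι z ℚ.* ι (+ 4)                                 ≡⟨ ι-* z (+ 4) ⟨
  ι (z * + 4)                                     ∎))
  where
  V A B : Expr 3
  V = X (# 0)
  A = X (# 1)
  B = X (# 2)
  regroup : ∀ v p q → (p ℚ.+ p) ℚ.* (p ℚ.+ p) ℚ.+ ℚ.- (v ℚ.* ((q ℚ.+ q) ℚ.* (q ℚ.+ q))) ≡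
                      (p ℚ.* p ℚ.- v ℚ.* (q ℚ.* q)) ℚ.* ι (+ 4)
  regroup = RingSolver.solve-∀ ℚ-ring

-- Four times the norm is `(2 p)² - v (2 q)²`, so `v (2 q)²` is an integer, and a square-free `v`
-- cannot absorb the square of a denominator.
integral-2q : ∀ v → SquareFree v → ∀ p q → Integral (2× p) → Integral (p ℚ.* p ℚ.- ι v ℚ.* (q ℚ.* q)) →
              Integral (2× q)
integral-2q v sqf p q h₁ h₂ = squarefree⇒integral {v} sqf (2× q)
  (subst Integral (regroup (ι v) p q) (integral-+ (integral-* h₁ h₁) (integral-* (- + 4 , refl) h₂)))
  where
  regroup : ∀ v p q → (p ℚ.+ p) ℚ.* (p ℚ.+ p) ℚ.+ ι (- + 4) ℚ.* (p ℚ.* p ℚ.- v ℚ.* (q ℚ.* q)) ≡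
                      v ℚ.* ((q ℚ.+ q) ℚ.* (q ℚ.+ q))
  regroup = RingSolver.solve-∀ ℚ-ring

quarter : ∀ {q α} → ι α ≡ 4× q → + 4 ∣ + 2 * α → ∃[ A ] q ≡ ½ ℚ.* ι A
quarter {q} {α} α≡ h = A , (begin
  q                                   ≡⟨ eq₁ q ⟩
  (½ ℚ.* ½) ℚ.* (4× q)                ≡⟨ cong (½ ℚ.* ½ ℚ.*_)
    (trans (sym α≡) (trans (cong ι (proj₂ (halve α h))) (ι-* (+ 2) A))) ⟩
  (½ ℚ.* ½) ℚ.* (ι (+ 2) ℚ.* ι A)     ≡⟨ eq₂ (ι A) ⟩
  ½ ℚ.* ι A ∎)
  where
  A = proj₁ (halve α h)
  eq₁ : ∀ q → q ≡ (½ ℚ.* ½) ℚ.* ((q ℚ.+ q) ℚ.+ (q ℚ.+ q))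
  eq₁ = RingSolver.solve-∀ ℚ-ring
  eq₂ : ∀ q → (½ ℚ.* ½) ℚ.* (ι (+ 2) ℚ.* q) ≡ ½ ℚ.* q
  eq₂ = RingSolver.solve-∀ ℚ-ring

-- Traces and norms through the three quadratic subfields

module TracesAndNorms (m n : ℤ) .{{_ : NonZero m}} .{{_ : NonZero n}} where

  open Biquadratic m n
    using (L; ⟨_,_,_,_⟩; mℚ; nℚ; fromℚ; τ; σ; √m; √n)
    renaming (_+_ to _⊕_; _*_ to _⊗_)
  open Lattice m n

  -- Meant for a conjugate `y` of `x`: sum and product are almost integral, and being rational they
  -- are integers.
  trace-and-norm : ∀ {x y p q} → AlmostIntegral x → AlmostIntegral y →
                   x ⊕ y ≡ fromℚ p → x ⊗ y ≡ fromℚ q → Integral p × Integral q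
  trace-and-norm {x} {y} {p} {q} hx hy sum prod =
    almostIntegral-fromℚ p (subst AlmostIntegral sum (almostIntegral-+ {x} {y} hx hy)) ,
    almostIntegral-fromℚ q (subst AlmostIntegral prod (almostIntegral-* {x} {y} hx hy))

  norm₁ : ∀ m n p q → p ℚ.* p ℚ.+ m ℚ.* (q ℚ.* ℚ.- q) ℚ.+ n ℚ.* (0ℚ ℚ.* 0ℚ) ℚ.+ m ℚ.* n ℚ.* (0ℚ ℚ.* 0ℚ) ≡
          p ℚ.* p ℚ.- m ℚ.* (q ℚ.* q)
  norm₁ = RingSolver.solve-∀ ℚ-ring

  norm₂ : ∀ m p q → p ℚ.* ℚ.- q ℚ.+ q ℚ.* p ℚ.+ m ℚ.* (0ℚ ℚ.* 0ℚ ℚ.+ 0ℚ ℚ.* 0ℚ) ≡ 0ℚ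
  norm₂ = RingSolver.solve-∀ ℚ-ring

  quadratic-m : ∀ p q → AlmostIntegral ⟨ p , q , 0ℚ , 0ℚ ⟩ →
    Integral (2× p) × Integral (p ℚ.* p ℚ.- mℚ ℚ.* (q ℚ.* q))
  quadratic-m p q h = trace-and-norm {⟨ p , q , 0ℚ , 0ℚ ⟩} {⟨ p , ℚ.- q , 0ℚ , 0ℚ ⟩} h
    (almostIntegral-σ {⟨ p , q , 0ℚ , 0ℚ ⟩} h)
    (ext refl (ℚ.+-inverseʳ q) refl refl)
    (ext (norm₁ mℚ nℚ p q) (norm₂ nℚ p q) (eq₃ mℚ p q) (eq₄ p q))
    where
    eq₃ : ∀ m p q → p ℚ.* 0ℚ ℚ.+ 0ℚ ℚ.* p ℚ.+ m ℚ.* (q ℚ.* 0ℚ ℚ.+ 0ℚ ℚ.* ℚ.- q) ≡ 0ℚ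
    eq₃ = RingSolver.solve-∀ ℚ-ring
    eq₄ : ∀ p q → p ℚ.* 0ℚ ℚ.+ 0ℚ ℚ.* p ℚ.+ q ℚ.* 0ℚ ℚ.+ 0ℚ ℚ.* ℚ.- q ≡ 0ℚ
    eq₄ = RingSolver.solve-∀ ℚ-ring

  quadratic-n : ∀ p q → AlmostIntegral ⟨ p , 0ℚ , q , 0ℚ ⟩ →
    Integral (2× p) × Integral (p ℚ.* p ℚ.- nℚ ℚ.* (q ℚ.* q))
  quadratic-n p q h = trace-and-norm {⟨ p , 0ℚ , q , 0ℚ ⟩} {⟨ p , 0ℚ , ℚ.- q , 0ℚ ⟩} h
    (almostIntegral-τ {⟨ p , 0ℚ , q , 0ℚ ⟩} h)
    (ext refl refl (ℚ.+-inverseʳ q) refl)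
    (ext (eq₁ mℚ nℚ p q) (eq₂ nℚ p q) (norm₂ mℚ p q) (eq₄ p q))
    where
    eq₁ : ∀ m n p q → p ℚ.* p ℚ.+ m ℚ.* (0ℚ ℚ.* 0ℚ) ℚ.+ n ℚ.* (q ℚ.* ℚ.- q) ℚ.+ m ℚ.* n ℚ.* (0ℚ ℚ.* 0ℚ) ≡
          p ℚ.* p ℚ.- n ℚ.* (q ℚ.* q)
    eq₁ = RingSolver.solve-∀ ℚ-ring
    eq₂ : ∀ n p q → p ℚ.* 0ℚ ℚ.+ 0ℚ ℚ.* p ℚ.+ n ℚ.* (q ℚ.* 0ℚ ℚ.+ 0ℚ ℚ.* ℚ.- q) ≡ 0ℚ
    eq₂ = RingSolver.solve-∀ ℚ-ring
    eq₄ : ∀ p q → p ℚ.* 0ℚ ℚ.+ 0ℚ ℚ.* p ℚ.+ 0ℚ ℚ.* ℚ.- q ℚ.+ q ℚ.* 0ℚ ≡ 0ℚ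
    eq₄ = RingSolver.solve-∀ ℚ-ring

  quadratic-mn : ∀ p q → AlmostIntegral ⟨ p , 0ℚ , 0ℚ , q ⟩ →
    Integral (2× p) × Integral (p ℚ.* p ℚ.- mℚ ℚ.* nℚ ℚ.* (q ℚ.* q))
  quadratic-mn p q h = trace-and-norm {⟨ p , 0ℚ , 0ℚ , q ⟩} {⟨ p , 0ℚ , 0ℚ , ℚ.- q ⟩} h
    (almostIntegral-τ {⟨ p , 0ℚ , 0ℚ , q ⟩} h)
    (ext refl refl refl (ℚ.+-inverseʳ q))
    (ext (eq₁ mℚ nℚ p q) (eq₂ nℚ p q) (eq₂ mℚ p q) (eq₄ p q))
    where
    eq₁ : ∀ m n p q → p ℚ.* p ℚ.+ m ℚ.* (0ℚ ℚ.* 0ℚ) ℚ.+ n ℚ.* (0ℚ ℚ.* 0ℚ) ℚ.+ m ℚ.* n ℚ.* (q ℚ.* ℚ.- q) ≡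
          p ℚ.* p ℚ.- m ℚ.* n ℚ.* (q ℚ.* q)
    eq₁ = RingSolver.solve-∀ ℚ-ring
    eq₂ : ∀ n p q → p ℚ.* 0ℚ ℚ.+ 0ℚ ℚ.* p ℚ.+ n ℚ.* (0ℚ ℚ.* ℚ.- q ℚ.+ q ℚ.* 0ℚ) ≡ 0ℚ
    eq₂ = RingSolver.solve-∀ ℚ-ring
    eq₄ : ∀ p q → p ℚ.* ℚ.- q ℚ.+ q ℚ.* p ℚ.+ 0ℚ ℚ.* 0ℚ ℚ.+ 0ℚ ℚ.* 0ℚ ≡ 0ℚ
    eq₄ = RingSolver.solve-∀ ℚ-ring

  module _ {a b c e : ℚ} (h : AlmostIntegral ⟨ a , b , c , e ⟩) where

    private
      x : L
      x = ⟨ a , b , c , e ⟩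

    -- The relative trace `x + τ x = 2 a + 2 b √m` lies in ℚ(√m), where its own trace and norm are
    -- available. The next two lemmas do the same with the other quadratic subfields.
    relative-trace-m : Integral (4× a) × Integral (2× a ℚ.* 2× a ℚ.- mℚ ℚ.* (2× b ℚ.* 2× b))
    relative-trace-m = quadratic-m (2× a) (2× b)
      (subst AlmostIntegral (ext refl refl (ℚ.+-inverseʳ c) (ℚ.+-inverseʳ e))
        (almostIntegral-+ {x} {τ x} h (almostIntegral-τ {x} h)))

    relative-trace-n : Integral (4× a) × Integral (2× a ℚ.* 2× a ℚ.- nℚ ℚ.* (2× c ℚ.* 2× c))
    relative-trace-n = quadratic-n (2× a) (2× c)
      (subst AlmostIntegral (ext refl (ℚ.+-inverseʳ b) refl (ℚ.+-inverseʳ e))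
        (almostIntegral-+ {x} {σ x} h (almostIntegral-σ {x} h)))

    relative-trace-mn : Integral (4× a) × Integral (2× a ℚ.* 2× a ℚ.- mℚ ℚ.* nℚ ℚ.* (2× e ℚ.* 2× e))
    relative-trace-mn = quadratic-mn (2× a) (2× e)
      (subst AlmostIntegral (ext refl (ℚ.+-inverseʳ b) (ℚ.+-inverseʳ c) (cong (e ℚ.+_) (-‿involutive e)))
        (almostIntegral-+ {x} {σ (τ x)} h (almostIntegral-σ {τ x} (almostIntegral-τ {x} h))))

    module _ (sqf-m : SquareFree m) (sqf-n : SquareFree n) where

      integral-4b : Integral (4× b)
      integral-4b = integral-2q m sqf-m (2× a) (2× b) (proj₁ relative-trace-m) (proj₂ relative-trace-m)

      integral-4c : Integral (4× c)
      integral-4c = integral-2q n sqf-n (2× a) (2× c) (proj₁ relative-trace-n) (proj₂ relative-trace-n)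

  module _ {a b c e : ℚ} (h : AlmostIntegral ⟨ a , b , c , e ⟩) (sqf-m : SquareFree m) (sqf-n : SquareFree n) where

    -- Multiplication by `√m` moves `e` to the `√n`-coordinate with a factor `m`. This detour is
    -- taken because `m n` is divisible by `d²` and need not be square-free, so `integral-2q` does
    -- not fit the subfield ℚ(√k) directly.
    integral-m4e : Integral (ι m ℚ.* 4× e)
    integral-m4e = subst Integral (eq mℚ a b c e) (integral-4c (almostIntegral-* {⟨ a , b , c , e ⟩} {√m} h
        (Λ⇒almostIntegral {√m} (0ᴵ , (+ 1 , refl) , 0ᴵ , 0ᴵ))) sqf-m sqf-n)
      where
      eq : ∀ m a b c e → let y = a ℚ.* 0ℚ ℚ.+ c ℚ.* 0ℚ ℚ.+ m ℚ.* (b ℚ.* 0ℚ ℚ.+ e ℚ.* 1ℚ) in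
           (y ℚ.+ y) ℚ.+ (y ℚ.+ y) ≡ m ℚ.* ((e ℚ.+ e) ℚ.+ (e ℚ.+ e))
      eq = RingSolver.solve-∀ ℚ-ring

    integral-n4e : Integral (ι n ℚ.* 4× e)
    integral-n4e = subst Integral (eq nℚ a b c e) (integral-4b (almostIntegral-* {⟨ a , b , c , e ⟩} {√n} h
        (Λ⇒almostIntegral {√n} (0ᴵ , 0ᴵ , (+ 1 , refl) , 0ᴵ))) sqf-m sqf-n)
      where
      eq : ∀ n a b c e → let y = a ℚ.* 0ℚ ℚ.+ b ℚ.* 0ℚ ℚ.+ n ℚ.* (c ℚ.* 0ℚ ℚ.+ e ℚ.* 1ℚ) in
           (y ℚ.+ y) ℚ.+ (y ℚ.+ y) ≡ n ℚ.* ((e ℚ.+ e) ℚ.+ (e ℚ.+ e))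
      eq = RingSolver.solve-∀ ℚ-ring

-- Coordinates with respect to 1, √m, √n, √k

-- m = m′ d and n = n′ d, so that √m √k = m′ √n, √n √k = n′ √m and √m √n = d √k.
module Coordinates (m n : ℤ) .{{_ : NonZero m}} .{{_ : NonZero n}} (d : ℕ) (m′ n′ : ℤ) (δ : ℚ)
  (m≡m′d : m ≡ m′ * + d) (n≡n′d : n ≡ n′ * + d) (δd≡1 : δ ℚ.* ι (+ d) ≡ 1ℚ) where

  open Biquadratic m n
    using (L; ⟨_,_,_,_⟩; mℚ; nℚ; fromℚ; τ)
    renaming (_+_ to _⊕_; _*_ to _⊗_; -_ to ⊝_)
  open Lattice m n using (ext; fromℚ-scale)

  D M N : ℚ
  D = ι (+ d)
  M = ι m′
  N = ι n′

  mℚ≡MD : mℚ ≡ M ℚ.* D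
  mℚ≡MD = trans (cong ι m≡m′d) (ι-* m′ (+ d))

  nℚ≡ND : nℚ ≡ N ℚ.* D
  nℚ≡ND = trans (cong ι n≡n′d) (ι-* n′ (+ d))

  -- Coordinates with respect to 1, √m, √n, √k.
  ⟪_,_,_,_⟫ : ℚ → ℚ → ℚ → ℚ → L
  ⟪ a , b , c , f ⟫ = ⟨ a , b , c , δ ℚ.* f ⟩

  ⟪⟫-cong : ∀ {a a′ b b′ c c′ f f′} → a ≡ a′ → b ≡ b′ → c ≡ c′ → f ≡ f′ → ⟪ a , b , c , f ⟫ ≡ ⟪ a′ , b′ , c′ , f′ ⟫
  ⟪⟫-cong p q r s = ext p q r (cong (δ ℚ.*_) s)

  δ[De]≡e : ∀ e → δ ℚ.* (D ℚ.* e) ≡ e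
  δ[De]≡e e = trans (sym (ℚ.*-assoc δ D e)) (trans (cong (ℚ._* e) δd≡1) (ℚ.*-identityˡ e))

  δ-injective : ∀ {f f′} → δ ℚ.* f ≡ δ ℚ.* f′ → f ≡ f′
  δ-injective {f} {f′} eq = trans (sym (D[δf]≡f f)) (trans (cong (D ℚ.*_) eq) (D[δf]≡f f′))
    where
    D[δf]≡f : ∀ f → D ℚ.* (δ ℚ.* f) ≡ f
    D[δf]≡f f = trans (sym (ℚ.*-assoc D δ f)) (trans (cong (ℚ._* f) (trans (ℚ.*-comm D δ) δd≡1)) (ℚ.*-identityˡ f))

  δ0≡0 : δ ℚ.* 0ℚ ≡ 0ℚ
  δ0≡0 = ℚ.*-zeroʳ δ

  fromℚ≡⟪⟫ : ∀ q → fromℚ q ≡ ⟪ q , 0ℚ , 0ℚ , 0ℚ ⟫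
  fromℚ≡⟪⟫ q = ext refl refl refl (sym δ0≡0)

  ⟪⟫-+ : ∀ a b c f a′ b′ c′ f′ →
    ⟪ a , b , c , f ⟫ ⊕ ⟪ a′ , b′ , c′ , f′ ⟫ ≡ ⟪ a ℚ.+ a′ , b ℚ.+ b′ , c ℚ.+ c′ , f ℚ.+ f′ ⟫
  ⟪⟫-+ a b c f a′ b′ c′ f′ = ext refl refl refl (sym (ℚ.*-distribˡ-+ δ f f′))

  ⟪⟫-neg : ∀ a b c f → ⊝ ⟪ a , b , c , f ⟫ ≡ ⟪ ℚ.- a , ℚ.- b , ℚ.- c , ℚ.- f ⟫
  ⟪⟫-neg a b c f = ext refl refl refl (-‿distribʳ-* δ f)

  ⟪⟫-τ : ∀ a b c f → τ ⟪ a , b , c , f ⟫ ≡ ⟪ a , b , ℚ.- c , ℚ.- f ⟫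
  ⟪⟫-τ a b c f = ext refl refl refl (-‿distribʳ-* δ f)

  ⟪⟫-* : ∀ a b c f a′ b′ c′ f′ →
    ⟪ a , b , c , f ⟫ ⊗ ⟪ a′ , b′ , c′ , f′ ⟫ ≡
    ⟪ a ℚ.* a′ ℚ.+ M ℚ.* D ℚ.* (b ℚ.* b′) ℚ.+ N ℚ.* D ℚ.* (c ℚ.* c′) ℚ.+ M ℚ.* N ℚ.* (f ℚ.* f′)
    , a ℚ.* b′ ℚ.+ b ℚ.* a′ ℚ.+ N ℚ.* (c ℚ.* f′ ℚ.+ f ℚ.* c′)
    , a ℚ.* c′ ℚ.+ c ℚ.* a′ ℚ.+ M ℚ.* (b ℚ.* f′ ℚ.+ f ℚ.* b′)
    , a ℚ.* f′ ℚ.+ f ℚ.* a′ ℚ.+ D ℚ.* (b ℚ.* c′ ℚ.+ c ℚ.* b′) ⟫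
  ⟪⟫-* a b c f a′ b′ c′ f′ = ext
    (trans (cong₂ (λ m n → a ℚ.* a′ ℚ.+ m ℚ.* (b ℚ.* b′) ℚ.+ n ℚ.* (c ℚ.* c′) ℚ.+ m ℚ.* n ℚ.*
      (δ ℚ.* f ℚ.* (δ ℚ.* f′))) mℚ≡MD nℚ≡ND)
      (trans (eq₁ M N D δ a b c f a′ b′ c′ f′)
      (trans (cong (λ u → a ℚ.* a′ ℚ.+ M ℚ.* D ℚ.* (b ℚ.* b′) ℚ.+ N ℚ.* D ℚ.* (c ℚ.* c′) ℚ.+ M ℚ.* N ℚ.*
        (u ℚ.* u) ℚ.* (f ℚ.* f′)) δd≡1)
             (cong (λ v → a ℚ.* a′ ℚ.+ M ℚ.* D ℚ.* (b ℚ.* b′) ℚ.+ N ℚ.* D ℚ.* (c ℚ.* c′) ℚ.+ v ℚ.* (f ℚ.* f′))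
               (ℚ.*-identityʳ (M ℚ.* N))))))
    (via {nℚ} {N} nℚ≡ND a b′ b a′ c f′ f c′)
    (via {mℚ} {M} mℚ≡MD a c′ c a′ b f′ f b′)
    (trans (eq₄ (b ℚ.* c′) (c ℚ.* b′) δ a f a′ f′)
      (trans (cong (λ u → δ ℚ.* (a ℚ.* f′ ℚ.+ f ℚ.* a′) ℚ.+ u ℚ.* (b ℚ.* c′ ℚ.+ c ℚ.* b′)) (sym δd≡1))
             (eq₅ δ D (a ℚ.* f′ ℚ.+ f ℚ.* a′) (b ℚ.* c′ ℚ.+ c ℚ.* b′))))
    where
    eq₁ : ∀ M N D δ a b c f a′ b′ c′ f′ →
      a ℚ.* a′ ℚ.+ M ℚ.* D ℚ.* (b ℚ.* b′) ℚ.+ N ℚ.* D ℚ.* (c ℚ.* c′) ℚ.+ M ℚ.* D ℚ.* (N ℚ.* D) ℚ.*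
        (δ ℚ.* f ℚ.* (δ ℚ.* f′)) ≡
      a ℚ.* a′ ℚ.+ M ℚ.* D ℚ.* (b ℚ.* b′) ℚ.+ N ℚ.* D ℚ.* (c ℚ.* c′) ℚ.+ M ℚ.* N ℚ.* (δ ℚ.* D ℚ.* (δ ℚ.* D)) ℚ.*
        (f ℚ.* f′)
    eq₁ = RingSolver.solve-∀ ℚ-ring
    eq₂ : ∀ V D δ a b′ b a′ c f′ f c′ →
      a ℚ.* b′ ℚ.+ b ℚ.* a′ ℚ.+ V ℚ.* D ℚ.* (c ℚ.* (δ ℚ.* f′) ℚ.+ δ ℚ.* f ℚ.* c′) ≡
      a ℚ.* b′ ℚ.+ b ℚ.* a′ ℚ.+ V ℚ.* (δ ℚ.* D) ℚ.* (c ℚ.* f′ ℚ.+ f ℚ.* c′)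
    eq₂ = RingSolver.solve-∀ ℚ-ring
    via : ∀ {v V} → v ≡ V ℚ.* D → ∀ a b′ b a′ c f′ f c′ →
      a ℚ.* b′ ℚ.+ b ℚ.* a′ ℚ.+ v ℚ.* (c ℚ.* (δ ℚ.* f′) ℚ.+ δ ℚ.* f ℚ.* c′) ≡
      a ℚ.* b′ ℚ.+ b ℚ.* a′ ℚ.+ V ℚ.* (c ℚ.* f′ ℚ.+ f ℚ.* c′)
    via {v} {V} v≡VD a b′ b a′ c f′ f c′ =
      trans (cong (λ v → a ℚ.* b′ ℚ.+ b ℚ.* a′ ℚ.+ v ℚ.* (c ℚ.* (δ ℚ.* f′) ℚ.+ δ ℚ.* f ℚ.* c′)) v≡VD)
      (trans (eq₂ V D δ a b′ b a′ c f′ f c′)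
             (cong (λ v → a ℚ.* b′ ℚ.+ b ℚ.* a′ ℚ.+ v ℚ.* (c ℚ.* f′ ℚ.+ f ℚ.* c′))
               (trans (cong (V ℚ.*_) δd≡1) (ℚ.*-identityʳ V))))
    eq₄ : ∀ u v δ a f a′ f′ → a ℚ.* (δ ℚ.* f′) ℚ.+ δ ℚ.* f ℚ.* a′ ℚ.+ u ℚ.+ v ≡
      δ ℚ.* (a ℚ.* f′ ℚ.+ f ℚ.* a′) ℚ.+ 1ℚ ℚ.* (u ℚ.+ v)
    eq₄ = RingSolver.solve-∀ ℚ-ring
    eq₅ : ∀ δ D u v → δ ℚ.* u ℚ.+ δ ℚ.* D ℚ.* v ≡ δ ℚ.* (u ℚ.+ D ℚ.* v)
    eq₅ = RingSolver.solve-∀ ℚ-ring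

  fromℚ-⟪⟫ : ∀ q a b c f → fromℚ q ⊗ ⟪ a , b , c , f ⟫ ≡ ⟪ q ℚ.* a , q ℚ.* b , q ℚ.* c , q ℚ.* f ⟫
  fromℚ-⟪⟫ q a b c f = trans (fromℚ-scale q ⟪ a , b , c , f ⟫) (ext refl refl refl (swap q δ f))
    where
    swap : ∀ q δ f → q ℚ.* (δ ℚ.* f) ≡ δ ℚ.* (q ℚ.* f)
    swap = RingSolver.solve-∀ ℚ-ring

  -- Coordinates with respect to the integral basis γ₁, γ₂, γ₃, γ₄.
  basis : ℤ → ℤ → ℤ → ℤ → L
  basis p b q f = ⟪ ι p ℚ.+ ½ ℚ.* ι b , ½ ℚ.* ι b , ι q ℚ.+ ½ ℚ.* ι f , ½ ℚ.* ι f ⟫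

-- The integral basis

module IntegralBasis (m n : ℤ) .{{_ : NonZero m}} .{{_ : NonZero n}} (d : ℕ) (m′ n′ : ℤ) (δ : ℚ)
  (m≡m′d : m ≡ m′ * + d) (n≡n′d : n ≡ n′ * + d) (δd≡1 : δ ℚ.* ι (+ d) ≡ 1ℚ)
  (d-greatest : ∀ {b} → b ℕ.∣ ∣ m ∣ → b ℕ.∣ ∣ n ∣ → b ℕ.∣ d)
  (sqf-m : SquareFree m) (sqf-n : SquareFree n)
  (μ κ : ℤ) (m≡1+4μ : m ≡ + 1 + μ * + 4) (d+m′≡2+4κ : + d + m′ ≡ + 2 + κ * + 4)
  (n≡2,3 : + 4 ∣ (n + - + 2) * (n + - + 3)) where

  open Biquadratic m n
    using (L; ⟨_,_,_,_⟩; c₁; cₘ; cₙ; cₘₙ; mℚ; nℚ; fromℚ; _·_; √m; 𝓞; τ; σ; H₁; 𝔄; IsFreeGenerator)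
    renaming (_-_ to _⊖_; _+_ to _⊕_; _*_ to _⊗_; -_ to ⊝_)
  open Lattice m n
  open TracesAndNorms m n
  open Coordinates m n d m′ n′ δ m≡m′d n≡n′d δd≡1

  4∣m-1 : + 4 ∣ m + - + 1
  4∣m-1 = divides μ (trans (cong (_+ - + 1) m≡1+4μ) (cancel μ))
    where
    cancel : ∀ μ → + 1 + μ * + 4 + - + 1 ≡ μ * + 4
    cancel = solve-∀

  cofactors-mod-4 : (+ 4 ∣ + d + m′ + - + 2) × (+ 4 ∣ m′ * n′ + - (n′ * + d)) × (+ 4 ∣ + 2 * (n′ + - (n′ * + d))) ×
                    (+ 4 ∣ (m′ * n′ + - + 2) * (m′ * n′ + - + 3))
  cofactors-mod-4 = cofactors (+ d) m′ n′ (subst (λ m → + 4 ∣ m + - + 1) m≡m′d 4∣m-1)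
                                          (subst (λ n → + 4 ∣ (n + - + 2) * (n + - + 3)) n≡n′d n≡2,3)

  -- The relative traces bound the denominators by 4. The norms of these traces, read modulo 4, then
  -- make all four numerators even.
  halves : ∀ {a b c e} → AlmostIntegral ⟨ a , b , c , e ⟩ →
    ∃[ A ] ∃[ B ] ∃[ C ] ∃[ F ] ⟨ a , b , c , e ⟩ ≡ ⟪ ½ ℚ.* ι A , ½ ℚ.* ι B , ½ ℚ.* ι C , ½ ℚ.* ι F ⟫
  halves {a} {b} {c} {e} h = proj₁ qa , proj₁ qb , proj₁ qc , proj₁ qf ,
    ext (proj₂ qa) (proj₂ qb) (proj₂ qc) (trans (sym (δ[De]≡e e)) (cong (δ ℚ.*_) (proj₂ qf)))
    where
    4aᴵ : Integral (4× a)
    4aᴵ = proj₁ (relative-trace-m h)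
    4bᴵ : Integral (4× b)
    4bᴵ = integral-4b h sqf-m sqf-n
    4cᴵ : Integral (4× c)
    4cᴵ = integral-4c h sqf-m sqf-n
    4fᴵ : Integral (D ℚ.* 4× e)
    -- The denominator of `4 e` divides both `m` and `n`, hence `d`; and `d e` is the coordinate at
    -- `√k`.
    4fᴵ = ↧∣⇒integral (+ d) (4× e) (d-greatest (integral⇒↧∣ m (4× e) (integral-m4e h sqf-m sqf-n))
                                               (integral⇒↧∣ n (4× e) (integral-n4e h sqf-m sqf-n)))
    α β γ φ : ℤ
    α = proj₁ 4aᴵ
    β = proj₁ 4bᴵ
    γ = proj₁ 4cᴵ
    φ = proj₁ 4fᴵ
    α≡ : ι α ≡ 4× a
    α≡ = sym (proj₂ 4aᴵ)
    distrib : ∀ D e → D ℚ.* ((e ℚ.+ e) ℚ.+ (e ℚ.+ e)) ≡ D ℚ.* (e ℚ.+ e) ℚ.+ D ℚ.* (e ℚ.+ e)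
    distrib = RingSolver.solve-∀ ℚ-ring
    distrib′ : ∀ D e → D ℚ.* ((e ℚ.+ e) ℚ.+ (e ℚ.+ e)) ≡ (D ℚ.* e ℚ.+ D ℚ.* e) ℚ.+ (D ℚ.* e ℚ.+ D ℚ.* e)
    distrib′ = RingSolver.solve-∀ ℚ-ring
    m-norm : + 4 ∣ α * α + - (m * (β * β))
    m-norm = norm-divisible m α β (2× a) (2× b) α≡ (sym (proj₂ 4bᴵ)) (proj₂ (relative-trace-m h))
    n-norm : + 4 ∣ α * α + - (n * (γ * γ))
    n-norm = norm-divisible n α γ (2× a) (2× c) α≡ (sym (proj₂ 4cᴵ)) (proj₂ (relative-trace-n h))
    k-norm : + 4 ∣ α * α + - (m′ * n′ * (φ * φ))
    k-norm = norm-divisible (m′ * n′) α φ (2× a) (D ℚ.* 2× e) α≡ (trans (sym (proj₂ 4fᴵ)) (distrib D e))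
      (subst Integral (cong (λ z → 2× a ℚ.* 2× a ℚ.- z) mnee≡) (proj₂ (relative-trace-mn h)))
      where
      regroup : ∀ M N D e → M ℚ.* D ℚ.* (N ℚ.* D) ℚ.* (e ℚ.* e) ≡ M ℚ.* N ℚ.* (D ℚ.* e ℚ.* (D ℚ.* e))
      regroup = RingSolver.solve-∀ ℚ-ring
      mnee≡ : mℚ ℚ.* nℚ ℚ.* (2× e ℚ.* 2× e) ≡ ι (m′ * n′) ℚ.* (D ℚ.* 2× e ℚ.* (D ℚ.* 2× e))
      mnee≡ = trans (cong₂ (λ x y → x ℚ.* y ℚ.* (2× e ℚ.* 2× e)) mℚ≡MD nℚ≡ND)
        (trans (regroup M N D (2× e)) (cong (ℚ._* (D ℚ.* 2× e ℚ.* (D ℚ.* 2× e))) (sym (ι-* m′ n′))))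
    even-αγ : (+ 4 ∣ + 2 * α) × (+ 4 ∣ + 2 * γ)
    even-αγ = 2,3-norm n α γ n≡2,3 n-norm
    qa : ∃[ A ] a ≡ ½ ℚ.* ι A
    qa = quarter α≡ (proj₁ even-αγ)
    qb : ∃[ B ] b ≡ ½ ℚ.* ι B
    qb = quarter (sym (proj₂ 4bᴵ)) (1-norm m α β 4∣m-1 (proj₁ even-αγ) m-norm)
    qc : ∃[ C ] c ≡ ½ ℚ.* ι C
    qc = quarter (sym (proj₂ 4cᴵ)) (proj₂ even-αγ)
    qf : ∃[ F ] D ℚ.* e ≡ ½ ℚ.* ι F
    qf = quarter (trans (sym (proj₂ 4fᴵ)) (distrib′ D e))
           (proj₂ (2,3-norm (m′ * n′) α φ (proj₂ (proj₂ (proj₂ cofactors-mod-4))) k-norm))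

  parities : ∀ A B C F → AlmostIntegral ⟪ ½ ℚ.* ι A , ½ ℚ.* ι B , ½ ℚ.* ι C , ½ ℚ.* ι F ⟫ →
             (+ 4 ∣ + 2 * (A + - B)) × (+ 4 ∣ + 2 * (C + - F))
  parities A B C F h = same-parity′ m n n′ (m′ * n′) A B C F w 4∣m-1
    (subst (λ n → + 4 ∣ m′ * n′ + - n) (sym n≡n′d) (proj₁ (proj₂ cofactors-mod-4))) n≡2,3
    (subst (λ n → + 4 ∣ + 2 * (n′ + - n)) (sym n≡n′d) (proj₁ (proj₂ (proj₂ cofactors-mod-4))))
    (divides (+ 0) (trans (cong (_+ - (+ 2 * w)) (trans s≡ s≡2w)) (ℤ.+-inverseʳ (+ 2 * w))))
    (norm-divisible m w v (½ ℚ.* ½ ℚ.* ι s) (½ ℚ.* ι v) (sym (proj₂ (proj₁ tn))) (double (ι v))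
      (proj₂ tn))
    where
    x : L
    x = ⟪ ½ ℚ.* ι A , ½ ℚ.* ι B , ½ ℚ.* ι C , ½ ℚ.* ι F ⟫
    s v : ℤ
    s = A * A + m′ * + d * (B * B) + - (n′ * + d * (C * C)) + - (m′ * n′ * (F * F))
    v = A * B + - (n′ * (C * F))
    Dᴱ Mᴱ Nᴱ Aᴱ Bᴱ Cᴱ Fᴱ : Expr 7
    Dᴱ = X (# 0)
    Mᴱ = X (# 1)
    Nᴱ = X (# 2)
    Aᴱ = X (# 3)
    Bᴱ = X (# 4)
    Cᴱ = X (# 5)
    Fᴱ = X (# 6)
    ρ : Vec ℤ 7
    ρ = + d ∷ m′ ∷ n′ ∷ A ∷ B ∷ C ∷ F ∷ []
    eq₁ : ∀ M N D A B C F → ½ ℚ.* A ℚ.* (½ ℚ.* A) ℚ.+ M ℚ.* D ℚ.* (½ ℚ.* B ℚ.* (½ ℚ.* B)) ℚ.+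
        N ℚ.* D ℚ.* (½ ℚ.* C ℚ.* ℚ.- (½ ℚ.* C)) ℚ.+ M ℚ.* N ℚ.* (½ ℚ.* F ℚ.* ℚ.- (½ ℚ.* F)) ≡
      ½ ℚ.* ½ ℚ.* (A ℚ.* A ℚ.+ M ℚ.* D ℚ.* (B ℚ.* B) ℚ.+ ℚ.- (N ℚ.* D ℚ.* (C ℚ.* C)) ℚ.+ ℚ.-
        (M ℚ.* N ℚ.* (F ℚ.* F)))
    eq₁ = RingSolver.solve-∀ ℚ-ring
    eq₂ : ∀ N A B C F → ½ ℚ.* A ℚ.* (½ ℚ.* B) ℚ.+ ½ ℚ.* B ℚ.* (½ ℚ.* A) ℚ.+
        N ℚ.* (½ ℚ.* C ℚ.* ℚ.- (½ ℚ.* F) ℚ.+ ½ ℚ.* F ℚ.* ℚ.- (½ ℚ.* C)) ≡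
      ½ ℚ.* (A ℚ.* B ℚ.+ ℚ.- (N ℚ.* (C ℚ.* F)))
    eq₂ = RingSolver.solve-∀ ℚ-ring
    eq₃ : ∀ M A B C F → A ℚ.* ℚ.- C ℚ.+ C ℚ.* A ℚ.+ M ℚ.* (B ℚ.* ℚ.- F ℚ.+ F ℚ.* B) ≡ 0ℚ
    eq₃ = RingSolver.solve-∀ ℚ-ring
    eq₄ : ∀ D A B C F → A ℚ.* ℚ.- F ℚ.+ F ℚ.* A ℚ.+ D ℚ.* (B ℚ.* ℚ.- C ℚ.+ C ℚ.* B) ≡ 0ℚ
    eq₄ = RingSolver.solve-∀ ℚ-ring
    relative-norm : x ⊗ τ x ≡ ⟨ ½ ℚ.* ½ ℚ.* ι s , ½ ℚ.* ι v , 0ℚ , 0ℚ ⟩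
    relative-norm = begin
      x ⊗ τ x
        ≡⟨ cong (x ⊗_) (⟪⟫-τ (½ ℚ.* ι A) (½ ℚ.* ι B) (½ ℚ.* ι C) (½ ℚ.* ι F)) ⟩
      x ⊗ ⟪ ½ ℚ.* ι A , ½ ℚ.* ι B , ℚ.- (½ ℚ.* ι C) , ℚ.- (½ ℚ.* ι F) ⟫
        ≡⟨ ⟪⟫-* (½ ℚ.* ι A) (½ ℚ.* ι B) (½ ℚ.* ι C) (½ ℚ.* ι F) (½ ℚ.* ι A) (½ ℚ.* ι B) (ℚ.- (½ ℚ.* ι C))
          (ℚ.- (½ ℚ.* ι F)) ⟩
      _ ≡⟨ ext
             (trans (eq₁ M N D (ι A) (ι B) (ι C) (ι F)) (cong (½ ℚ.* ½ ℚ.*_) (sym (ι-⟦⟧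
               (Aᴱ ⊠ Aᴱ ⊞ Mᴱ ⊠ Dᴱ ⊠ (Bᴱ ⊠ Bᴱ) ⊞ ⊟ (Nᴱ ⊠ Dᴱ ⊠ (Cᴱ ⊠ Cᴱ)) ⊞ ⊟ (Mᴱ ⊠ Nᴱ ⊠ (Fᴱ ⊠ Fᴱ))) ρ))))
             (trans (eq₂ N (ι A) (ι B) (ι C) (ι F)) (cong (½ ℚ.*_) (sym (ι-⟦⟧ (Aᴱ ⊠ Bᴱ ⊞ ⊟ (Nᴱ ⊠ (Cᴱ ⊠ Fᴱ))) ρ))))
             (eq₃ M (½ ℚ.* ι A) (½ ℚ.* ι B) (½ ℚ.* ι C) (½ ℚ.* ι F))
             (trans (cong (δ ℚ.*_) (eq₄ D (½ ℚ.* ι A) (½ ℚ.* ι B) (½ ℚ.* ι C) (½ ℚ.* ι F))) δ0≡0) ⟩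
      ⟨ ½ ℚ.* ½ ℚ.* ι s , ½ ℚ.* ι v , 0ℚ , 0ℚ ⟩ ∎
    -- Trace and norm of the relative norm `s / 4 + (v / 2) √m`: the first gives the integer
    -- `w = s / 2`, the second gives `4 ∣ w² - m v²`.
    tn : Integral (2× (½ ℚ.* ½ ℚ.* ι s)) ×
         Integral (½ ℚ.* ½ ℚ.* ι s ℚ.* (½ ℚ.* ½ ℚ.* ι s) ℚ.- mℚ ℚ.* (½ ℚ.* ι v ℚ.* (½ ℚ.* ι v)))
    tn = quadratic-m (½ ℚ.* ½ ℚ.* ι s) (½ ℚ.* ι v)
           (subst AlmostIntegral relative-norm (almostIntegral-* {x} {τ x} h (almostIntegral-τ {x} h)))
    w : ℤ
    w = proj₁ (proj₁ tn)
    double : ∀ v → v ≡ ½ ℚ.* v ℚ.+ ½ ℚ.* v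
    double = RingSolver.solve-∀ ℚ-ring
    s≡ : A * A + m * (B * B) + - (n * (C * C)) + - (m′ * n′ * (F * F)) ≡ s
    s≡ = cong₂ (λ m n → A * A + m * (B * B) + - (n * (C * C)) + - (m′ * n′ * (F * F))) m≡m′d n≡n′d
    s≡2w : s ≡ + 2 * w
    s≡2w = ι-injective {s} {+ 2 * w} (trans (eq (ι s))
      (trans (cong (ι (+ 2) ℚ.*_) (proj₂ (proj₁ tn))) (sym (ι-* (+ 2) w))))
      where
      eq : ∀ s → s ≡ ι (+ 2) ℚ.* (½ ℚ.* ½ ℚ.* s ℚ.+ ½ ℚ.* ½ ℚ.* s)
      eq = RingSolver.solve-∀ ℚ-ring

  -- Only γ₂ and γ₄ involve `√m` and `√k`, so `B` and `F` are their coefficients; the halved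
  -- differences `A - B` and `C - F` are left for γ₁ and γ₃.
  integral⇒basis : ∀ {x} → 𝓞 x → ∃[ p ] ∃[ b ] ∃[ q ] ∃[ f ] x ≡ basis p b q f
  integral⇒basis {x} x∈𝓞 = proj₁ evenAB , B , proj₁ evenCF , F ,
    trans x≡ (⟪⟫-cong (split A B (proj₁ evenAB) (proj₂ evenAB)) refl (split C F (proj₁ evenCF) (proj₂ evenCF)) refl)
    where
    h : ∃[ A ] ∃[ B ] ∃[ C ] ∃[ F ] x ≡ ⟪ ½ ℚ.* ι A , ½ ℚ.* ι B , ½ ℚ.* ι C , ½ ℚ.* ι F ⟫
    h = halves (integral⇒almostIntegral x∈𝓞)
    A B C F : ℤ
    A = proj₁ h
    B = proj₁ (proj₂ h)
    C = proj₁ (proj₂ (proj₂ h))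
    F = proj₁ (proj₂ (proj₂ (proj₂ h)))
    x≡ : x ≡ ⟪ ½ ℚ.* ι A , ½ ℚ.* ι B , ½ ℚ.* ι C , ½ ℚ.* ι F ⟫
    x≡ = proj₂ (proj₂ (proj₂ (proj₂ h)))
    p : (+ 4 ∣ + 2 * (A + - B)) × (+ 4 ∣ + 2 * (C + - F))
    p = parities A B C F (subst AlmostIntegral x≡ (integral⇒almostIntegral x∈𝓞))
    evenAB : ∃[ w ] A + - B ≡ + 2 * w
    evenAB = halve (A + - B) (proj₁ p)
    evenCF : ∃[ w ] C + - F ≡ + 2 * w
    evenCF = halve (C + - F) (proj₂ p)
    split : ∀ A B w → A + - B ≡ + 2 * w → ½ ℚ.* ι A ≡ ι w ℚ.+ ½ ℚ.* ι B
    split A B w eq = begin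
      ½ ℚ.* ι A                         ≡⟨ cong (λ z → ½ ℚ.* ι z) (trans (regroup A B) (cong (_+ B) eq)) ⟩
      ½ ℚ.* ι (+ 2 * w + B)             ≡⟨ cong (½ ℚ.*_) (trans (ι-+ (+ 2 * w) B) (cong (ℚ._+ ι B) (ι-* (+ 2) w))) ⟩
      ½ ℚ.* (ι (+ 2) ℚ.* ι w ℚ.+ ι B)   ≡⟨ regroup′ (ι w) (ι B) ⟩
      ι w ℚ.+ ½ ℚ.* ι B                 ∎
      where
      regroup : ∀ A B → A ≡ A + - B + B
      regroup = solve-∀
      regroup′ : ∀ w B → ½ ℚ.* (ι (+ 2) ℚ.* w ℚ.+ B) ≡ w ℚ.+ ½ ℚ.* B
      regroup′ = RingSolver.solve-∀ ℚ-ring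

  -- The polynomial identities below are verified in `D`, `M` and `N`, so `μ = (m - 1) / 4` and, in
  -- `ικ≡`, `κ = (d + m′ - 2) / 4` are eliminated.
  ιμ≡ : ι μ ≡ ½ ℚ.* ½ ℚ.* (M ℚ.* D ℚ.- 1ℚ)
  ιμ≡ = begin
    ι μ                                                   ≡⟨ eq (ι μ) ⟩
    ½ ℚ.* ½ ℚ.* (ι (+ 1) ℚ.+ ι μ ℚ.* ι (+ 4) ℚ.- 1ℚ)      ≡⟨ cong (λ z → ½ ℚ.* ½ ℚ.* (z ℚ.- 1ℚ)) 1+4μ≡ ⟩
    ½ ℚ.* ½ ℚ.* (M ℚ.* D ℚ.- 1ℚ)                          ∎
    where
    eq : ∀ μ → μ ≡ ½ ℚ.* ½ ℚ.* (ι (+ 1) ℚ.+ μ ℚ.* ι (+ 4) ℚ.- 1ℚ)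
    eq = RingSolver.solve-∀ ℚ-ring
    1+4μ≡ : ι (+ 1) ℚ.+ ι μ ℚ.* ι (+ 4) ≡ M ℚ.* D
    1+4μ≡ = trans (sym (ι-⟦⟧ (K 1 ⊞ X (# 0) ⊠ K 4) (μ ∷ []))) (trans (cong ι (sym m≡1+4μ)) mℚ≡MD)

  ικ≡ : ι κ ≡ ½ ℚ.* ½ ℚ.* (D ℚ.+ M ℚ.- ι (+ 2))
  ικ≡ = begin
    ι κ                                                        ≡⟨ eq (ι κ) ⟩
    ½ ℚ.* ½ ℚ.* (ι (+ 2) ℚ.+ ι κ ℚ.* ι (+ 4) ℚ.- ι (+ 2))      ≡⟨ cong (λ z → ½ ℚ.* ½ ℚ.* (z ℚ.- ι (+ 2))) 2+4κ≡ ⟩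
    ½ ℚ.* ½ ℚ.* (D ℚ.+ M ℚ.- ι (+ 2))                          ∎
    where
    eq : ∀ κ → κ ≡ ½ ℚ.* ½ ℚ.* (ι (+ 2) ℚ.+ κ ℚ.* ι (+ 4) ℚ.- ι (+ 2))
    eq = RingSolver.solve-∀ ℚ-ring
    2+4κ≡ : ι (+ 2) ℚ.+ ι κ ℚ.* ι (+ 4) ≡ D ℚ.+ M
    2+4κ≡ = trans (sym (ι-⟦⟧ (K 2 ⊞ X (# 0) ⊠ K 4) (κ ∷ []))) (trans (cong ι (sym d+m′≡2+4κ)) (ι-+ (+ d) m′))

  -- This is γ₂. Every element of `basis` is a root of a quadratic polynomial over ℤ[ω].
  ω : L
  ω = ⟨ ½ , ½ , 0ℚ , 0ℚ ⟩

  ω≡ : ω ≡ ⟪ ½ , ½ , 0ℚ , 0ℚ ⟫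
  ω≡ = ext refl refl refl (sym δ0≡0)

  ω-⟪⟫ : ∀ a b c f → ω ⊗ ⟪ a , b , c , f ⟫ ≡
    ⟪ ½ ℚ.* (a ℚ.+ M ℚ.* D ℚ.* b) , ½ ℚ.* (a ℚ.+ b) , ½ ℚ.* (c ℚ.+ M ℚ.* f) , ½ ℚ.* (f ℚ.+ D ℚ.* c) ⟫
  ω-⟪⟫ a b c f = trans (cong (_⊗ ⟪ a , b , c , f ⟫) ω≡) (trans (⟪⟫-* ½ ½ 0ℚ 0ℚ a b c f)
    (⟪⟫-cong (eq₁ M N D a b c f) (eq₂ N a b c f) (eq₃ M a b c f) (eq₄ D a b c f)))
    where
    eq₁ : ∀ M N D a b c f → ½ ℚ.* a ℚ.+ M ℚ.* D ℚ.* (½ ℚ.* b) ℚ.+ N ℚ.* D ℚ.* (0ℚ ℚ.* c) ℚ.+ M ℚ.* N ℚ.*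
      (0ℚ ℚ.* f) ≡
            ½ ℚ.* (a ℚ.+ M ℚ.* D ℚ.* b)
    eq₁ = RingSolver.solve-∀ ℚ-ring
    eq₂ : ∀ N a b c f → ½ ℚ.* b ℚ.+ ½ ℚ.* a ℚ.+ N ℚ.* (0ℚ ℚ.* f ℚ.+ 0ℚ ℚ.* c) ≡ ½ ℚ.* (a ℚ.+ b)
    eq₂ = RingSolver.solve-∀ ℚ-ring
    eq₃ : ∀ M a b c f → ½ ℚ.* c ℚ.+ 0ℚ ℚ.* a ℚ.+ M ℚ.* (½ ℚ.* f ℚ.+ 0ℚ ℚ.* b) ≡ ½ ℚ.* (c ℚ.+ M ℚ.* f)
    eq₃ = RingSolver.solve-∀ ℚ-ring
    eq₄ : ∀ D a b c f → ½ ℚ.* f ℚ.+ 0ℚ ℚ.* a ℚ.+ D ℚ.* (½ ℚ.* c ℚ.+ 0ℚ ℚ.* b) ≡ ½ ℚ.* (f ℚ.+ D ℚ.* c)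
    eq₄ = RingSolver.solve-∀ ℚ-ring

  ω²≡ω+μ : ω ⊗ ω ≡ ω ⊕ fromℚ (ι μ)
  ω²≡ω+μ = trans (cong (ω ⊗_) ω≡) (trans (ω-⟪⟫ ½ ½ 0ℚ 0ℚ)
    (ext (trans (eq₁ (M ℚ.* D)) (cong (½ ℚ.+_) (sym ιμ≡))) refl
      (eq₃ M) (trans (cong (δ ℚ.*_) (eq₃ D)) δ0≡0)))
    where
    eq₁ : ∀ m → ½ ℚ.* (½ ℚ.+ m ℚ.* ½) ≡ ½ ℚ.+ ½ ℚ.* ½ ℚ.* (m ℚ.- 1ℚ)
    eq₁ = RingSolver.solve-∀ ℚ-ring
    eq₃ : ∀ M → ½ ℚ.* (0ℚ ℚ.+ M ℚ.* 0ℚ) ≡ 0ℚ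
    eq₃ = RingSolver.solve-∀ ℚ-ring

  -- With x = (p + b ω) + (q γ₃ + f γ₄), the second summand squares to
  -- n′ (d q² + q f (2 ω + d - 1) + f² (ω + κ)).
  basis⇒integral : ∀ p b q f → 𝓞 (basis p b q f)
  basis⇒integral p b q f = quadratic⇒integral μ (⟦ T₀ ⟧ ρ) (⟦ T₁ ⟧ ρ) (⟦ S₀ ⟧ ρ) (⟦ S₁ ⟧ ρ) ω x ω²≡ω+μ (begin
    x ⊗ x ⊕ ⊝ (fromℚ (ι (⟦ T₀ ⟧ ρ)) ⊗ x) ⊕ fromℚ (ι (⟦ S₀ ⟧ ρ))
      ≡⟨ cong₂ (λ y z → y ⊕ ⊝ z ⊕ fromℚ (ι (⟦ S₀ ⟧ ρ))) (⟪⟫-* xa xb xc xf xa xb xc xf)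
               (trans (fromℚ-⟪⟫ (ι (⟦ T₀ ⟧ ρ)) xa xb xc xf)
                      (⟪⟫-cong (cong (ℚ._* xa) T₀≡) (cong (ℚ._* xb) T₀≡) (cong (ℚ._* xc) T₀≡)
                        (cong (ℚ._* xf) T₀≡))) ⟩
    ⟪ y₁ , y₂ , y₃ , y₄ ⟫ ⊕ ⊝ ⟪ t₀ ℚ.* xa , t₀ ℚ.* xb , t₀ ℚ.* xc , t₀ ℚ.* xf ⟫ ⊕ fromℚ (ι (⟦ S₀ ⟧ ρ))
      ≡⟨ cong₂ (λ y z → ⟪ y₁ , y₂ , y₃ , y₄ ⟫ ⊕ y ⊕ z) (⟪⟫-neg (t₀ ℚ.* xa) (t₀ ℚ.* xb) (t₀ ℚ.* xc) (t₀ ℚ.* xf))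
               (trans (cong fromℚ S₀≡) (fromℚ≡⟪⟫ s₀)) ⟩
    ⟪ y₁ , y₂ , y₃ , y₄ ⟫ ⊕ ⟪ ℚ.- (t₀ ℚ.* xa) , ℚ.- (t₀ ℚ.* xb) , ℚ.- (t₀ ℚ.* xc) , ℚ.- (t₀ ℚ.* xf) ⟫ ⊕
      ⟪ s₀ , 0ℚ , 0ℚ , 0ℚ ⟫
      ≡⟨ trans (cong (_⊕ ⟪ s₀ , 0ℚ , 0ℚ , 0ℚ ⟫) (⟪⟫-+ y₁ y₂ y₃ y₄ (ℚ.- (t₀ ℚ.* xa)) (ℚ.- (t₀ ℚ.* xb))
        (ℚ.- (t₀ ℚ.* xc)) (ℚ.- (t₀ ℚ.* xf))))
               (⟪⟫-+ (y₁ ℚ.- t₀ ℚ.* xa) (y₂ ℚ.- t₀ ℚ.* xb) (y₃ ℚ.- t₀ ℚ.* xc) (y₄ ℚ.- t₀ ℚ.* xf) s₀ 0ℚ 0ℚ 0ℚ) ⟩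
    ⟪ y₁ ℚ.- t₀ ℚ.* xa ℚ.+ s₀ , y₂ ℚ.- t₀ ℚ.* xb ℚ.+ 0ℚ , y₃ ℚ.- t₀ ℚ.* xc ℚ.+ 0ℚ , y₄ ℚ.- t₀ ℚ.* xf ℚ.+ 0ℚ ⟫
      ≡⟨ ⟪⟫-cong (eq₁ D M N (ι p) (ι b) (ι q) (ι f)) (eq₂ D M N (ι p) (ι b) (ι q) (ι f))
                 (eq₃ D M N (ι p) (ι b) (ι q) (ι f)) (eq₄ D M N (ι p) (ι b) (ι q) (ι f)) ⟩
    ⟪ ½ ℚ.* (t₁ ℚ.* xa ℚ.- s₁ ℚ.+ M ℚ.* D ℚ.* (t₁ ℚ.* xb ℚ.- 0ℚ)) , ½ ℚ.* (t₁ ℚ.* xa ℚ.- s₁ ℚ.+ (t₁ ℚ.* xb ℚ.- 0ℚ))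
    , ½ ℚ.* (t₁ ℚ.* xc ℚ.- 0ℚ ℚ.+ M ℚ.* (t₁ ℚ.* xf ℚ.- 0ℚ)) , ½ ℚ.*
      (t₁ ℚ.* xf ℚ.- 0ℚ ℚ.+ D ℚ.* (t₁ ℚ.* xc ℚ.- 0ℚ)) ⟫
      ≡⟨ ω-⟪⟫ (t₁ ℚ.* xa ℚ.- s₁) (t₁ ℚ.* xb ℚ.- 0ℚ) (t₁ ℚ.* xc ℚ.- 0ℚ) (t₁ ℚ.* xf ℚ.- 0ℚ) ⟨
    ω ⊗ ⟪ t₁ ℚ.* xa ℚ.- s₁ , t₁ ℚ.* xb ℚ.- 0ℚ , t₁ ℚ.* xc ℚ.- 0ℚ , t₁ ℚ.* xf ℚ.- 0ℚ ⟫
      ≡⟨ cong (ω ⊗_) (⟪⟫-+ (t₁ ℚ.* xa) (t₁ ℚ.* xb) (t₁ ℚ.* xc) (t₁ ℚ.* xf) (ℚ.- s₁) 0ℚ 0ℚ 0ℚ) ⟨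
    ω ⊗ (⟪ t₁ ℚ.* xa , t₁ ℚ.* xb , t₁ ℚ.* xc , t₁ ℚ.* xf ⟫ ⊕ ⟪ ℚ.- s₁ , 0ℚ , 0ℚ , 0ℚ ⟫)
      ≡⟨ cong₂ (λ y z → ω ⊗ (y ⊕ z))
               (trans (fromℚ-⟪⟫ (ι (⟦ T₁ ⟧ ρ)) xa xb xc xf)
                      (⟪⟫-cong (cong (ℚ._* xa) T₁≡) (cong (ℚ._* xb) T₁≡) (cong (ℚ._* xc) T₁≡) (cong (ℚ._* xf) T₁≡)))
               (trans (cong (λ s → ⊝ fromℚ s) S₁≡) (fromℚ≡⟪⟫ (ℚ.- s₁))) ⟨
    ω ⊗ (fromℚ (ι (⟦ T₁ ⟧ ρ)) ⊗ x ⊕ ⊝ fromℚ (ι (⟦ S₁ ⟧ ρ))) ∎)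
    where
    x : L
    x = basis p b q f
    Dᴱ Nᴱ μᴱ κᴱ P B Q F T₀ T₁ S₀ S₁ : Expr 8
    Dᴱ = X (# 0)
    Nᴱ = X (# 1)
    μᴱ = X (# 2)
    κᴱ = X (# 3)
    P = X (# 4)
    B = X (# 5)
    Q = X (# 6)
    F = X (# 7)
    -- `T₀ + T₁ ω` is the relative trace `2 (p + b ω)`, and `S₀ + S₁ ω` is the relative norm
    -- `(p + b ω)² - (q γ₃ + f γ₄)²`, both reduced by `ω² = ω + μ`.
    T₀ = K 2 ⊠ P
    T₁ = K 2 ⊠ B
    S₀ = P ⊠ P ⊞ B ⊠ B ⊠ μᴱ ⊞ ⊟ (Nᴱ ⊠ (Q ⊠ Q ⊠ Dᴱ ⊞ Q ⊠ F ⊠ (Dᴱ ⊞ ⊟ K 1) ⊞ F ⊠ F ⊠ κᴱ))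
    S₁ = K 2 ⊠ (P ⊠ B) ⊞ B ⊠ B ⊞ ⊟ (Nᴱ ⊠ (K 2 ⊠ (Q ⊠ F) ⊞ F ⊠ F))
    ρ : Vec ℤ 8
    ρ = + d ∷ n′ ∷ μ ∷ κ ∷ p ∷ b ∷ q ∷ f ∷ []
    xa xb xc xf y₁ y₂ y₃ y₄ t₀ t₁ s₁ s₀ : ℚ
    xa = ι p ℚ.+ ½ ℚ.* ι b
    xb = ½ ℚ.* ι b
    xc = ι q ℚ.+ ½ ℚ.* ι f
    xf = ½ ℚ.* ι f
    y₁ = xa ℚ.* xa ℚ.+ M ℚ.* D ℚ.* (xb ℚ.* xb) ℚ.+ N ℚ.* D ℚ.* (xc ℚ.* xc) ℚ.+ M ℚ.* N ℚ.* (xf ℚ.* xf)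
    y₂ = xa ℚ.* xb ℚ.+ xb ℚ.* xa ℚ.+ N ℚ.* (xc ℚ.* xf ℚ.+ xf ℚ.* xc)
    y₃ = xa ℚ.* xc ℚ.+ xc ℚ.* xa ℚ.+ M ℚ.* (xb ℚ.* xf ℚ.+ xf ℚ.* xb)
    y₄ = xa ℚ.* xf ℚ.+ xf ℚ.* xa ℚ.+ D ℚ.* (xb ℚ.* xc ℚ.+ xc ℚ.* xb)
    t₀ = ι (+ 2) ℚ.* ι p
    t₁ = ι (+ 2) ℚ.* ι b
    s₀ = ι p ℚ.* ι p ℚ.+ ι b ℚ.* ι b ℚ.* (½ ℚ.* ½ ℚ.* (M ℚ.* D ℚ.- 1ℚ)) ℚ.+
         ℚ.- (N ℚ.* (ι q ℚ.* ι q ℚ.* D ℚ.+ ι q ℚ.* ι f ℚ.* (D ℚ.+ ℚ.- ι (+ 1)) ℚ.+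
                     ι f ℚ.* ι f ℚ.* (½ ℚ.* ½ ℚ.* (D ℚ.+ M ℚ.- ι (+ 2)))))
    s₁ = ι (+ 2) ℚ.* (ι p ℚ.* ι b) ℚ.+ ι b ℚ.* ι b ℚ.+ ℚ.- (N ℚ.* (ι (+ 2) ℚ.* (ι q ℚ.* ι f) ℚ.+ ι f ℚ.* ι f))
    T₀≡ : ι (⟦ T₀ ⟧ ρ) ≡ t₀
    T₀≡ = ι-⟦⟧ T₀ ρ
    T₁≡ : ι (⟦ T₁ ⟧ ρ) ≡ t₁
    T₁≡ = ι-⟦⟧ T₁ ρ
    S₀≡ : ι (⟦ S₀ ⟧ ρ) ≡ s₀
    S₀≡ = trans (ι-⟦⟧ S₀ ρ) (cong₂ (λ m k → ι p ℚ.* ι p ℚ.+ ι b ℚ.* ι b ℚ.* m ℚ.+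
         ℚ.- (N ℚ.* (ι q ℚ.* ι q ℚ.* D ℚ.+ ι q ℚ.* ι f ℚ.* (D ℚ.+ ℚ.- ι (+ 1)) ℚ.+ ι f ℚ.* ι f ℚ.* k))) ιμ≡ ικ≡)
    S₁≡ : ι (⟦ S₁ ⟧ ρ) ≡ s₁
    S₁≡ = ι-⟦⟧ S₁ ρ
    eq₁ : ∀ D M N P B Q F →
      let xa = P ℚ.+ ½ ℚ.* B
          xb = ½ ℚ.* B
          xc = Q ℚ.+ ½ ℚ.* F
          xf = ½ ℚ.* F
          t₀ = ι (+ 2) ℚ.* P
          t₁ = ι (+ 2) ℚ.* B
          s₀ = P ℚ.* P ℚ.+ B ℚ.* B ℚ.* (½ ℚ.* ½ ℚ.* (M ℚ.* D ℚ.- 1ℚ)) ℚ.+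
               ℚ.- (N ℚ.* (Q ℚ.* Q ℚ.* D ℚ.+ Q ℚ.* F ℚ.* (D ℚ.+ ℚ.- ι (+ 1)) ℚ.+
                           F ℚ.* F ℚ.* (½ ℚ.* ½ ℚ.* (D ℚ.+ M ℚ.- ι (+ 2)))))
          s₁ = ι (+ 2) ℚ.* (P ℚ.* B) ℚ.+ B ℚ.* B ℚ.+ ℚ.- (N ℚ.* (ι (+ 2) ℚ.* (Q ℚ.* F) ℚ.+ F ℚ.* F))
      in xa ℚ.* xa ℚ.+ M ℚ.* D ℚ.* (xb ℚ.* xb) ℚ.+ N ℚ.* D ℚ.* (xc ℚ.* xc) ℚ.+ M ℚ.* N ℚ.* (xf ℚ.* xf) ℚ.-
        t₀ ℚ.* xa ℚ.+ s₀ ≡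
         ½ ℚ.* (t₁ ℚ.* xa ℚ.- s₁ ℚ.+ M ℚ.* D ℚ.* (t₁ ℚ.* xb ℚ.- 0ℚ))
    eq₁ = RingSolver.solve-∀ ℚ-ring
    eq₂ : ∀ D M N P B Q F →
      let xa = P ℚ.+ ½ ℚ.* B
          xb = ½ ℚ.* B
          xc = Q ℚ.+ ½ ℚ.* F
          xf = ½ ℚ.* F
          t₀ = ι (+ 2) ℚ.* P
          t₁ = ι (+ 2) ℚ.* B
          s₀ = P ℚ.* P ℚ.+ B ℚ.* B ℚ.* (½ ℚ.* ½ ℚ.* (M ℚ.* D ℚ.- 1ℚ)) ℚ.+
               ℚ.- (N ℚ.* (Q ℚ.* Q ℚ.* D ℚ.+ Q ℚ.* F ℚ.* (D ℚ.+ ℚ.- ι (+ 1)) ℚ.+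
                           F ℚ.* F ℚ.* (½ ℚ.* ½ ℚ.* (D ℚ.+ M ℚ.- ι (+ 2)))))
          s₁ = ι (+ 2) ℚ.* (P ℚ.* B) ℚ.+ B ℚ.* B ℚ.+ ℚ.- (N ℚ.* (ι (+ 2) ℚ.* (Q ℚ.* F) ℚ.+ F ℚ.* F))
      in xa ℚ.* xb ℚ.+ xb ℚ.* xa ℚ.+ N ℚ.* (xc ℚ.* xf ℚ.+ xf ℚ.* xc) ℚ.- t₀ ℚ.* xb ℚ.+ 0ℚ ≡
         ½ ℚ.* (t₁ ℚ.* xa ℚ.- s₁ ℚ.+ (t₁ ℚ.* xb ℚ.- 0ℚ))
    eq₂ = RingSolver.solve-∀ ℚ-ring
    eq₃ : ∀ D M N P B Q F →
      let xa = P ℚ.+ ½ ℚ.* B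
          xb = ½ ℚ.* B
          xc = Q ℚ.+ ½ ℚ.* F
          xf = ½ ℚ.* F
          t₀ = ι (+ 2) ℚ.* P
          t₁ = ι (+ 2) ℚ.* B
          s₀ = P ℚ.* P ℚ.+ B ℚ.* B ℚ.* (½ ℚ.* ½ ℚ.* (M ℚ.* D ℚ.- 1ℚ)) ℚ.+
               ℚ.- (N ℚ.* (Q ℚ.* Q ℚ.* D ℚ.+ Q ℚ.* F ℚ.* (D ℚ.+ ℚ.- ι (+ 1)) ℚ.+
                           F ℚ.* F ℚ.* (½ ℚ.* ½ ℚ.* (D ℚ.+ M ℚ.- ι (+ 2)))))
          s₁ = ι (+ 2) ℚ.* (P ℚ.* B) ℚ.+ B ℚ.* B ℚ.+ ℚ.- (N ℚ.* (ι (+ 2) ℚ.* (Q ℚ.* F) ℚ.+ F ℚ.* F))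
      in xa ℚ.* xc ℚ.+ xc ℚ.* xa ℚ.+ M ℚ.* (xb ℚ.* xf ℚ.+ xf ℚ.* xb) ℚ.- t₀ ℚ.* xc ℚ.+ 0ℚ ≡
         ½ ℚ.* (t₁ ℚ.* xc ℚ.- 0ℚ ℚ.+ M ℚ.* (t₁ ℚ.* xf ℚ.- 0ℚ))
    eq₃ = RingSolver.solve-∀ ℚ-ring
    eq₄ : ∀ D M N P B Q F →
      let xa = P ℚ.+ ½ ℚ.* B
          xb = ½ ℚ.* B
          xc = Q ℚ.+ ½ ℚ.* F
          xf = ½ ℚ.* F
          t₀ = ι (+ 2) ℚ.* P
          t₁ = ι (+ 2) ℚ.* B
          s₀ = P ℚ.* P ℚ.+ B ℚ.* B ℚ.* (½ ℚ.* ½ ℚ.* (M ℚ.* D ℚ.- 1ℚ)) ℚ.+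
               ℚ.- (N ℚ.* (Q ℚ.* Q ℚ.* D ℚ.+ Q ℚ.* F ℚ.* (D ℚ.+ ℚ.- ι (+ 1)) ℚ.+
                           F ℚ.* F ℚ.* (½ ℚ.* ½ ℚ.* (D ℚ.+ M ℚ.- ι (+ 2)))))
          s₁ = ι (+ 2) ℚ.* (P ℚ.* B) ℚ.+ B ℚ.* B ℚ.+ ℚ.- (N ℚ.* (ι (+ 2) ℚ.* (Q ℚ.* F) ℚ.+ F ℚ.* F))
      in xa ℚ.* xf ℚ.+ xf ℚ.* xa ℚ.+ D ℚ.* (xb ℚ.* xc ℚ.+ xc ℚ.* xb) ℚ.- t₀ ℚ.* xf ℚ.+ 0ℚ ≡
         ½ ℚ.* (t₁ ℚ.* xf ℚ.- 0ℚ ℚ.+ D ℚ.* (t₁ ℚ.* xc ℚ.- 0ℚ))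
    eq₄ = RingSolver.solve-∀ ℚ-ring

  -- The action of `H₁` and its associated order

  act : ℚ → ℚ → ℚ → ℚ → L → L
  act p r s t ⟨ a , b , c , e ⟩ = ⟨ p ℚ.* a , r ℚ.* b , s ℚ.* c ℚ.- mℚ ℚ.* (t ℚ.* e) , s ℚ.* e ℚ.+ t ℚ.* c ⟩

  combination≡act : ∀ q₁ q₂ q₃ q₄ x →
    q₁ · x ⊕ q₂ · τ x ⊕ q₃ · (σ x ⊕ σ (τ x)) ⊕ q₄ · (√m ⊗ (σ x ⊖ σ (τ x))) ≡
    act (q₁ ℚ.+ q₂ ℚ.+ (q₃ ℚ.+ q₃)) (q₁ ℚ.+ q₂ ℚ.- (q₃ ℚ.+ q₃)) (q₁ ℚ.- q₂) (q₄ ℚ.+ q₄) x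
  combination≡act q₁ q₂ q₃ q₄ ⟨ a , b , c , e ⟩ =
    ext (eq₁ q₁ q₂ q₃ q₄ a b c e mℚ nℚ) (eq₂ q₁ q₂ q₃ q₄ a b c e nℚ) (eq₃ q₁ q₂ q₃ q₄ a b c e mℚ)
      (eq₄ q₁ q₂ q₃ q₄ a b c e)
    where
    eq₁ : ∀ q₁ q₂ q₃ q₄ a b c e m n →
      q₁ ℚ.* a ℚ.+ q₂ ℚ.* a ℚ.+ q₃ ℚ.* (a ℚ.+ a) ℚ.+
      q₄ ℚ.* (0ℚ ℚ.* (a ℚ.+ ℚ.- a) ℚ.+ m ℚ.* (1ℚ ℚ.* (ℚ.- b ℚ.+ ℚ.- (ℚ.- b))) ℚ.+ n ℚ.* (0ℚ ℚ.* (c ℚ.+ ℚ.- (ℚ.- c)))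
              ℚ.+ m ℚ.* n ℚ.* (0ℚ ℚ.* (ℚ.- e ℚ.+ ℚ.- (ℚ.- (ℚ.- e))))) ≡
      (q₁ ℚ.+ q₂ ℚ.+ (q₃ ℚ.+ q₃)) ℚ.* a
    eq₁ = RingSolver.solve-∀ ℚ-ring
    eq₂ : ∀ q₁ q₂ q₃ q₄ a b c e n →
      q₁ ℚ.* b ℚ.+ q₂ ℚ.* b ℚ.+ q₃ ℚ.* (ℚ.- b ℚ.+ ℚ.- b) ℚ.+
      q₄ ℚ.* (0ℚ ℚ.* (ℚ.- b ℚ.+ ℚ.- (ℚ.- b)) ℚ.+ 1ℚ ℚ.* (a ℚ.+ ℚ.- a) ℚ.+
              n ℚ.* (0ℚ ℚ.* (ℚ.- e ℚ.+ ℚ.- (ℚ.- (ℚ.- e))) ℚ.+ 0ℚ ℚ.* (c ℚ.+ ℚ.- (ℚ.- c)))) ≡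
      (q₁ ℚ.+ q₂ ℚ.- (q₃ ℚ.+ q₃)) ℚ.* b
    eq₂ = RingSolver.solve-∀ ℚ-ring
    eq₃ : ∀ q₁ q₂ q₃ q₄ a b c e m →
      q₁ ℚ.* c ℚ.+ q₂ ℚ.* ℚ.- c ℚ.+ q₃ ℚ.* (c ℚ.+ ℚ.- c) ℚ.+
      q₄ ℚ.* (0ℚ ℚ.* (c ℚ.+ ℚ.- (ℚ.- c)) ℚ.+ 0ℚ ℚ.* (a ℚ.+ ℚ.- a) ℚ.+
              m ℚ.* (1ℚ ℚ.* (ℚ.- e ℚ.+ ℚ.- (ℚ.- (ℚ.- e))) ℚ.+ 0ℚ ℚ.* (ℚ.- b ℚ.+ ℚ.- (ℚ.- b)))) ≡
      (q₁ ℚ.- q₂) ℚ.* c ℚ.- m ℚ.* ((q₄ ℚ.+ q₄) ℚ.* e)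
    eq₃ = RingSolver.solve-∀ ℚ-ring
    eq₄ : ∀ q₁ q₂ q₃ q₄ a b c e →
      q₁ ℚ.* e ℚ.+ q₂ ℚ.* ℚ.- e ℚ.+ q₃ ℚ.* (ℚ.- e ℚ.+ ℚ.- (ℚ.- e)) ℚ.+
      q₄ ℚ.* (0ℚ ℚ.* (ℚ.- e ℚ.+ ℚ.- (ℚ.- (ℚ.- e))) ℚ.+ 0ℚ ℚ.* (a ℚ.+ ℚ.- a) ℚ.+
              1ℚ ℚ.* (c ℚ.+ ℚ.- (ℚ.- c)) ℚ.+ 0ℚ ℚ.* (ℚ.- b ℚ.+ ℚ.- (ℚ.- b))) ≡
      (q₁ ℚ.- q₂) ℚ.* e ℚ.+ (q₄ ℚ.+ q₄) ℚ.* c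
    eq₄ = RingSolver.solve-∀ ℚ-ring

  H₁⇒act : ∀ {h} → H₁ h → ∃[ p ] ∃[ r ] ∃[ s ] ∃[ t ] (∀ x → h x ≡ act p r s t x)
  H₁⇒act (q₁ , q₂ , q₃ , q₄ , h≡) = q₁ ℚ.+ q₂ ℚ.+ (q₃ ℚ.+ q₃) , q₁ ℚ.+ q₂ ℚ.- (q₃ ℚ.+ q₃) , q₁ ℚ.- q₂ , q₄ ℚ.+ q₄ ,
    λ x → trans (h≡ x) (combination≡act q₁ q₂ q₃ q₄ x)

  act∈H₁ : ∀ p r s t → H₁ (act p r s t)
  act∈H₁ p r s t = q₁ , q₂ , q₃ , q₄ , λ x → sym (trans (combination≡act q₁ q₂ q₃ q₄ x)
    (trans (cong₂ (λ p r → act p r (q₁ ℚ.- q₂) (q₄ ℚ.+ q₄) x) (eq₁ p r s) (eq₂ p r s))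
           (cong₂ (λ s t → act p r s t x) (eq₃ p r s) (eq₄ t))))
    where
    q₁ q₂ q₃ q₄ : ℚ
    -- Solution of `p = q₁ + q₂ + 2 q₃`, `r = q₁ + q₂ - 2 q₃`, `s = q₁ - q₂`, `t = 2 q₄`.
    q₁ = ½ ℚ.* (½ ℚ.* (p ℚ.+ r) ℚ.+ s)
    q₂ = ½ ℚ.* (½ ℚ.* (p ℚ.+ r) ℚ.- s)
    q₃ = ½ ℚ.* ½ ℚ.* (p ℚ.- r)
    q₄ = ½ ℚ.* t
    eq₁ : ∀ p r s → ½ ℚ.* (½ ℚ.* (p ℚ.+ r) ℚ.+ s) ℚ.+ ½ ℚ.* (½ ℚ.* (p ℚ.+ r) ℚ.- s) ℚ.+
            (½ ℚ.* ½ ℚ.* (p ℚ.- r) ℚ.+ ½ ℚ.* ½ ℚ.* (p ℚ.- r)) ≡ p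
    eq₁ = RingSolver.solve-∀ ℚ-ring
    eq₂ : ∀ p r s → ½ ℚ.* (½ ℚ.* (p ℚ.+ r) ℚ.+ s) ℚ.+ ½ ℚ.* (½ ℚ.* (p ℚ.+ r) ℚ.- s) ℚ.-
            (½ ℚ.* ½ ℚ.* (p ℚ.- r) ℚ.+ ½ ℚ.* ½ ℚ.* (p ℚ.- r)) ≡ r
    eq₂ = RingSolver.solve-∀ ℚ-ring
    eq₃ : ∀ p r s → ½ ℚ.* (½ ℚ.* (p ℚ.+ r) ℚ.+ s) ℚ.- ½ ℚ.* (½ ℚ.* (p ℚ.+ r) ℚ.- s) ≡ s
    eq₃ = RingSolver.solve-∀ ℚ-ring
    eq₄ : ∀ t → ½ ℚ.* t ℚ.+ ½ ℚ.* t ≡ t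
    eq₄ = RingSolver.solve-∀ ℚ-ring

  act-⟪⟫ : ∀ p r s t a b c f → act p r s t ⟪ a , b , c , f ⟫ ≡
    ⟪ p ℚ.* a , r ℚ.* b , s ℚ.* c ℚ.- M ℚ.* (t ℚ.* f) , s ℚ.* f ℚ.+ D ℚ.* (t ℚ.* c) ⟫
  act-⟪⟫ p r s t a b c f = ext refl refl
    (trans (cong (λ m → s ℚ.* c ℚ.- m ℚ.* (t ℚ.* (δ ℚ.* f))) mℚ≡MD)
      (trans (eq₁ M D δ s t c f) (trans (cong (λ u → s ℚ.* c ℚ.- M ℚ.* (u ℚ.* (t ℚ.* f))) δd≡1)
        (cong (λ u → s ℚ.* c ℚ.- M ℚ.* u) (ℚ.*-identityˡ (t ℚ.* f))))))
    (sym (trans (eq₂ δ D s t c f) (trans (cong (λ u → s ℚ.* (δ ℚ.* f) ℚ.+ u ℚ.* (t ℚ.* c)) δd≡1)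
      (cong (s ℚ.* (δ ℚ.* f) ℚ.+_) (ℚ.*-identityˡ (t ℚ.* c))))))
    where
    eq₁ : ∀ M D δ s t c f → s ℚ.* c ℚ.- M ℚ.* D ℚ.* (t ℚ.* (δ ℚ.* f)) ≡ s ℚ.* c ℚ.- M ℚ.* (δ ℚ.* D ℚ.* (t ℚ.* f))
    eq₁ = RingSolver.solve-∀ ℚ-ring
    eq₂ : ∀ δ D s t c f → δ ℚ.* (s ℚ.* f ℚ.+ D ℚ.* (t ℚ.* c)) ≡ s ℚ.* (δ ℚ.* f) ℚ.+ δ ℚ.* D ℚ.* (t ℚ.* c)
    eq₂ = RingSolver.solve-∀ ℚ-ring

  ½[D+M]≡1+2κ : ½ ℚ.* (D ℚ.+ M) ≡ ι (+ 1 + + 2 * κ)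
  ½[D+M]≡1+2κ = sym (trans (ι-⟦⟧ (K 1 ⊞ K 2 ⊠ X (# 0)) (κ ∷ []))
    (trans (cong (λ k → ι (+ 1) ℚ.+ ι (+ 2) ℚ.* k) ικ≡) (eq D M)))
    where
    eq : ∀ D M → ι (+ 1) ℚ.+ ι (+ 2) ℚ.* (½ ℚ.* ½ ℚ.* (D ℚ.+ M ℚ.- ι (+ 2))) ≡ ½ ℚ.* (D ℚ.+ M)
    eq = RingSolver.solve-∀ ℚ-ring

  -- The two halves of γ₂ are scaled by `p` and `r` separately, so γ₂ goes to
  -- `r γ₂ + (p - r) / 2 γ₁`; the witness `w` of `p ≡ r (mod 2)` is that coefficient. The factor
  -- `1 + 2 κ` is `(d + m′) / 2`, produced by the halves of γ₄.
  act-basis : ∀ w r s t p b q f → act (ι (r + + 2 * w)) (ι r) (ι s) (ι t) (basis p b q f) ≡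
    basis ((r + + 2 * w) * p + w * b) (r * b) ((s + - (t * + d)) * q + - (t * (+ 1 + + 2 * κ) * f))
          (s * f + t * + d * (+ 2 * q + f))
  act-basis w r s t p b q f = trans (act-⟪⟫ (ι (r + + 2 * w)) (ι r) (ι s) (ι t) xa xb xc xf) (⟪⟫-cong
    (trans (cong (ℚ._* xa) p≡) (trans (eq₁ (ι r) (ι w) (ι p) (ι b))
       (cong₂ (λ y z → y ℚ.+ ½ ℚ.* z) (sym (ι-⟦⟧ ((R ⊞ K 2 ⊠ W) ⊠ P ⊞ W ⊠ B) ρ)) (sym (ι-* r b)))))
    (trans (eq₂ (ι r) (ι b)) (cong (½ ℚ.*_) (sym (ι-* r b))))
    (trans (eq₃ M D (ι s) (ι t) (ι q) (ι f))
       (cong₂ (λ y z → y ℚ.+ ½ ℚ.* z)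
         (trans (cong (λ g → (ι s ℚ.+ ℚ.- (ι t ℚ.* D)) ℚ.* ι q ℚ.+ ℚ.- (ι t ℚ.* g ℚ.* ι f)) g≡)
                (sym (ι-⟦⟧ ((S ⊞ ⊟ (Tᴱ ⊠ Dᴱ)) ⊠ Q ⊞ ⊟ (Tᴱ ⊠ (K 1 ⊞ K 2 ⊠ κᴱ) ⊠ F)) ρ)))
         (sym f≡)))
    (trans (eq₄ D (ι s) (ι t) (ι q) (ι f)) (cong (½ ℚ.*_) (sym f≡))))
    where
    Dᴱ κᴱ W R S Tᴱ P B Q F : Expr 10
    Dᴱ = X (# 0)
    κᴱ = X (# 1)
    W = X (# 2)
    R = X (# 3)
    S = X (# 4)
    Tᴱ = X (# 5)
    P = X (# 6)
    B = X (# 7)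
    Q = X (# 8)
    F = X (# 9)
    ρ : Vec ℤ 10
    ρ = + d ∷ κ ∷ w ∷ r ∷ s ∷ t ∷ p ∷ b ∷ q ∷ f ∷ []
    xa xb xc xf : ℚ
    xa = ι p ℚ.+ ½ ℚ.* ι b
    xb = ½ ℚ.* ι b
    xc = ι q ℚ.+ ½ ℚ.* ι f
    xf = ½ ℚ.* ι f
    p≡ : ι (r + + 2 * w) ≡ ι r ℚ.+ ι (+ 2) ℚ.* ι w
    p≡ = ι-⟦⟧ (R ⊞ K 2 ⊠ W) ρ
    g≡ : ½ ℚ.* (D ℚ.+ M) ≡ ι (+ 1) ℚ.+ ι (+ 2) ℚ.* ι κ
    g≡ = trans ½[D+M]≡1+2κ (ι-⟦⟧ (K 1 ⊞ K 2 ⊠ κᴱ) ρ)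
    f≡ : ι (s * f + t * + d * (+ 2 * q + f)) ≡ ι s ℚ.* ι f ℚ.+ ι t ℚ.* D ℚ.* (ι (+ 2) ℚ.* ι q ℚ.+ ι f)
    f≡ = ι-⟦⟧ (S ⊠ F ⊞ Tᴱ ⊠ Dᴱ ⊠ (K 2 ⊠ Q ⊞ F)) ρ
    eq₁ : ∀ r w p b → (r ℚ.+ ι (+ 2) ℚ.* w) ℚ.* (p ℚ.+ ½ ℚ.* b) ≡ (r ℚ.+ ι (+ 2) ℚ.* w) ℚ.* p ℚ.+ w ℚ.* b ℚ.+
      ½ ℚ.* (r ℚ.* b)
    eq₁ = RingSolver.solve-∀ ℚ-ring
    eq₂ : ∀ r b → r ℚ.* (½ ℚ.* b) ≡ ½ ℚ.* (r ℚ.* b)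
    eq₂ = RingSolver.solve-∀ ℚ-ring
    eq₃ : ∀ M D s t q f → s ℚ.* (q ℚ.+ ½ ℚ.* f) ℚ.- M ℚ.* (t ℚ.* (½ ℚ.* f)) ≡
      (s ℚ.+ ℚ.- (t ℚ.* D)) ℚ.* q ℚ.+ ℚ.- (t ℚ.* (½ ℚ.* (D ℚ.+ M)) ℚ.* f) ℚ.+
      ½ ℚ.* (s ℚ.* f ℚ.+ t ℚ.* D ℚ.* (ι (+ 2) ℚ.* q ℚ.+ f))
    eq₃ = RingSolver.solve-∀ ℚ-ring
    eq₄ : ∀ D s t q f → s ℚ.* (½ ℚ.* f) ℚ.+ D ℚ.* (t ℚ.* (q ℚ.+ ½ ℚ.* f)) ≡
      ½ ℚ.* (s ℚ.* f ℚ.+ t ℚ.* D ℚ.* (ι (+ 2) ℚ.* q ℚ.+ f))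
    eq₄ = RingSolver.solve-∀ ℚ-ring

  act∈𝔄 : ∀ w r s t → 𝔄 H₁ (act (ι (r + + 2 * w)) (ι r) (ι s) (ι t))
  act∈𝔄 w r s t = act∈H₁ (ι (r + + 2 * w)) (ι r) (ι s) (ι t) , λ x x∈𝓞 → preserve x (integral⇒basis x∈𝓞)
    where
    preserve : ∀ x → ∃[ p ] ∃[ b ] ∃[ q ] ∃[ f ] x ≡ basis p b q f → 𝓞 (act (ι (r + + 2 * w)) (ι r) (ι s) (ι t) x)
    preserve x (p , b , q , f , x≡) = subst 𝓞 (sym
      (trans (cong (act (ι (r + + 2 * w)) (ι r) (ι s) (ι t)) x≡) (act-basis w r s t p b q f)))
      (basis⇒integral ((r + + 2 * w) * p + w * b) (r * b) ((s + - (t * + d)) * q + - (t * (+ 1 + + 2 * κ) * f))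
                      (s * f + t * + d * (+ 2 * q + f)))

  -- Write `g = 1 + 2 κ`. As `g` is odd, `b` divides `d`; as `2 g = d + m′`, it divides `m′` too. So
  -- `b²` divides `m′ d = m`.
  odd-coprime : ∀ b → b ℕ.∣ ∣ + 2 * + d ∣ → b ℕ.∣ ∣ + 1 + + 2 * κ ∣ → b ≡ 1
  odd-coprime b b∣2d b∣g = sqf-m b (subst (b ℕ.* b ℕ.∣_) (sym (trans (cong ∣_∣ m≡m′d) (ℤ.abs-* m′ (+ d))))
    (ℕ.*-pres-∣ b∣m′ b∣d))
    where
    coprime-2 : ℕ.Coprime b 2
    coprime-2 {c} (c∣b , c∣2) = ℕ.∣1⇒≡1 (∣⇒∣ᵤ {+ c} {+ 1}
      (∣m+n∣n⇒∣m {+ c} {+ 1} {+ 2 * κ} (∣ᵤ⇒∣ (ℕ.∣-trans c∣b b∣g)) (∣m⇒∣m*n κ (∣ᵤ⇒∣ {+ c} {+ 2} c∣2))))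
    b∣d : b ℕ.∣ d
    b∣d = ℕ.coprime-divisor coprime-2 (subst (b ℕ.∣_) (ℤ.abs-* (+ 2) (+ d)) b∣2d)
    d+m′≡2g : ∀ κ → + 2 + κ * + 4 ≡ + 2 * (+ 1 + + 2 * κ)
    d+m′≡2g = solve-∀
    b∣m′ : b ℕ.∣ ∣ m′ ∣
    b∣m′ = ∣⇒∣ᵤ {+ b} {m′} (∣m+n∣m⇒∣n {+ b} {+ d} {m′}
      (subst (+ b ∣_) (sym (trans d+m′≡2+4κ (d+m′≡2g κ))) (∣n⇒∣m*n (+ 2) (∣ᵤ⇒∣ {+ b} {+ 1 + + 2 * κ} b∣g)))
        (∣ᵤ⇒∣ {+ b} {+ d} b∣d))

  -- The image of γ₃ has `√k`-coordinate `d t`, so `2 d t` is an integer. In the image of γ₄ the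
  -- difference of the `√k`- and `√n`-coordinates is free of `s` and equals `(1 + 2 κ) t`.
  -- Coprimality makes `t` an integer, and then `s = Q + d t` is one.
  images⇒integral : ∀ p r s t →
    ∃[ P ] ∃[ B ] ∃[ Q ] ∃[ F ] act p r s t ⟪ 0ℚ , 0ℚ , 1ℚ , 0ℚ ⟫ ≡ basis P B Q F →
    ∃[ P ] ∃[ B ] ∃[ Q ] ∃[ F ] act p r s t ⟪ 0ℚ , 0ℚ , ½ , ½ ⟫ ≡ basis P B Q F →
    Integral s × Integral t
  images⇒integral p r s t (P , B , Q , F , γ₃≡) (P′ , B′ , Q′ , F′ , γ₄≡) = integral-s , integral-t
    where
    e₃ : ⟪ p ℚ.* 0ℚ , r ℚ.* 0ℚ , s ℚ.* 1ℚ ℚ.- M ℚ.* (t ℚ.* 0ℚ) , s ℚ.* 0ℚ ℚ.+ D ℚ.* (t ℚ.* 1ℚ) ⟫ ≡ basis P B Q F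
    e₃ = trans (sym (act-⟪⟫ p r s t 0ℚ 0ℚ 1ℚ 0ℚ)) γ₃≡
    e₄ : ⟪ p ℚ.* 0ℚ , r ℚ.* 0ℚ , s ℚ.* ½ ℚ.- M ℚ.* (t ℚ.* ½) , s ℚ.* ½ ℚ.+ D ℚ.* (t ℚ.* ½) ⟫ ≡ basis P′ B′ Q′ F′
    e₄ = trans (sym (act-⟪⟫ p r s t 0ℚ 0ℚ ½ ½)) γ₄≡
    γ₃-n : s ℚ.* 1ℚ ℚ.- M ℚ.* (t ℚ.* 0ℚ) ≡ ι Q ℚ.+ ½ ℚ.* ι F
    γ₃-n = cong cₙ e₃
    γ₃-k : s ℚ.* 0ℚ ℚ.+ D ℚ.* (t ℚ.* 1ℚ) ≡ ½ ℚ.* ι F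
    γ₃-k = δ-injective (cong cₘₙ e₃)
    γ₄-n : s ℚ.* ½ ℚ.- M ℚ.* (t ℚ.* ½) ≡ ι Q′ ℚ.+ ½ ℚ.* ι F′
    γ₄-n = cong cₙ e₄
    γ₄-k : s ℚ.* ½ ℚ.+ D ℚ.* (t ℚ.* ½) ≡ ½ ℚ.* ι F′
    γ₄-k = δ-injective (cong cₘₙ e₄)
    2dt : ι (+ 2 * + d) ℚ.* t ≡ ι F
    2dt = trans (cong (ℚ._* t) (ι-* (+ 2) (+ d))) (trans (eq₁ D s t) (trans (cong (ι (+ 2) ℚ.*_) γ₃-k) (eq₂ (ι F))))
      where
      eq₁ : ∀ D s t → ι (+ 2) ℚ.* D ℚ.* t ≡ ι (+ 2) ℚ.* (s ℚ.* 0ℚ ℚ.+ D ℚ.* (t ℚ.* 1ℚ))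
      eq₁ = RingSolver.solve-∀ ℚ-ring
      eq₂ : ∀ F → ι (+ 2) ℚ.* (½ ℚ.* F) ≡ F
      eq₂ = RingSolver.solve-∀ ℚ-ring
    gt : ι (+ 1 + + 2 * κ) ℚ.* t ≡ ι (- Q′)
    gt = trans (cong (ℚ._* t) (sym ½[D+M]≡1+2κ)) (trans (eq₁ D M s t)
           (trans (cong₂ ℚ._-_ γ₄-k γ₄-n) (trans (eq₂ (ι Q′) (ι F′)) (sym (ι-neg Q′)))))
      where
      eq₁ : ∀ D M s t → ½ ℚ.* (D ℚ.+ M) ℚ.* t ≡ (s ℚ.* ½ ℚ.+ D ℚ.* (t ℚ.* ½)) ℚ.- (s ℚ.* ½ ℚ.- M ℚ.* (t ℚ.* ½))
      eq₁ = RingSolver.solve-∀ ℚ-ring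
      eq₂ : ∀ Q F → ½ ℚ.* F ℚ.- (Q ℚ.+ ½ ℚ.* F) ≡ ℚ.- Q
      eq₂ = RingSolver.solve-∀ ℚ-ring
    integral-t : Integral t
    integral-t = ↧≡1⇒integral t (odd-coprime (↧ₙ t) (integral⇒↧∣ (+ 2 * + d) t (F , 2dt))
      (integral⇒↧∣ (+ 1 + + 2 * κ) t (- Q′ , gt)))
    integral-s : Integral s
    integral-s = subst Integral (trans (cong (ι Q ℚ.+_) (trans (eq₁ D s t) γ₃-k)) (trans (sym γ₃-n) (eq₂ M s t)))
      (integral-+ {ι Q} {D ℚ.* t} (Q , refl) (integral-* {D} {t} (+ d , refl) integral-t))
      where
      eq₁ : ∀ D s t → D ℚ.* t ≡ s ℚ.* 0ℚ ℚ.+ D ℚ.* (t ℚ.* 1ℚ)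
      eq₁ = RingSolver.solve-∀ ℚ-ring
      eq₂ : ∀ M s t → s ℚ.* 1ℚ ℚ.- M ℚ.* (t ℚ.* 0ℚ) ≡ s
      eq₂ = RingSolver.solve-∀ ℚ-ring

  preserves⇒integral : ∀ p r s t → (∀ x → 𝓞 x → 𝓞 (act p r s t x)) → Integral s × Integral t
  preserves⇒integral p r s t h = images⇒integral p r s t
    (integral⇒basis (h ⟪ 0ℚ , 0ℚ , 1ℚ , 0ℚ ⟫ (basis⇒integral (+ 0) (+ 0) (+ 1) (+ 0))))
    (integral⇒basis (h ⟪ 0ℚ , 0ℚ , ½ , ½ ⟫ (basis⇒integral (+ 0) (+ 0) (+ 0) (+ 1))))

  -- From a generator to a solution

  -- For β with γ₃- and γ₄-coordinates q and f, the images of β under s + t √-m (s, t ∈ ℤ) form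
  -- a lattice of index ∣G q f∣ in ℤ γ₃ + ℤ γ₄; in terms of x = d (2 q + f) and y = f, the
  -- quantity 2 d G q f is x² + m y².
  G : ℤ → ℤ → ℤ
  G q f = + 2 * + d * (q * q + q * f) + (+ 1 + + 2 * κ) * (f * f)

  x²+my²≡2dG : ∀ q f → (+ 2 * q + f) * + d * ((+ 2 * q + f) * + d) + m * (f * f) ≡ + 2 * + d * G q f
  x²+my²≡2dG q f = begin
    (+ 2 * q + f) * + d * ((+ 2 * q + f) * + d) + m * (f * f)
      ≡⟨ cong (λ m → (+ 2 * q + f) * + d * ((+ 2 * q + f) * + d) + m * (f * f)) m≡m′d ⟩
    (+ 2 * q + f) * + d * ((+ 2 * q + f) * + d) + m′ * + d * (f * f)
      ≡⟨ eq₁ q f (+ d) m′ ⟩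
    + d * (+ 4 * + d * (q * q + q * f) + (+ d + m′) * (f * f))
      ≡⟨ cong (λ z → + d * (+ 4 * + d * (q * q + q * f) + z * (f * f))) d+m′≡2+4κ ⟩
    + d * (+ 4 * + d * (q * q + q * f) + (+ 2 + κ * + 4) * (f * f))
      ≡⟨ eq₂ q f (+ d) κ ⟩
    + 2 * + d * G q f ∎
    where
    eq₁ : ∀ q f d m → (+ 2 * q + f) * d * ((+ 2 * q + f) * d) + m * d * (f * f) ≡
                      d * (+ 4 * d * (q * q + q * f) + (d + m) * (f * f))
    eq₁ = solve-∀
    eq₂ : ∀ q f d κ → d * (+ 4 * d * (q * q + q * f) + (+ 2 + κ * + 4) * (f * f)) ≡
                      + 2 * d * (+ 2 * d * (q * q + q * f) + (+ 1 + + 2 * κ) * (f * f))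
    eq₂ = solve-∀

  norm-form : ∀ q f → D ℚ.* ((ι q ℚ.+ ½ ℚ.* ι f) ℚ.* (ι q ℚ.+ ½ ℚ.* ι f)) ℚ.+ M ℚ.* (½ ℚ.* ι f ℚ.* (½ ℚ.* ι f))
    ≡ ½ ℚ.* ι (G q f)
  norm-form q f = trans (eq D M (ι q) (ι f)) (cong (½ ℚ.*_)
    (trans (cong (λ g → ι (+ 2) ℚ.* D ℚ.* (ι q ℚ.* ι q ℚ.+ ι q ℚ.* ι f) ℚ.+ g ℚ.* (ι f ℚ.* ι f))
              (trans ½[D+M]≡1+2κ (ι-⟦⟧ (K 1 ⊞ K 2 ⊠ κᴱ) ρ)))
           (sym (ι-⟦⟧ (K 2 ⊠ Dᴱ ⊠ (Q ⊠ Q ⊞ Q ⊠ F) ⊞ (K 1 ⊞ K 2 ⊠ κᴱ) ⊠ (F ⊠ F)) ρ))))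
    where
    Dᴱ κᴱ Q F : Expr 4
    Dᴱ = X (# 0)
    κᴱ = X (# 1)
    Q = X (# 2)
    F = X (# 3)
    ρ : Vec ℤ 4
    ρ = + d ∷ κ ∷ q ∷ f ∷ []
    eq : ∀ D M q f → D ℚ.* ((q ℚ.+ ½ ℚ.* f) ℚ.* (q ℚ.+ ½ ℚ.* f)) ℚ.+ M ℚ.* (½ ℚ.* f ℚ.* (½ ℚ.* f)) ≡
      ½ ℚ.* (ι (+ 2) ℚ.* D ℚ.* (q ℚ.* q ℚ.+ q ℚ.* f) ℚ.+ ½ ℚ.* (D ℚ.+ M) ℚ.* (f ℚ.* f))
    eq = RingSolver.solve-∀ ℚ-ring

  -- In coordinates at `√n` and `√k` the image under `s + t √-m` is `s (c , h) + t (- M h , D c)`,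
  -- and these two vectors have determinant `D c² + M h² = G q f / 2`. The targets γ₃ and γ₄ have
  -- determinant 1/2, so multiplicativity gives the equation.
  determinant : ∀ p b q f p₁ r₁ p₂ r₂ s₁ t₁ s₂ t₂ →
    act p₁ r₁ (ι s₁) (ι t₁) (basis p b q f) ≡ ⟪ 0ℚ , 0ℚ , 1ℚ , 0ℚ ⟫ →
    act p₂ r₂ (ι s₂) (ι t₂) (basis p b q f) ≡ ⟪ 0ℚ , 0ℚ , ½ , ½ ⟫ →
    (s₁ * t₂ + - (t₁ * s₂)) * G q f ≡ + 1
  determinant p b q f p₁ r₁ p₂ r₂ s₁ t₁ s₂ t₂ γ₃≡ γ₄≡ = ι-injective {(s₁ * t₂ + - (t₁ * s₂)) * G q f} {+ 1} (begin
    ι ((s₁ * t₂ + - (t₁ * s₂)) * G q f)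
      ≡⟨ ι-⟦⟧ ((X (# 0) ⊠ X (# 1) ⊞ ⊟ (X (# 2) ⊠ X (# 3))) ⊠ X (# 4)) (s₁ ∷ t₂ ∷ t₁ ∷ s₂ ∷ G q f ∷ []) ⟩
    (ι s₁ ℚ.* ι t₂ ℚ.+ ℚ.- (ι t₁ ℚ.* ι s₂)) ℚ.* ι (G q f)
      ≡⟨ double (ι s₁ ℚ.* ι t₂ ℚ.+ ℚ.- (ι t₁ ℚ.* ι s₂)) (ι (G q f)) ⟩
    ι (+ 2) ℚ.* ((ι s₁ ℚ.* ι t₂ ℚ.+ ℚ.- (ι t₁ ℚ.* ι s₂)) ℚ.* (½ ℚ.* ι (G q f)))
      ≡⟨ cong (λ z → ι (+ 2) ℚ.* ((ι s₁ ℚ.* ι t₂ ℚ.+ ℚ.- (ι t₁ ℚ.* ι s₂)) ℚ.* z)) (norm-form q f) ⟨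
    ι (+ 2) ℚ.* ((ι s₁ ℚ.* ι t₂ ℚ.+ ℚ.- (ι t₁ ℚ.* ι s₂)) ℚ.* (D ℚ.* (c ℚ.* c) ℚ.+ M ℚ.* (h ℚ.* h)))
      ≡⟨ cong (ι (+ 2) ℚ.*_) (cross D M (ι s₁) (ι t₁) (ι s₂) (ι t₂) c h) ⟩
    ι (+ 2) ℚ.* ((ι s₁ ℚ.* c ℚ.- M ℚ.* (ι t₁ ℚ.* h)) ℚ.* (ι s₂ ℚ.* h ℚ.+ D ℚ.* (ι t₂ ℚ.* c)) ℚ.-
                 (ι s₁ ℚ.* h ℚ.+ D ℚ.* (ι t₁ ℚ.* c)) ℚ.* (ι s₂ ℚ.* c ℚ.- M ℚ.* (ι t₂ ℚ.* h)))
      ≡⟨ cong (ι (+ 2) ℚ.*_) (cong₂ ℚ._-_ (cong₂ ℚ._*_ (cong cₙ e₃) (δ-injective (cong cₘₙ e₄)))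
                                          (cong₂ ℚ._*_ (δ-injective (cong cₘₙ e₃)) (cong cₙ e₄))) ⟩
    ι (+ 1) ∎)
    where
    c h : ℚ
    c = ι q ℚ.+ ½ ℚ.* ι f
    h = ½ ℚ.* ι f
    e₃ : ⟪ p₁ ℚ.* (ι p ℚ.+ ½ ℚ.* ι b) , r₁ ℚ.* (½ ℚ.* ι b) , ι s₁ ℚ.* c ℚ.- M ℚ.* (ι t₁ ℚ.* h) , ι s₁ ℚ.* h ℚ.+
      D ℚ.* (ι t₁ ℚ.* c) ⟫ ≡
         ⟪ 0ℚ , 0ℚ , 1ℚ , 0ℚ ⟫
    e₃ = trans (sym (act-⟪⟫ p₁ r₁ (ι s₁) (ι t₁) (ι p ℚ.+ ½ ℚ.* ι b) (½ ℚ.* ι b) c h)) γ₃≡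
    e₄ : ⟪ p₂ ℚ.* (ι p ℚ.+ ½ ℚ.* ι b) , r₂ ℚ.* (½ ℚ.* ι b) , ι s₂ ℚ.* c ℚ.- M ℚ.* (ι t₂ ℚ.* h) , ι s₂ ℚ.* h ℚ.+
      D ℚ.* (ι t₂ ℚ.* c) ⟫ ≡
         ⟪ 0ℚ , 0ℚ , ½ , ½ ⟫
    e₄ = trans (sym (act-⟪⟫ p₂ r₂ (ι s₂) (ι t₂) (ι p ℚ.+ ½ ℚ.* ι b) (½ ℚ.* ι b) c h)) γ₄≡
    double : ∀ u g → u ℚ.* g ≡ ι (+ 2) ℚ.* (u ℚ.* (½ ℚ.* g))
    double = RingSolver.solve-∀ ℚ-ring
    cross : ∀ D M s t s′ t′ c h → (s ℚ.* t′ ℚ.+ ℚ.- (t ℚ.* s′)) ℚ.* (D ℚ.* (c ℚ.* c) ℚ.+ M ℚ.* (h ℚ.* h)) ≡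
      (s ℚ.* c ℚ.- M ℚ.* (t ℚ.* h)) ℚ.* (s′ ℚ.* h ℚ.+ D ℚ.* (t′ ℚ.* c)) ℚ.-
      (s ℚ.* h ℚ.+ D ℚ.* (t ℚ.* c)) ℚ.* (s′ ℚ.* c ℚ.- M ℚ.* (t′ ℚ.* h))
    cross = RingSolver.solve-∀ ℚ-ring

  Solves : ℤ → ℤ → Set
  Solves x y = (x * x + m * (y * y) ≡ + (2 ℕ.* d)) ⊎ (x * x + m * (y * y) ≡ - (+ (2 ℕ.* d)))

  unit⇒solves : ∀ k q f → k * G q f ≡ + 1 → Solves ((+ 2 * q + f) * + d) f
  unit⇒solves k q f kG≡1 = [ (λ G≡ → inj₁ (trans (value (+ 1) G≡) (ℤ.*-identityʳ (+ (2 ℕ.* d)))))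
                           , (λ G≡ → inj₂ (trans (value (- + 1) G≡) (negate (+ (2 ℕ.* d))))) ]′ (sign (G q f) ∣G∣≡1)
    where
    ∣G∣≡1 : ∣ G q f ∣ ≡ 1
    ∣G∣≡1 = ℕ.m*n≡1⇒n≡1 ∣ k ∣ ∣ G q f ∣ (trans (sym (ℤ.abs-* k (G q f))) (cong ∣_∣ kG≡1))
    sign : ∀ z → ∣ z ∣ ≡ 1 → z ≡ + 1 ⊎ z ≡ - + 1
    sign (+ _)             refl = inj₁ refl
    sign ℤ.-[1+ zero ]     _    = inj₂ refl
    sign ℤ.-[1+ suc _ ]    ()
    value : ∀ e → G q f ≡ e → (+ 2 * q + f) * + d * ((+ 2 * q + f) * + d) + m * (f * f) ≡ + (2 ℕ.* d) * e
    value e G≡ = trans (x²+my²≡2dG q f) (cong₂ _*_ (sym (ℤ.pos-* 2 d)) G≡)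
    negate : ∀ z → z * - + 1 ≡ - z
    negate = solve-∀

  Image : L → L → Set
  Image β y = ∃[ p ] ∃[ r ] ∃[ s ] ∃[ t ] act p r (ι s) (ι t) β ≡ y

  image : ∀ β y h → 𝔄 H₁ h → h β ≡ y → Image β y
  image β y h (h∈H₁ , h𝓞⊆𝓞) hβ≡y = from-act (H₁⇒act h∈H₁)
    where
    from-integral : ∀ p r s t → (∀ x → h x ≡ act p r s t x) → Integral s → Integral t → Image β y
    from-integral p r _ _ h≡ (s , refl) (t , refl) = p , r , s , t , trans (sym (h≡ β)) hβ≡y
    from-act : ∃[ p ] ∃[ r ] ∃[ s ] ∃[ t ] (∀ x → h x ≡ act p r s t x) → Image β y
    from-act (p , r , s , t , h≡) = from-integral p r s t h≡ (proj₁ st) (proj₂ st)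
      where
      st : Integral s × Integral t
      st = preserves⇒integral p r s t (λ x x∈𝓞 → subst 𝓞 (h≡ x) (h𝓞⊆𝓞 x x∈𝓞))

  -- A generator reaches γ₃ and γ₄, and the determinant of the two multipliers is an inverse of
  -- `G q f` in ℤ.
  generator⇒solvable : ∀ β → IsFreeGenerator H₁ β → ∃[ x ] ∃[ y ] Solves x y
  generator⇒solvable β (β∈𝓞 , _ , surjective) = solve-with (integral⇒basis β∈𝓞)
    (hit ⟪ 0ℚ , 0ℚ , 1ℚ , 0ℚ ⟫ (basis⇒integral (+ 0) (+ 0) (+ 1) (+ 0)))
    (hit ⟪ 0ℚ , 0ℚ , ½ , ½ ⟫ (basis⇒integral (+ 0) (+ 0) (+ 0) (+ 1)))
    where
    hit : ∀ y → 𝓞 y → Image β y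
    hit y y∈𝓞 = preimage (surjective (y , y∈𝓞))
      where
      preimage : (∃[ h ] (∀ {h′ : ∃ (𝔄 H₁)} → (proj₁ h′ ≗ proj₁ h) → proj₁ h′ β ≡ y)) → Image β y
      preimage ((h , h∈𝔄) , hβ≡y) = image β y h h∈𝔄 (hβ≡y {h , h∈𝔄} (λ _ → refl))
    solve-with : ∃[ p ] ∃[ b ] ∃[ q ] ∃[ f ] β ≡ basis p b q f →
      Image β ⟪ 0ℚ , 0ℚ , 1ℚ , 0ℚ ⟫ → Image β ⟪ 0ℚ , 0ℚ , ½ , ½ ⟫ → ∃[ x ] ∃[ y ] Solves x y
    solve-with (p , b , q , f , refl) (p₁ , r₁ , s₁ , t₁ , γ₃≡) (p₂ , r₂ , s₂ , t₂ , γ₄≡) =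
      (+ 2 * q + f) * + d , f , unit⇒solves (s₁ * t₂ + - (t₁ * s₂)) q f
        (determinant p b q f p₁ r₁ p₂ r₂ s₁ t₁ s₂ t₂ γ₃≡ γ₄≡)

  -- From a solution to a generator

  module _ (q f ε : ℤ) (G≡ε : G q f ≡ ε) (ε²≡1 : ε * ε ≡ + 1) where

    -- The part `γ₁ - γ₂` has coordinates ½ and -½ at 1 and `√m`. It generates ℤ γ₁ + ℤ γ₂ over the
    -- pairs `p ≡ r (mod 2)`.
    β : L
    β = basis (+ 1) (- + 1) q f

    private
      c h e : ℚ
      c = ι q ℚ.+ ½ ℚ.* ι f
      h = ½ ℚ.* ι f
      e = ι ε

      unscale : ∀ s → ι (+ 2) ℚ.* e ℚ.* (s ℚ.* (D ℚ.* (c ℚ.* c) ℚ.+ M ℚ.* (h ℚ.* h))) ≡ s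
      unscale s = begin
        ι (+ 2) ℚ.* e ℚ.* (s ℚ.* (D ℚ.* (c ℚ.* c) ℚ.+ M ℚ.* (h ℚ.* h)))
          ≡⟨ cong (λ z → ι (+ 2) ℚ.* e ℚ.* (s ℚ.* z)) (trans (norm-form q f) (cong (λ g → ½ ℚ.* ι g) G≡ε)) ⟩
        ι (+ 2) ℚ.* e ℚ.* (s ℚ.* (½ ℚ.* e))
          ≡⟨ eq e s ⟩
        s ℚ.* (e ℚ.* e)
          ≡⟨ cong (s ℚ.*_) (trans (sym (ι-* ε ε)) (cong ι ε²≡1)) ⟩
        s ℚ.* 1ℚ
          ≡⟨ ℚ.*-identityʳ s ⟩
        s ∎
        where
        eq : ∀ e s → ι (+ 2) ℚ.* e ℚ.* (s ℚ.* (½ ℚ.* e)) ≡ s ℚ.* (e ℚ.* e)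
        eq = RingSolver.solve-∀ ℚ-ring

      -- Cramer's rule for the vectors `(c , h)` and `(- M h , D c)`: their determinant is `ε / 2`,
      -- whose inverse is `2 ε` because `ε² = 1`.
      recover-s : ∀ s t → ι (+ 2) ℚ.* e ℚ.* (D ℚ.* c ℚ.* (s ℚ.* c ℚ.- M ℚ.* (t ℚ.* h)) ℚ.+
                    M ℚ.* h ℚ.* (s ℚ.* h ℚ.+ D ℚ.* (t ℚ.* c))) ≡ s
      recover-s s t = trans (cong (ι (+ 2) ℚ.* e ℚ.*_) (eq D M c h s t)) (unscale s)
        where
        eq : ∀ D M c h s t → D ℚ.* c ℚ.* (s ℚ.* c ℚ.- M ℚ.* (t ℚ.* h)) ℚ.+ M ℚ.* h ℚ.*
          (s ℚ.* h ℚ.+ D ℚ.* (t ℚ.* c)) ≡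
          s ℚ.* (D ℚ.* (c ℚ.* c) ℚ.+ M ℚ.* (h ℚ.* h))
        eq = RingSolver.solve-∀ ℚ-ring

      recover-t : ∀ s t → ι (+ 2) ℚ.* e ℚ.* (c ℚ.* (s ℚ.* h ℚ.+ D ℚ.* (t ℚ.* c)) ℚ.- h ℚ.*
        (s ℚ.* c ℚ.- M ℚ.* (t ℚ.* h))) ≡ t
      recover-t s t = trans (cong (ι (+ 2) ℚ.* e ℚ.*_) (eq D M c h s t)) (unscale t)
        where
        eq : ∀ D M c h s t → c ℚ.* (s ℚ.* h ℚ.+ D ℚ.* (t ℚ.* c)) ℚ.- h ℚ.* (s ℚ.* c ℚ.- M ℚ.* (t ℚ.* h)) ≡
          t ℚ.* (D ℚ.* (c ℚ.* c) ℚ.+ M ℚ.* (h ℚ.* h))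
        eq = RingSolver.solve-∀ ℚ-ring

      cancel-½ : ∀ {p p′} → p ℚ.* ½ ≡ p′ ℚ.* ½ → p ≡ p′
      cancel-½ {p} {p′} eq = trans (double p) (trans (cong (ℚ._* ι (+ 2)) eq) (sym (double p′)))
        where
        double : ∀ p → p ≡ p ℚ.* ½ ℚ.* ι (+ 2)
        double = RingSolver.solve-∀ ℚ-ring

      cancel--½ : ∀ {p p′} → p ℚ.* ℚ.- ½ ≡ p′ ℚ.* ℚ.- ½ → p ≡ p′
      cancel--½ {p} {p′} eq = trans (double p) (trans (cong (ℚ._* ι (- + 2)) eq) (sym (double p′)))
        where
        double : ∀ p → p ≡ p ℚ.* ℚ.- ½ ℚ.* ι (- + 2)
        double = RingSolver.solve-∀ ℚ-ring

      act-β : ∀ p r s t → act p r s t β ≡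
        ⟪ p ℚ.* ½ , r ℚ.* ℚ.- ½ , s ℚ.* c ℚ.- M ℚ.* (t ℚ.* h) , s ℚ.* h ℚ.+ D ℚ.* (t ℚ.* c) ⟫
      act-β p r s t = act-⟪⟫ p r s t ½ (ℚ.- ½) c h

    act-injective : ∀ p r s t p′ r′ s′ t′ →
      act p r s t β ≡ act p′ r′ s′ t′ β → ∀ x → act p r s t x ≡ act p′ r′ s′ t′ x
    act-injective p r s t p′ r′ s′ t′ eq x = trans
      (cong₂ (λ p r → act p r s t x) (cancel-½ {p} {p′} (cong c₁ eq′)) (cancel--½ {r} {r′} (cong cₘ eq′)))
      (cong₂ (λ s t → act p′ r′ s t x)
        (trans (sym (recover-s s t)) (trans (cong₂ (λ u v → ι (+ 2) ℚ.* e ℚ.* (D ℚ.* c ℚ.* u ℚ.+ M ℚ.* h ℚ.* v))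
          eqₙ eqₖ) (recover-s s′ t′)))
        (trans (sym (recover-t s t)) (trans (cong₂ (λ u v → ι (+ 2) ℚ.* e ℚ.* (c ℚ.* v ℚ.- h ℚ.* u)) eqₙ eqₖ)
          (recover-t s′ t′))))
      where
      eq′ : ⟪ p ℚ.* ½ , r ℚ.* ℚ.- ½ , s ℚ.* c ℚ.- M ℚ.* (t ℚ.* h) , s ℚ.* h ℚ.+ D ℚ.* (t ℚ.* c) ⟫ ≡
            ⟪ p′ ℚ.* ½ , r′ ℚ.* ℚ.- ½ , s′ ℚ.* c ℚ.- M ℚ.* (t′ ℚ.* h) , s′ ℚ.* h ℚ.+ D ℚ.* (t′ ℚ.* c) ⟫
      eq′ = trans (sym (act-β p r s t)) (trans eq (act-β p′ r′ s′ t′))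
      eqₙ : s ℚ.* c ℚ.- M ℚ.* (t ℚ.* h) ≡ s′ ℚ.* c ℚ.- M ℚ.* (t′ ℚ.* h)
      eqₙ = cong cₙ eq′
      eqₖ : s ℚ.* h ℚ.+ D ℚ.* (t ℚ.* c) ≡ s′ ℚ.* h ℚ.+ D ℚ.* (t′ ℚ.* c)
      eqₖ = δ-injective (cong cₘₙ eq′)

    act-surjective : ∀ p′ b′ q′ f′ → ∃[ w ] ∃[ r ] ∃[ s ] ∃[ t ]
      act (ι (r + + 2 * w)) (ι r) (ι s) (ι t) β ≡ basis p′ b′ q′ f′
    act-surjective p′ b′ q′ f′ = w , r , s , t , trans (act-basis w r s t (+ 1) (- + 1) q f)
      (trans (cong₂ (λ p b → basis p b ((s + - (t * + d)) * q + - (t * g * f))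
        (s * f + t * + d * (+ 2 * q + f))) (eq₁ p′ b′) (eq₂ b′))
             (cong₂ (basis p′ b′) (trans (eq₃ ε (+ d) g q f q′ f′) (unit q′))
               (trans (eq₄ ε (+ d) g q f q′ f′) (unit f′))))
      where
      g w r s t : ℤ
      g = + 1 + + 2 * κ
      -- The coordinates at γ₁ and γ₂ ask for `r + w = p′` and `- r = b′`.
      w = p′ + b′
      r = - b′
      -- Cramer's rule in the basis γ₃, γ₄: `s` is `ε` times the symmetric bilinear form of `G` at
      -- `(q , f)` and `(q′ , f′)`, and `t` is `ε` times their determinant.
      s = ε * (+ 2 * + d * (q * q′) + + d * (q * f′ + f * q′) + g * (f * f′))
      t = ε * (q * f′ + - (f * q′))
      eq₁ : ∀ p b → (- b + + 2 * (p + b)) * + 1 + (p + b) * - + 1 ≡ p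
      eq₁ = solve-∀
      eq₂ : ∀ b → - b * - + 1 ≡ b
      eq₂ = solve-∀
      eq₃ : ∀ ε d g q f q′ f′ →
        (ε * (+ 2 * d * (q * q′) + d * (q * f′ + f * q′) + g * (f * f′)) + - (ε * (q * f′ + - (f * q′)) * d)) * q +
        - (ε * (q * f′ + - (f * q′)) * g * f) ≡
        ε * (+ 2 * d * (q * q + q * f) + g * (f * f)) * q′
      eq₃ = solve-∀
      eq₄ : ∀ ε d g q f q′ f′ →
        ε * (+ 2 * d * (q * q′) + d * (q * f′ + f * q′) + g * (f * f′)) * f +
        ε * (q * f′ + - (f * q′)) * d * (+ 2 * q + f) ≡
        ε * (+ 2 * d * (q * q + q * f) + g * (f * f)) * f′
      eq₄ = solve-∀
      unit : ∀ z → ε * G q f * z ≡ z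
      unit z = trans (cong (_* z) (trans (cong (ε *_) G≡ε) ε²≡1)) (ℤ.*-identityˡ z)

    isFreeGenerator : IsFreeGenerator H₁ β
    isFreeGenerator = basis⇒integral (+ 1) (- + 1) q f ,
      (λ {(h₁ , h₁∈𝔄)} {(h₂ , h₂∈𝔄)} → injective h₁ h₂ (H₁⇒act (proj₁ h₁∈𝔄)) (H₁⇒act (proj₁ h₂∈𝔄))) ,
      (λ (y , y∈𝓞) → surjective y y∈𝓞 (integral⇒basis y∈𝓞))
      where
      injective : ∀ h₁ h₂ → ∃[ p ] ∃[ r ] ∃[ s ] ∃[ t ] (∀ x → h₁ x ≡ act p r s t x) →
        ∃[ p ] ∃[ r ] ∃[ s ] ∃[ t ] (∀ x → h₂ x ≡ act p r s t x) → h₁ β ≡ h₂ β → h₁ ≗ h₂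
      injective h₁ h₂ (p , r , s , t , h₁≡) (p′ , r′ , s′ , t′ , h₂≡) eq x = trans (h₁≡ x)
        (trans (act-injective p r s t p′ r′ s′ t′ (trans (sym (h₁≡ β)) (trans eq (h₂≡ β))) x) (sym (h₂≡ x)))
      surjective : ∀ y (y∈𝓞 : 𝓞 y) → ∃[ p ] ∃[ b ] ∃[ q ] ∃[ f ] y ≡ basis p b q f →
        ∃[ h ] (∀ {h′ : ∃ (𝔄 H₁)} → proj₁ h′ ≗ proj₁ h → proj₁ h′ β ≡ y)
      surjective y y∈𝓞 (p′ , b′ , q′ , f′ , y≡) = from-act (act-surjective p′ b′ q′ f′)
        where
        from-act : ∃[ w ] ∃[ r ] ∃[ s ] ∃[ t ] act (ι (r + + 2 * w)) (ι r) (ι s) (ι t) β ≡ basis p′ b′ q′ f′ →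
          ∃[ h ] (∀ {h′ : ∃ (𝔄 H₁)} → proj₁ h′ ≗ proj₁ h → proj₁ h′ β ≡ y)
        from-act (w , r , s , t , eq) = (act (ι (r + + 2 * w)) (ι r) (ι s) (ι t) , act∈𝔄 w r s t) ,
          λ h′≗h → trans (h′≗h β) (trans eq (sym y≡))

  cancel-d : ∀ u v → u * + d ≡ v * + d → u ≡ v
  cancel-d u v eq = ι-injective {u} {v} (trans (sym (strip u)) (trans (cong (λ z → δ ℚ.* ι z) eq) (strip v)))
    where
    strip : ∀ u → δ ℚ.* ι (u * + d) ≡ ι u
    strip u = trans (cong (δ ℚ.*_) (trans (ι-* u (+ d)) (ℚ.*-comm (ι u) D))) (δ[De]≡e (ι u))

  sqf-d : SquareFree (+ d)
  sqf-d a a²∣d = sqf-m a (subst (a ℕ.* a ℕ.∣_) (sym (trans (cong ∣_∣ m≡m′d) (ℤ.abs-* m′ (+ d))))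
    (ℕ.∣n⇒∣m*n ∣ m′ ∣ a²∣d))

  -- The rational `x / d` satisfies `d (x / d)² = z`, and `d` is square-free as a divisor of `m`.
  d∣x²⇒d∣x : ∀ x z → x * x ≡ z * + d → ∃[ c ] x ≡ c * + d
  d∣x²⇒d∣x x z x²≡zd = divide (squarefree⇒integral {+ d} sqf-d (δ ℚ.* ι x) (z , dq²≡z))
    where
    regroup : ∀ δ D x → D ℚ.* (δ ℚ.* x ℚ.* (δ ℚ.* x)) ≡ δ ℚ.* (δ ℚ.* D) ℚ.* (x ℚ.* x)
    regroup = RingSolver.solve-∀ ℚ-ring
    dq²≡z : D ℚ.* (δ ℚ.* ι x ℚ.* (δ ℚ.* ι x)) ≡ ι z
    dq²≡z = begin
      D ℚ.* (δ ℚ.* ι x ℚ.* (δ ℚ.* ι x))     ≡⟨ regroup δ D (ι x) ⟩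
      δ ℚ.* (δ ℚ.* D) ℚ.* (ι x ℚ.* ι x)     ≡⟨ cong (λ u → δ ℚ.* u ℚ.* (ι x ℚ.* ι x)) δd≡1 ⟩
      δ ℚ.* 1ℚ ℚ.* (ι x ℚ.* ι x)            ≡⟨ cong₂ ℚ._*_ (ℚ.*-identityʳ δ)
        (trans (sym (ι-* x x)) (cong ι x²≡zd)) ⟩
      δ ℚ.* ι (z * + d)                     ≡⟨ cong (δ ℚ.*_) (trans (ι-* z (+ d)) (ℚ.*-comm (ι z) D)) ⟩
      δ ℚ.* (D ℚ.* ι z)                     ≡⟨ δ[De]≡e (ι z) ⟩
      ι z                                   ∎
    divide : Integral (δ ℚ.* ι x) → ∃[ c ] x ≡ c * + d
    divide (c , eq) = c , ι-injective {x} {c * + d} (begin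
      ι x                        ≡⟨ δ[De]≡e (ι x) ⟨
      δ ℚ.* (D ℚ.* ι x)          ≡⟨ swap δ D (ι x) ⟩
      δ ℚ.* ι x ℚ.* D            ≡⟨ cong (ℚ._* D) eq ⟩
      ι c ℚ.* D                  ≡⟨ ι-* c (+ d) ⟨
      ι (c * + d)                ∎)
      where
      swap : ∀ δ D x → δ ℚ.* (D ℚ.* x) ≡ δ ℚ.* x ℚ.* D
      swap = RingSolver.solve-∀ ℚ-ring

  -- Both `d` and `m′` are odd, so modulo 2 the equation reads `c + y ≡ 0`.
  solution⇒parity : ∀ c y ε → ε * ε ≡ + 1 → + d * (c * c) + m′ * (y * y) ≡ + 2 * ε → + 4 ∣ + 2 * (c + - y)
  solution⇒parity c y ε ε²≡1 eq = proj₁ (mod4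
    (Mᴱ ⊠ Dᴱ ⊞ ⊟ K 1 ∷ E ⊠ E ⊞ ⊟ K 1 ∷ Dᴱ ⊠ (C ⊠ C) ⊞ Mᴱ ⊠ (Y ⊠ Y) ⊞ ⊟ (K 2 ⊠ E) ∷ [])
    (K 2 ⊠ (C ⊞ ⊟ Y) ∷ []) tt (+ d ∷ m′ ∷ c ∷ y ∷ ε ∷ [])
    ( subst (λ m → + 4 ∣ m + - + 1) m≡m′d 4∣m-1
    , divides (+ 0) (cong (_+ - + 1) ε²≡1)
    , divides (+ 0) (trans (cong (_+ - (+ 2 * ε)) eq) (ℤ.+-inverseʳ (+ 2 * ε))) , tt))
    where
    Dᴱ Mᴱ C Y E : Expr 5
    Dᴱ = X (# 0)
    Mᴱ = X (# 1)
    C = X (# 2)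
    Y = X (# 3)
    E = X (# 4)

  -- Since `d` divides `m`, it divides `x²` and hence `x = c d`. Division by `d` leaves
  -- `d c² + m′ y² = 2 ε` with a sign `ε`, so `c - y = 2 q` is even. This `q` equals
  -- `(x - d y) / (2 d)`, which is how the coefficient of γ₃ in `genβ` turns out to be an integer.
  solves⇒generator : ∀ x y → Solves x y → ∃[ q ] x ≡ (+ 2 * q + y) * + d ×
            IsFreeGenerator H₁ (basis (+ 1) (- + 1) q y)
  solves⇒generator x y = [ (λ eq → from-sign (+ 1) refl (trans eq (sym (ℤ.*-identityʳ (+ (2 ℕ.* d))))))
                         , (λ eq → from-sign (- + 1) refl (trans eq (negate (+ (2 ℕ.* d))))) ]′
    where
    negate : ∀ z → - z ≡ z * - + 1
    negate = solve-∀
    from-sign : ∀ ε → ε * ε ≡ + 1 → x * x + m * (y * y) ≡ + (2 ℕ.* d) * ε →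
      ∃[ q ] x ≡ (+ 2 * q + y) * + d × IsFreeGenerator H₁ (basis (+ 1) (- + 1) q y)
    from-sign ε ε²≡1 eq = from-multiple (d∣x²⇒d∣x x (+ 2 * ε + - (m′ * (y * y))) (begin
      x * x
        ≡⟨ isolate (x * x) (m * (y * y)) ⟩
      x * x + m * (y * y) + - (m * (y * y))
        ≡⟨ cong₂ (λ u m → u + - (m * (y * y))) norm≡ m≡m′d ⟩
      + 2 * + d * ε + - (m′ * + d * (y * y))
        ≡⟨ collect (+ d) ε m′ (y * y) ⟩
      (+ 2 * ε + - (m′ * (y * y))) * + d ∎))
      where
      norm≡ : x * x + m * (y * y) ≡ + 2 * + d * ε
      norm≡ = trans eq (cong (_* ε) (ℤ.pos-* 2 d))
      isolate : ∀ u v → u ≡ u + v + - v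
      isolate = solve-∀
      collect : ∀ d ε m v → + 2 * d * ε + - (m * d * v) ≡ (+ 2 * ε + - (m * v)) * d
      collect = solve-∀
      from-multiple : ∃[ c ] x ≡ c * + d → ∃[ q ] x ≡ (+ 2 * q + y) * + d ×
            IsFreeGenerator H₁ (basis (+ 1) (- + 1) q y)
      from-multiple (c , x≡cd) = from-half (halve (c + - y) (solution⇒parity c y ε ε²≡1 (cancel-d _ _ (begin
        (+ d * (c * c) + m′ * (y * y)) * + d
          ≡⟨ expand (+ d) c m′ y ⟩
        c * + d * (c * + d) + m′ * + d * (y * y)
          ≡⟨ cong₂ (λ x m → x * x + m * (y * y)) (sym x≡cd) (sym m≡m′d) ⟩
        x * x + m * (y * y)
          ≡⟨ norm≡ ⟩
        + 2 * + d * ε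
          ≡⟨ swap (+ d) ε ⟩
        + 2 * ε * + d ∎))))
        where
        expand : ∀ d c m y → (d * (c * c) + m * (y * y)) * d ≡ c * d * (c * d) + m * d * (y * y)
        expand = solve-∀
        swap : ∀ d ε → + 2 * d * ε ≡ + 2 * ε * d
        swap = solve-∀
        from-half : ∃[ q ] c + - y ≡ + 2 * q → ∃[ q ] x ≡ (+ 2 * q + y) * + d ×
            IsFreeGenerator H₁ (basis (+ 1) (- + 1) q y)
        from-half (q , c-y≡2q) = q , x≡ , isFreeGenerator q y ε G≡ε ε²≡1
          where
          restore : ∀ c y → c ≡ c + - y + y
          restore = solve-∀
          x≡ : x ≡ (+ 2 * q + y) * + d
          x≡ = trans x≡cd (cong (_* + d) (trans (restore c y) (cong (_+ y) c-y≡2q)))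
          2dG≡ : ∀ d g → + 2 * d * g ≡ + 2 * g * d
          2dG≡ = solve-∀
          G≡ε : G q y ≡ ε
          G≡ε = ℤ.*-cancelˡ-≡ (+ 2) (G q y) ε (cancel-d (+ 2 * G q y) (+ 2 * ε) (begin
            + 2 * G q y * + d      ≡⟨ 2dG≡ (+ d) (G q y) ⟨
            + 2 * + d * G q y      ≡⟨ x²+my²≡2dG q y ⟨
            (+ 2 * q + y) * + d * ((+ 2 * q + y) * + d) + m * (y * y)   ≡⟨ cong (λ x → x * x + m * (y * y)) x≡ ⟨
            x * x + m * (y * y)    ≡⟨ norm≡ ⟩
            + 2 * + d * ε          ≡⟨ swap (+ d) ε ⟩
            + 2 * ε * + d          ∎))

-- The stated generator in coordinates

module GeneratorCoordinates (m n : ℤ) .{{_ : NonZero m}} .{{_ : NonZero n}} where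

  open Biquadratic m n
    using (⟨_,_,_,_⟩; mℚ; nℚ; √m; √n; γ₁; γ₂; γ₃; genβ; _·_; d; d-nonZero; 2d-nonZero)
    renaming (_-_ to _⊖_; _+_ to _⊕_; _*_ to _⊗_)
  open Lattice m n using (ext)

  private
    δ : ℚ
    δ = + 1 / d

  √m√n : √m ⊗ √n ≡ ⟨ 0ℚ , 0ℚ , 0ℚ , 1ℚ ⟩
  √m√n = ext (eq₁ mℚ nℚ) (eq₂ nℚ) (eq₂′ mℚ) refl
    where
    eq₁ : ∀ m n → 0ℚ ℚ.* 0ℚ ℚ.+ m ℚ.* (1ℚ ℚ.* 0ℚ) ℚ.+ n ℚ.* (0ℚ ℚ.* 1ℚ) ℚ.+ m ℚ.* n ℚ.* (0ℚ ℚ.* 0ℚ) ≡ 0ℚ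
    eq₁ = RingSolver.solve-∀ ℚ-ring
    eq₂ : ∀ n → 0ℚ ℚ.* 0ℚ ℚ.+ 1ℚ ℚ.* 0ℚ ℚ.+ n ℚ.* (0ℚ ℚ.* 0ℚ ℚ.+ 0ℚ ℚ.* 1ℚ) ≡ 0ℚ
    eq₂ = RingSolver.solve-∀ ℚ-ring
    eq₂′ : ∀ m → 0ℚ ℚ.* 1ℚ ℚ.+ 0ℚ ℚ.* 0ℚ ℚ.+ m ℚ.* (1ℚ ℚ.* 0ℚ ℚ.+ 0ℚ ℚ.* 0ℚ) ≡ 0ℚ
    eq₂′ = RingSolver.solve-∀ ℚ-ring

  genβ≡ : ∀ x y q → x ≡ (+ 2 * q + y) * + d →
          genβ x y ≡ ⟨ ½ , ℚ.- ½ , ι q ℚ.+ ½ ℚ.* ι y , δ ℚ.* (½ ℚ.* ι y) ⟩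
  genβ≡ x y q x≡ = begin
    γ₁ ⊖ γ₂ ⊕ ((x ℤ.- + d * y) / (2 ℕ.* d)) · γ₃ ⊕ ι y · (½ · (√n ⊕ δ · (√m ⊗ √n)))
      ≡⟨ cong₂ (λ u v → γ₁ ⊖ γ₂ ⊕ u · γ₃ ⊕ ι y · (½ · (√n ⊕ δ · v))) quotient≡ √m√n ⟩
    γ₁ ⊖ γ₂ ⊕ ι q · γ₃ ⊕ ι y · (½ · (√n ⊕ δ · ⟨ 0ℚ , 0ℚ , 0ℚ , 1ℚ ⟩))
      ≡⟨ ext (eq₁ (ι q) (ι y) δ) (eq₂ (ι q) (ι y) δ) (eq₃ (ι q) (ι y) δ) (eq₄ (ι q) (ι y) δ) ⟩
    ⟨ ½ , ℚ.- ½ , ι q ℚ.+ ½ ℚ.* ι y , δ ℚ.* (½ ℚ.* ι y) ⟩ ∎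
    where
    quotient≡ : (x ℤ.- + d * y) / (2 ℕ.* d) ≡ ι q
    quotient≡ = trans (cong (_/ (2 ℕ.* d)) (trans (cong (ℤ._- + d * y) x≡)
      (trans (collect (+ d) q y) (cong (q *_) (sym (ℤ.pos-* 2 d)))))) (ι[q*d/d]≡q q (2 ℕ.* d))
      where
      collect : ∀ d q y → (+ 2 * q + y) * d + - (d * y) ≡ q * (+ 2 * d)
      collect = solve-∀
    eq₁ : ∀ q y δ → ½ ℚ.+ q ℚ.* 0ℚ ℚ.+ y ℚ.* (½ ℚ.* (0ℚ ℚ.+ δ ℚ.* 0ℚ)) ≡ ½
    eq₁ = RingSolver.solve-∀ ℚ-ring
    eq₂ : ∀ q y δ → ℚ.- ½ ℚ.+ q ℚ.* 0ℚ ℚ.+ y ℚ.* (½ ℚ.* (0ℚ ℚ.+ δ ℚ.* 0ℚ)) ≡ ℚ.- ½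
    eq₂ = RingSolver.solve-∀ ℚ-ring
    eq₃ : ∀ q y δ → 0ℚ ℚ.+ q ℚ.* 1ℚ ℚ.+ y ℚ.* (½ ℚ.* (1ℚ ℚ.+ δ ℚ.* 0ℚ)) ≡ q ℚ.+ ½ ℚ.* y
    eq₃ = RingSolver.solve-∀ ℚ-ring
    eq₄ : ∀ q y δ → 0ℚ ℚ.+ q ℚ.* 0ℚ ℚ.+ y ℚ.* (½ ℚ.* (0ℚ ℚ.+ δ ℚ.* 1ℚ)) ≡ δ ℚ.* (½ ℚ.* y)
    eq₄ = RingSolver.solve-∀ ℚ-ring

-- The residue hypotheses and the theorem

1-mod-4 : ∀ m → m %ℕ 4 ≡ 1 → m ≡ + 1 + m /ℕ 4 * + 4
1-mod-4 m m%4≡1 = trans (a≡a%ℕn+[a/ℕn]*n m 4) (cong (λ r → + r + m /ℕ 4 * + 4) m%4≡1)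

2,3-mod-4 : ∀ n → n %ℕ 4 ≡ 2 ⊎ n %ℕ 4 ≡ 3 → + 4 ∣ (n + - + 2) * (n + - + 3)
2,3-mod-4 n = [ (λ eq → divides ((n /ℕ 4) * (n + - + 3))
  (trans (cong (λ z → (z + - + 2) * (n + - + 3)) (at 2 eq)) (eq₁ (n /ℕ 4) n)))
              , (λ eq → divides ((n + - + 2) * (n /ℕ 4)) (trans
                (cong (λ z → (n + - + 2) * (z + - + 3)) (at 3 eq)) (eq₂ (n /ℕ 4) n))) ]′
  where
  at : ∀ r → n %ℕ 4 ≡ r → n ≡ + r + n /ℕ 4 * + 4
  at r eq = trans (a≡a%ℕn+[a/ℕn]*n n 4) (cong (λ r → + r + n /ℕ 4 * + 4) eq)
  eq₁ : ∀ q n → (+ 2 + q * + 4 + - + 2) * (n + - + 3) ≡ q * (n + - + 3) * + 4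
  eq₁ = solve-∀
  eq₂ : ∀ q n → (n + - + 2) * (+ 3 + q * + 4 + - + 3) ≡ (n + - + 2) * q * + 4
  eq₂ = solve-∀

proposition5p5 : (m n : ℤ) .{{_ : NonZero m}} .{{_ : NonZero n}} →
    let module B = Biquadratic m n in
    B.IsBiquadraticField →
    SquareFree m → SquareFree n →
    m %ℕ 4 ≡ 1 → (n %ℕ 4 ≡ 2 ⊎ n %ℕ 4 ≡ 3) →
    let Solves : ℤ → ℤ → Set
        Solves x y = (x * x + m * (y * y) ≡ + (2 *ℕ B.d))
                   ⊎ (x * x + m * (y * y) ≡ - (+ (2 *ℕ B.d)))
    in
    (B.IsFree B.H₁ ⇔ (∃[ x ] ∃[ y ] Solves x y))
    × (∀ x y → Solves x y → B.IsFreeGenerator B.H₁ (B.genβ x y))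
proposition5p5 m n _ sqf-m sqf-n m%4≡1 n%4≡2,3 =
  conclude (∣ᵤ⇒∣ {+ B.d} {m} (ℕ.gcd[m,n]∣m ∣ m ∣ ∣ n ∣)) (∣ᵤ⇒∣ {+ B.d} {n} (ℕ.gcd[m,n]∣n ∣ m ∣ ∣ n ∣))
  where
  module B = Biquadratic m n
  open B using (d-nonZero)
  Solves : ℤ → ℤ → Set
  Solves x y = (x * x + m * (y * y) ≡ + (2 *ℕ B.d)) ⊎ (x * x + m * (y * y) ≡ - (+ (2 *ℕ B.d)))
  Conclusion : Set
  Conclusion = (B.IsFree B.H₁ ⇔ (∃[ x ] ∃[ y ] Solves x y)) ×
    (∀ x y → Solves x y → B.IsFreeGenerator B.H₁ (B.genβ x y))
  conclude : + B.d ∣ m → + B.d ∣ n → Conclusion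
  conclude (divides m′ m≡m′d) (divides n′ n≡n′d) = from-κ (proj₁ (cofactors (+ B.d) m′ n′
      (subst (λ m → + 4 ∣ m + - + 1) m≡m′d (divides (m /ℕ 4)
        (trans (cong (_+ - + 1) (1-mod-4 m m%4≡1)) (cancel (m /ℕ 4)))))
      (subst (λ n → + 4 ∣ (n + - + 2) * (n + - + 3)) n≡n′d (2,3-mod-4 n n%4≡2,3))))
    where
    cancel : ∀ μ → + 1 + μ * + 4 + - + 1 ≡ μ * + 4
    cancel = solve-∀
    from-κ : + 4 ∣ + B.d + m′ + - + 2 → Conclusion
    -- The quotient here is `κ = (d + m′ - 2) / 4`, the remaining parameter of `IntegralBasis`.
    from-κ (divides κ d+m′-2≡) =
      mk⇔ (λ (β , β-generates) → S.generator⇒solvable β β-generates)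
        (λ (x , y , solves) → B.genβ x y , generates x y solves) , generates
      where
      restore : ∀ z → z ≡ + 2 + (z + - + 2)
      restore = solve-∀
      module S = IntegralBasis m n B.d m′ n′ (+ 1 / B.d) m≡m′d n≡n′d (1/d*d≡1 B.d)
        (λ b∣m b∣n → ℕ.gcd-greatest b∣m b∣n)
        sqf-m sqf-n (m /ℕ 4) κ (1-mod-4 m m%4≡1) (trans (restore (+ B.d + m′)) (cong (λ z → + 2 + z) d+m′-2≡))
          (2,3-mod-4 n n%4≡2,3)
      generates : ∀ x y → Solves x y → B.IsFreeGenerator B.H₁ (B.genβ x y)
      generates x y solves = from-solution (S.solves⇒generator x y solves)
        where
        from-solution : _ → B.IsFreeGenerator B.H₁ (B.genβ x y)
        from-solution (q , x≡ , generator) = subst (B.IsFreeGenerator B.H₁)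
          (sym (GeneratorCoordinates.genβ≡ m n x y q x≡)) generator
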